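{- Let $2<n<\omega$ and let $\mathcal T$ be any signature between $\mathsf{Df}_n$ and $\mathsf{PEA}_n$. Then the class of strongly representable atom structures of type $\mathcal T$ is not elementary.
   Context: $\mathsf{Df}_n$ has the Boolean operations and cylindrifiers $c_i$ ($i<n$); $\mathsf{PEA}_n$ has in addition the diagonal constants $d_{ij}$, replacements $s^i_j$ and transpositions $s_{ij}$ ($i,j<n$). A signature between them contains the $\mathsf{Df}_n$ operations together with some of the families $(d_{ij})$, $(s^i_j)$, $(s_{ij})$; e.g. $\mathsf{Df}$ ($c_i$), $\mathsf{Sc}$ ($c_i,s^i_j$), $\mathsf{CA}$ ($c_i,d_{ij}$), $\mathsf{QA}=\mathsf{PA}$ ($c_i,s^i_j,s_{ij}$), $\mathsf{PEA}$ (all). An algebra of type $\mathcal T$ is representable if it is isomorphic to a subalgebra of a direct product of set algebras of the same type, where in a set algebra with unit ${}^nU$ (or $U_0\times\dots\times U_{n-1}$ for $\mathsf{Df}_n$): $c_iX=\{s:\exists t\in X,\ t_j=s_j\ \forall j\neq i\}$, $d_{ij}=\{s:s_i=s_j\}$, $s^i_jX=\{s:s\circ[i|j]\in X\}$, $s_{ij}X=\{s:s\circ[i,j]\in X\}$, with $[i|j]$ the map sending $i$ to $j$ and fixing the rest, $[i,j]$ the transposition. An atom structure of type $\mathcal T$ is a relational structure $\mathcal S$ with a binary relation for each of the unary operators $c_i$, $s^i_j$, $s_{ij}$ in $\mathcal T$ and a unary relation for each $d_{ij}$ in $\mathcal T$; the atom structure $\mathrm{At}\mathfrak A$ of an atomic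 algebra $\mathfrak A$ has the atoms as universe, with $R_\Omega(a,b)\iff\Omega(b)\ge a$ and $R_{d_{ij}}(a)\iff a\le d_{ij}$. $\mathcal S$ is strongly representable if every atomic $n$-dimensional algebra $\mathfrak A$ of type $\mathcal T$ with $\mathrm{At}\mathfrak A=\mathcal S$ is representable; equivalently, the complex algebra $\mathfrak{Cm}\mathcal S$ is representable. -}

module Defs where

open import Level using (Level; _⊔_; suc; Lift)
open import Algebra.Lattice.Structures using (IsBooleanAlgebra)
open import Data.Bool.Base using (Bool; false; T; if_then_else_)
open import Data.Empty using (⊥)
open import Data.Fin.Base using (Fin)
open import Data.Fin.Permutation.Components using (transpose)
open import Data.Fin.Properties using (_≟_)
open import Data.Nat.Base using (ℕ)
open import Data.Product.Base using (Σ; Σ-syntax; ∃-syntax; _×_; _,_; proj₁)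
open import Data.Sum.Base using (_⊎_)
open import Data.Unit.Base using (⊤)
open import Data.Vec.Functional using (_∷_; [])
open import Function.Base using (_∘_; _on_)
open import Function.Bundles using (_⇔_; Bijection)
open import Function.Definitions using (Bijective)
open import Relation.Binary.Bundles using (Setoid)
open import Relation.Binary.Core using (Rel; _Preserves_⟶_)
open import Relation.Binary.Definitions using (_Respects_; _Respects₂_)
open import Relation.Binary.PropositionalEquality.Core using (_≡_; _≢_; refl)
open import Relation.Nullary using (¬_; does)
open import Relation.Unary using (Pred)

-- Which of the families d_ij, s^i_j, s_ij are added to the Df_n operations.

record Signature : Set where
  constructor signature
  field
    hasDiag hasRepl hasTrans : Bool

open Signature

Df : Signature
Df = signature false false false

data Constant (n : ℕ) (σ : Signature) : Set where
  diag : T (hasDiag σ) → Fin n → Fin n → Constant n σ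

-- repl _ i j is s^i_j and trans _ i j is s_ij.

data Operator (n : ℕ) (σ : Signature) : Set where
  cyl   : Fin n → Operator n σ
  repl  : T (hasRepl σ) → Fin n → Fin n → Operator n σ
  trans : T (hasTrans σ) → Fin n → Fin n → Operator n σ

record RawAlgebra (n : ℕ) (σ : Signature) (c e : Level) : Set (suc (c ⊔ e)) where
  infix  4 _≈_ _≤_
  infixr 7 _∧_
  infixr 6 _∨_
  field
    Carrier : Set c
    _≈_     : Rel Carrier e
    _∨_ _∧_ : Carrier → Carrier → Carrier
    ∁       : Carrier → Carrier
    𝟙 𝟘     : Carrier
    op      : Operator n σ → Carrier → Carrier
    const   : Constant n σ → Carrier

  _≤_ : Rel Carrier e
  x ≤ y = x ∧ y ≈ x

  IsSupremum : ∀ {k} {K : Set k} → (K → Carrier) → Carrier → Set (c ⊔ e ⊔ k)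
  IsSupremum x y = (∀ k → x k ≤ y) × (∀ z → (∀ k → x k ≤ z) → y ≤ z)

  IsAtom : Pred Carrier (c ⊔ e)
  IsAtom a = ¬ (a ≈ 𝟘) × (∀ x → x ≤ a → (x ≈ 𝟘) ⊎ (x ≈ a))

  Atomic : Set (c ⊔ e)
  Atomic = ∀ x → ¬ (x ≈ 𝟘) → ∃[ a ] (IsAtom a × a ≤ x)

-- The operators of an algebra are required to be completely additive: they
-- preserve all existing suprema, in particular the empty one (normality).
-- This is what makes an atomic algebra a subalgebra of the complex algebra of
-- its atom structure. Without it, an atom structure would say nothing about
-- the values of the operators on infinite suprema of atoms.

record Algebra (n : ℕ) (σ : Signature) (c e : Level) : Set (suc (c ⊔ e)) where
  field
    raw : RawAlgebra n σ c e
  open RawAlgebra raw public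
  field
    isBooleanAlgebra   : IsBooleanAlgebra _≈_ _∨_ _∧_ ∁ 𝟙 𝟘
    op-cong            : ∀ Ω → op Ω Preserves _≈_ ⟶ _≈_
    completelyAdditive : ∀ Ω {K : Set (c ⊔ e)} (x : K → Carrier) y →
                         IsSupremum x y → IsSupremum (op Ω ∘ x) (op Ω y)
  open IsBooleanAlgebra isBooleanAlgebra public
    using () renaming (refl to ≈-refl; sym to ≈-sym; trans to ≈-trans;
                       isEquivalence to ≈-isEquivalence;
                       ∨-cong to ∨-congruent; ∧-cong to ∧-congruent)

record IsHomomorphism {n σ c e c′ e′}
  (A : RawAlgebra n σ c e) (B : RawAlgebra n σ c′ e′)
  (f : RawAlgebra.Carrier A → RawAlgebra.Carrier B) : Set (c ⊔ e ⊔ e′) where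
  private
    module A = RawAlgebra A
    module B = RawAlgebra B
  field
    cong    : f Preserves A._≈_ ⟶ B._≈_
    ∨-homo  : ∀ x y → f (x A.∨ y) B.≈ (f x B.∨ f y)
    ∧-homo  : ∀ x y → f (x A.∧ y) B.≈ (f x B.∧ f y)
    ∁-homo  : ∀ x → f (A.∁ x) B.≈ B.∁ (f x)
    𝟙-homo  : f A.𝟙 B.≈ B.𝟙
    𝟘-homo  : f A.𝟘 B.≈ B.𝟘
    op-homo : ∀ Ω x → f (A.op Ω x) B.≈ B.op Ω (f x)
    const-homo : ∀ d → f (A.const d) B.≈ B.const d

record _≅_ {n σ c e c′ e′} (A : RawAlgebra n σ c e) (B : RawAlgebra n σ c′ e′)
  : Set (c ⊔ e ⊔ c′ ⊔ e′) where
  field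
    to             : RawAlgebra.Carrier A → RawAlgebra.Carrier B
    isHomomorphism : IsHomomorphism A B to
    bijective      : Bijective (RawAlgebra._≈_ A) (RawAlgebra._≈_ B) to

record Subuniverse {n σ c e} (A : RawAlgebra n σ c e) (p : Level)
  : Set (c ⊔ e ⊔ suc p) where
  open RawAlgebra A
  field
    Mem          : Pred Carrier p
    respects     : Mem Respects _≈_
    ∨-closed     : ∀ {x y} → Mem x → Mem y → Mem (x ∨ y)
    ∧-closed     : ∀ {x y} → Mem x → Mem y → Mem (x ∧ y)
    ∁-closed     : ∀ {x} → Mem x → Mem (∁ x)
    𝟙-closed     : Mem 𝟙
    𝟘-closed     : Mem 𝟘
    op-closed    : ∀ Ω {x} → Mem x → Mem (op Ω x)
    const-closed : ∀ d → Mem (const d)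

subalgebra : ∀ {n σ c e p} (A : RawAlgebra n σ c e) →
             Subuniverse A p → RawAlgebra n σ (c ⊔ p) e
subalgebra A S = record
  { Carrier = Σ A.Carrier S.Mem
  ; _≈_     = A._≈_ on proj₁
  ; _∨_     = λ (x , p) (y , q) → (x A.∨ y) , S.∨-closed p q
  ; _∧_     = λ (x , p) (y , q) → (x A.∧ y) , S.∧-closed p q
  ; ∁       = λ (x , p) → A.∁ x , S.∁-closed p
  ; 𝟙       = A.𝟙 , S.𝟙-closed
  ; 𝟘       = A.𝟘 , S.𝟘-closed
  ; op      = λ Ω (x , p) → A.op Ω x , S.op-closed Ω p
  ; const   = λ d → A.const d , S.const-closed d
  }
  where
  module A = RawAlgebra A
  module S = Subuniverse S

directProduct : ∀ {n σ i c e} (I : Set i) → (I → RawAlgebra n σ c e) →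
                RawAlgebra n σ (i ⊔ c) (i ⊔ e)
directProduct I A = record
  { Carrier = ∀ i → A.Carrier i
  ; _≈_     = λ x y → ∀ i → A._≈_ i (x i) (y i)
  ; _∨_     = λ x y i → A._∨_ i (x i) (y i)
  ; _∧_     = λ x y i → A._∧_ i (x i) (y i)
  ; ∁       = λ x i → A.∁ i (x i)
  ; 𝟙       = λ i → A.𝟙 i
  ; 𝟘       = λ i → A.𝟘 i
  ; op      = λ Ω x i → A.op i Ω (x i)
  ; const   = λ d i → A.const i d
  }
  where
  module A i = RawAlgebra (A i)

-- A square base U gives the unit ⁿU; a rectangle gives U_0 × … × U_{n-1} and
-- is available only when the signature is exactly that of Df_n.

data Base (n : ℕ) (σ : Signature) (u : Level) : Set (suc u) where
  square    : Set u → Base n σ u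
  rectangle : σ ≡ Df → (Fin n → Set u) → Base n σ u

module _ {n : ℕ} {σ : Signature} {u : Level} where

  Sort : Base n σ u → Fin n → Set u
  Sort (square U)      _ = U
  Sort (rectangle _ U) i = U i

  Unit : Base n σ u → Set u
  Unit b = (i : Fin n) → Sort b i

  [_∣_] : Fin n → Fin n → Fin n → Fin n
  [ i ∣ j ] k = if does (k ≟ i) then j else k

  setOp : (b : Base n σ u) → Operator n σ → Pred (Unit b) u → Pred (Unit b) u
  setOp b          (cyl i)       X s = ∃[ t ] (X t × (∀ j → j ≢ i → t j ≡ s j))
  setOp (square _) (repl _ i j)  X s = X (s ∘ [ i ∣ j ])
  setOp (square _) (trans _ i j) X s = X (s ∘ transpose i j)
  setOp (rectangle refl _) (repl () _ _)
  setOp (rectangle refl _) (trans () _ _)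

  setConst : (b : Base n σ u) → Constant n σ → Pred (Unit b) u
  setConst (square _) (diag _ i j) s = s i ≡ s j
  setConst (rectangle refl _) (diag () _ _)

  setAlgebra : Base n σ u → RawAlgebra n σ (suc u) u
  setAlgebra b = record
    { Carrier = Pred (Unit b) u
    ; _≈_     = λ X Y → ∀ s → X s ⇔ Y s
    ; _∨_     = λ X Y s → X s ⊎ Y s
    ; _∧_     = λ X Y s → X s × Y s
    ; ∁       = λ X s → ¬ X s
    ; 𝟙       = λ _ → Lift u ⊤
    ; 𝟘       = λ _ → Lift u ⊥
    ; op      = setOp b
    ; const   = setConst b
    }

Representable : ∀ {n σ c e} → RawAlgebra n σ c e → Set (suc (c ⊔ e))
Representable {n} {σ} {c} {e} A =
  Σ[ I ∈ Set r ] Σ[ b ∈ (I → Base n σ r) ]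
  Σ[ S ∈ Subuniverse (directProduct I (setAlgebra ∘ b)) r ]
    A ≅ subalgebra (directProduct I (setAlgebra ∘ b)) S
  where
  r : Level
  r = c ⊔ e

record AtomStructure (n : ℕ) (σ : Signature) (a e r : Level)
  : Set (suc (a ⊔ e ⊔ r)) where
  field
    universe   : Setoid a e
  open Setoid universe public using (Carrier; _≈_)
  field
    R          : Operator n σ → Rel Carrier r
    D          : Constant n σ → Pred Carrier r
    R-respects : ∀ Ω → R Ω Respects₂ _≈_
    D-respects : ∀ d → D d Respects _≈_

record _≅ₛ_ {n σ a e r a′ e′ r′}
  (S : AtomStructure n σ a e r) (S′ : AtomStructure n σ a′ e′ r′)
  : Set (a ⊔ e ⊔ r ⊔ a′ ⊔ e′ ⊔ r′) where
  private
    module S  = AtomStructure S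
    module S′ = AtomStructure S′
  field
    bijection : Bijection S.universe S′.universe
  open Bijection bijection public
  field
    R-iso : ∀ Ω x y → S.R Ω x y ⇔ S′.R Ω (to x) (to y)
    D-iso : ∀ d x → S.D d x ⇔ S′.D d (to x)

At : ∀ {n σ c e} → Algebra n σ c e → AtomStructure n σ (c ⊔ e) e e
At 𝔄 = record
  { universe   = record
      { Carrier       = Σ Carrier IsAtom
      ; _≈_           = _≈_ on proj₁
      ; isEquivalence = record { refl = ≈-refl ; sym = ≈-sym ; trans = ≈-trans }
      }
  ; R          = λ Ω (a , _) (b , _) → a ≤ op Ω b
  ; D          = λ d (a , _) → a ≤ const d
  ; R-respects = λ Ω → (λ b≈b′ → ≤-resp ≈-refl (op-cong Ω b≈b′))
                     , (λ a≈a′ → ≤-resp a≈a′ ≈-refl)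
  ; D-respects = λ d a≈a′ → ≤-resp a≈a′ ≈-refl
  }
  where
  open Algebra 𝔄
  ≤-resp : ∀ {x x′ y y′} → x ≈ x′ → y ≈ y′ → x ≤ y → x′ ≤ y′
  ≤-resp x≈x′ y≈y′ x≤y =
    ≈-trans (∧-congruent (≈-sym x≈x′) (≈-sym y≈y′)) (≈-trans x≤y x≈x′)

-- "At 𝔄 = S" is read up to isomorphism. The algebras have carriers one level
-- up, where the complex algebra of S (all subsets of S) lives.

StronglyRepresentable : ∀ {n σ ℓ} → AtomStructure n σ ℓ ℓ ℓ → Set (suc (suc ℓ))
StronglyRepresentable {n} {σ} {ℓ} S =
  (𝔄 : Algebra n σ (suc ℓ) ℓ) → Algebra.Atomic 𝔄 → At 𝔄 ≅ₛ S →
  Representable (Algebra.raw 𝔄)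

-- Formula n σ m has its free variables among m de Bruijn indices; _≐_ is
-- equality. The other connectives and ∃ are classically definable from these.

data Formula (n : ℕ) (σ : Signature) (m : ℕ) : Set where
  _≐_   : Fin m → Fin m → Formula n σ m
  rel   : Operator n σ → Fin m → Fin m → Formula n σ m
  unary : Constant n σ → Fin m → Formula n σ m
  ⊥′    : Formula n σ m
  _⇒′_  : Formula n σ m → Formula n σ m → Formula n σ m
  ∀′    : Formula n σ (ℕ.suc m) → Formula n σ m

Sentence : ℕ → Signature → Set
Sentence n σ = Formula n σ 0

module _ {n σ ℓ} (S : AtomStructure n σ ℓ ℓ ℓ) where
  open AtomStructure S

  Satisfies : ∀ {m} → (Fin m → Carrier) → Formula n σ m → Set ℓ
  Satisfies v (x ≐ y)     = v x ≈ v y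
  Satisfies v (rel Ω x y) = R Ω (v x) (v y)
  Satisfies v (unary d x) = D d (v x)
  Satisfies v ⊥′          = Lift ℓ ⊥
  Satisfies v (φ ⇒′ ψ)    = Satisfies v φ → Satisfies v ψ
  Satisfies v (∀′ φ)      = ∀ a → Satisfies (a ∷ v) φ

  _⊨_ : Sentence n σ → Set ℓ
  _⊨_ φ = Satisfies [] φ

Elementary : ∀ {n σ ℓ k} → Pred (AtomStructure n σ ℓ ℓ ℓ) k → Set (suc ℓ ⊔ k)
Elementary {n} {σ} {ℓ} K =
  Σ[ Γ ∈ Pred (Sentence n σ) ℓ ] (∀ S → K S ⇔ (∀ φ → Γ φ → S ⊨ φ))

{-# OPTIONS --safe #-}

-- Given a graph V, consider structures in which every set of n - 1 points (a
-- face) is labelled by a vertex of V, the faces of n distinct points never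
-- being labelled by an independent set. The isomorphism types of labelled
-- n-tuples form an atom structure.
--
-- If V has a finite colouring, the complex algebra of this atom structure is
-- not representable, not even as a Df-algebra: an element for each colour would
-- colour the faces of an infinite set, and by Ramsey's theorem some n points
-- would have all their faces of one colour. If V has no finite colouring, some
-- ultrafilter on V contains no independent set. A representation of the complex
-- algebra is then built by adjoining witnesses for all cylindrifications, faces
-- being labelled by ultrafilters and new faces by the special one.
--
-- Let V_k consist of finitely many copies, completely joined to each other, of
-- the shift graph on (k+1)-tuples. It has no finite colouring, and the shift
-- graph has no closed walk of odd length at most k. So the labels in an
-- ultraproduct of these atom structures have a finite colouring, while the
-- ultraproduct satisfies every sentence true in all factors.

module Submission where

open import Defs
open import Level using (Level; _⊔_; Lift; lift; lower; 0ℓ)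
open import Axiom.ExcludedMiddle using (ExcludedMiddle)
open import Axiom.Extensionality.Propositional using (Extensionality)
open import Data.Bool.Base using (Bool; true; false; not)
open import Data.Empty using (⊥; ⊥-elim)
open import Data.Fin.Base as Fin using (Fin; zero; suc; toℕ; fromℕ<)
import Data.Fin.Properties as Finₚ
open import Data.Fin.Properties using (_≟_)
open import Data.Nat using (ℕ; zero; suc; _+_; _*_; _^_; _<_; z≤n; s≤s)
import Data.Nat.Base as ℕ
import Data.Nat.Properties as ℕₚ
open import Data.Product.Base using (Σ; Σ-syntax; ∃; ∃-syntax; _×_; _,_; proj₁; proj₂)
open import Data.Sum.Base as Sum using (_⊎_; inj₁; inj₂)
open import Data.Unit.Base using (⊤; tt)
open import Function.Base using (_∘_; id)
open import Function.Bundles using (_⇔_; mk⇔; Equivalence)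
open import Relation.Binary.PropositionalEquality
  using (_≡_; _≢_; refl; sym; cong; cong₂; subst; subst₂; module ≡-Reasoning) renaming (trans to ≡-trans)
open import Relation.Nullary using (¬_; Dec; yes; no)
open import Relation.Unary using (Pred)

open Equivalence using (to; from)

-- A tuple of the representation cannot simply be given an atom: the complex algebra contains all
-- sets of atoms, so a tuple determines an ultrafilter of such sets. These come from ultrafilters on
-- labellings of all faces, and tuples that share a face only have to induce the same ultrafilter of
-- labels on it. The obstacle is validity. Among the ultrafilters on the faces of `n` distinct
-- points some two must be joined by edges, in the sense that any two large sets are. The special
-- ultrafilter is joined to itself, but it need not be joined to an ultrafilter that some witness
-- has brought in. The copies repair this: ultrafilters living on different copies are always
-- joined. A new face meets at most `n * 2 ^ n` older ultrafilters, each living on one copy, so one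
-- copy more than that leaves a free one. The number of copies does not depend on `k`. In the limit
-- the shift graphs lose all odd closed walks and become bipartite, so two colours per copy suffice
-- there. Large odd girth is therefore enough, and shift graphs are an explicit family that has it
-- together with unbounded chromatic number in every finite sense.

module _ (em : ∀ {a} → ExcludedMiddle a) (ext : ∀ {a b} → Extensionality a b) where

  -- Classical logic and Boolean-valued predicates.

  module Classical where
    open import Data.Bool.Base using (_∧_)
    open import Relation.Nullary using (does)

    private variable
      a b p q : Level

    -- Unlike T, a record type constructor is injective, so unification can read off
    -- the Boolean.
    record Holds (x : Bool) : Set where
      constructor holds
      field isTrue : x ≡ true
    open Holds

    -- Excluded middle is assumed for all types, so it makes every predicate Boolean
    -- whatever its level, and it provides choice functions.
    abstract
      ⌊_⌋ : Set p → Bool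
      ⌊ P ⌋ = does (em {P = P})

      ⌊⌋⁺ : {P : Set p} → P → Holds ⌊ P ⌋
      ⌊⌋⁺ {P = P} x with em {P = P}
      ... | yes _ = holds refl
      ... | no ¬x = ⊥-elim (¬x x)

      ⌊⌋⁻ : {P : Set p} → Holds ⌊ P ⌋ → P
      ⌊⌋⁻ {P = P} t with em {P = P}
      ... | yes x = x
      ... | no _  with () ← isTrue t

    ¬¬-elim : {P : Set p} → ¬ ¬ P → P
    ¬¬-elim {P = P} ¬¬x with em {P = P}
    ... | yes x = x
    ... | no ¬x = ⊥-elim (¬¬x ¬x)

    ¬∀⇒∃¬ : {A : Set a} {P : A → Set p} → ¬ (∀ x → P x) → ∃[ x ] ¬ P x
    ¬∀⇒∃¬ ¬∀ = ¬¬-elim λ ¬∃ → ¬∀ λ x → ¬¬-elim λ ¬px → ¬∃ (x , ¬px)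

    Holds-ext : ∀ {x y} → (Holds x → Holds y) → (Holds y → Holds x) → x ≡ y
    Holds-ext {false} {false} _ _ = refl
    Holds-ext {false} {true}  _ g = isTrue (g (holds refl))
    Holds-ext {true}  {false} f _ = sym (isTrue (f (holds refl)))
    Holds-ext {true}  {true}  _ _ = refl

    subset-ext : {A : Set a} {X Y : A → Bool} →
                 (∀ x → Holds (X x) → Holds (Y x)) → (∀ x → Holds (Y x) → Holds (X x)) → X ≡ Y
    subset-ext f g = ext λ x → Holds-ext (f x) (g x)

    Holds-not⁺ : ∀ {x} → ¬ Holds x → Holds (not x)
    Holds-not⁺ {false} _ = holds refl
    Holds-not⁺ {true}  f = ⊥-elim (f (holds refl))

    Holds-not⁻ : ∀ {x} → Holds (not x) → ¬ Holds x
    Holds-not⁻ {false} _ t with () ← isTrue t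
    Holds-not⁻ {true}  t _ with () ← isTrue t

    abstract
      infixr 7 _∩_
      _∩_ : {A : Set a} → (A → Bool) → (A → Bool) → A → Bool
      (X ∩ Y) x = X x ∧ Y x

      ∩⁺ : {A : Set a} {X Y : A → Bool} {x : A} → Holds (X x) → Holds (Y x) → Holds ((X ∩ Y) x)
      ∩⁺ (holds s) (holds t) = holds (cong₂ _∧_ s t)

      ∩⁻ : {A : Set a} {X Y : A → Bool} {x : A} → Holds ((X ∩ Y) x) → Holds (X x) × Holds (Y x)
      ∩⁻ {X = X} {x = x} (holds t) with X x
      ... | true = holds refl , holds t

    bit : Bool → Fin 2
    bit false = zero
    bit true  = suc zero

    bit-injective : ∀ {x y} → bit x ≡ bit y → x ≡ y
    bit-injective {false} {false} _ = refl
    bit-injective {true}  {true}  _ = refl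
    bit-injective {false} {true}  ()
    bit-injective {true}  {false} ()

  open Classical

  -- Ultrafilters and the ultrafilter lemma.

  module Ultrafilters where
    private variable
      a b p q : Level

    -- Zermelo's argument: as next is inflationary, the stages form a chain, and their
    -- union is a fixed point of next.
    module Tower {Q : Set a} (bottom : Q → Bool) (next : (Q → Bool) → (Q → Bool)) where

      infix 4 _⊑_
      _⊑_ : (Q → Bool) → (Q → Bool) → Set a
      F ⊑ G = ∀ y → Holds (F y) → Holds (G y)

      -- Including `bottom` makes the empty union the initial stage, so `Stage` has no separate
      -- constructor for it.
      union : ((Q → Bool) → Bool) → Q → Bool
      union C y = ⌊ Holds (bottom y) ⊎ (∃[ F ] (Holds (C F) × Holds (F y))) ⌋

      data Stage : (Q → Bool) → Set a where
        step  : ∀ {F} → Stage F → Stage (next F)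
        limit : ∀ C → (∀ F → Holds (C F) → Stage F) → Stage (union C)

      module Inflationary (inflate : ∀ F → F ⊑ next F) where

        bottom⊑ : ∀ {F} → Stage F → bottom ⊑ F
        bottom⊑ (step s)    y t = inflate _ y (bottom⊑ s y t)
        bottom⊑ (limit C _) y t = ⌊⌋⁺ (inj₁ t)

        ⊑-trans : ∀ {F G H} → F ⊑ G → G ⊑ H → F ⊑ H
        ⊑-trans f g y t = g y (f y t)

        -- The extreme points of the Bourbaki-Witt argument: nothing strictly below `F` jumps past
        -- it under `next`. An extreme stage is comparable with all stages, and by induction every
        -- stage is extreme.
        Extreme : (Q → Bool) → Set a
        Extreme F = ∀ {G} → Stage G → G ⊑ F → ¬ (F ⊑ G) → next G ⊑ F

        extreme⇒comparable : ∀ {F} → Stage F → Extreme F → ∀ {G} → Stage G → G ⊑ F ⊎ next F ⊑ G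
        extreme⇒comparable {F} sF eF (step {G} sG) with extreme⇒comparable sF eF sG
        ... | inj₂ F⁺⊑G = inj₂ (⊑-trans F⁺⊑G (inflate G))
        ... | inj₁ G⊑F with em {P = F ⊑ G}
        ...   | no ¬F⊑G = inj₁ (eF sG G⊑F ¬F⊑G)
        -- `next` need not be monotone, so the two inclusions are first turned into an equality.
        ...   | yes F⊑G = inj₂ (subst (λ H → next F ⊑ next H) (subset-ext F⊑G G⊑F) λ _ t → t)
        extreme⇒comparable {F} sF eF (limit C sC) with em {P = ∀ G → Holds (C G) → G ⊑ F}
        ... | yes all = inj₁ λ y t → bounded y (⌊⌋⁻ t)
          where
          bounded : ∀ y → Holds (bottom y) ⊎ (∃[ G ] (Holds (C G) × Holds (G y))) → Holds (F y)
          bounded y (inj₁ t)            = bottom⊑ sF y t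
          bounded y (inj₂ (G , c , t)) = all G c y t
        ... | no ¬all with ¬∀⇒∃¬ ¬all
        ...   | G , ¬c with em {P = Holds (C G)}
        ...     | no ¬cG = ⊥-elim (¬c λ c → ⊥-elim (¬cG c))
        ...     | yes c with extreme⇒comparable sF eF (sC G c)
        ...       | inj₁ G⊑F = ⊥-elim (¬c λ _ → G⊑F)
        ...       | inj₂ F⁺⊑G = inj₂ λ y t → ⌊⌋⁺ (inj₂ (G , c , F⁺⊑G y t))

        extreme : ∀ {F} → Stage F → Extreme F
        extreme (step {F} sF) {G} sG G⊑F⁺ ¬F⁺⊑G with extreme⇒comparable sF (extreme sF) sG
        ... | inj₂ F⁺⊑G = ⊥-elim (¬F⁺⊑G F⁺⊑G)
        ... | inj₁ G⊑F with em {P = F ⊑ G}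
        ...   | no ¬F⊑G = ⊑-trans (extreme sF sG G⊑F ¬F⊑G) (inflate F)
        ...   | yes F⊑G = subst (λ H → next G ⊑ next H) (subset-ext G⊑F F⊑G) λ _ t → t
        extreme (limit C sC) {G} sG G⊑∪ ¬∪⊑G with em {P = ∀ F → Holds (C F) → F ⊑ G}
        ... | yes all = ⊥-elim (¬∪⊑G λ y t → bounded y (⌊⌋⁻ t))
          where
          bounded : ∀ y → Holds (bottom y) ⊎ (∃[ F ] (Holds (C F) × Holds (F y))) → Holds (G y)
          bounded y (inj₁ t)            = bottom⊑ sG y t
          bounded y (inj₂ (F , c , t)) = all F c y t
        ... | no ¬all with ¬∀⇒∃¬ ¬all
        ...   | F , ¬c with em {P = Holds (C F)}
        ...     | no ¬cF = ⊥-elim (¬c λ c → ⊥-elim (¬cF c))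
        ...     | yes c with extreme⇒comparable (sC F c) (extreme (sC F c)) sG
        ...       | inj₂ F⁺⊑G = ⊥-elim (¬c λ _ → ⊑-trans (inflate F) F⁺⊑G)
        ...       | inj₁ G⊑F = λ y t →
                      ⌊⌋⁺ (inj₂ (F , c , extreme (sC F c) sG G⊑F (λ F⊑G → ¬c λ _ → F⊑G) y t))

        linear : ∀ {F G} → Stage F → Stage G → F ⊑ G ⊎ G ⊑ F
        linear {F} sF sG with extreme⇒comparable sF (extreme sF) sG
        ... | inj₁ G⊑F = inj₂ G⊑F
        ... | inj₂ F⁺⊑G = inj₁ (⊑-trans (inflate F) F⁺⊑G)

        -- Being a stage is made Boolean by `⌊_⌋`, so all stages together can be fed to `limit` and
        -- their union is again a stage.
        top : Q → Bool
        top = union (λ F → ⌊ Stage F ⌋)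

        top-stage : Stage top
        top-stage = limit _ λ F t → ⌊⌋⁻ t

        next-top⊑top : next top ⊑ top
        next-top⊑top y t = ⌊⌋⁺ (inj₂ (next top , ⌊⌋⁺ (step top-stage) , t))

    -- Only Boolean-valued subsets are measured, which keeps the type of ultrafilters at the level
    -- of `X`. `_∋_` extends membership to predicates of any level.
    record Ultrafilter (X : Set a) : Set a where
      no-eta-equality
      field
        mem      : (X → Bool) → Bool
        upward   : ∀ {A B} → (∀ x → Holds (A x) → Holds (B x)) → Holds (mem A) → Holds (mem B)
        meet     : ∀ {A B} → Holds (mem A) → Holds (mem B) → Holds (mem (A ∩ B))
        nonempty : ∀ {A} → Holds (mem A) → ∃[ x ] Holds (A x)
        total    : ∀ A → Holds (mem A) ⊎ Holds (mem (not ∘ A))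

    open Ultrafilter

    infix 4 _∋_
    record _∋_ {X : Set a} (U : Ultrafilter X) (P : X → Set p) : Set where
      constructor large
      field unlarge : Holds (mem U λ x → ⌊ P x ⌋)

    module _ {X : Set a} (U : Ultrafilter X) where

      ∋-mono : {P : X → Set p} {Q : X → Set q} → (∀ x → P x → Q x) → U ∋ P → U ∋ Q
      ∋-mono f (large t) = large (upward U (λ x t → ⌊⌋⁺ (f x (⌊⌋⁻ t))) t)

      ∋-∩ : {P : X → Set p} {Q : X → Set q} → U ∋ P → U ∋ Q → U ∋ (λ x → P x × Q x)
      ∋-∩ (large s) (large t) =
        large (upward U (λ x t → let u , v = ∩⁻ t in ⌊⌋⁺ (⌊⌋⁻ u , ⌊⌋⁻ v)) (meet U s t))

      ∋-witness : {P : X → Set p} → U ∋ P → ∃ P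
      ∋-witness (large t) with x , t′ ← nonempty U t = x , ⌊⌋⁻ t′

      ∋-total : (P : X → Set p) → U ∋ P ⊎ U ∋ (λ x → ¬ P x)
      ∋-total P with total U (λ x → ⌊ P x ⌋)
      ... | inj₁ t = inj₁ (large t)
      ... | inj₂ t = inj₂ (large (upward U (λ x t → ⌊⌋⁺ λ p → Holds-not⁻ t (⌊⌋⁺ p)) t))

      ∋-mono₂ : ∀ {r} {P : X → Set p} {Q : X → Set q} {R : X → Set r} →
                (∀ x → P x → Q x → R x) → U ∋ P → U ∋ Q → U ∋ R
      ∋-mono₂ f u v = ∋-mono (λ x (s , t) → f x s t) (∋-∩ u v)

      ∋-∁⁻ : {P : X → Set p} → U ∋ (λ x → ¬ P x) → ¬ U ∋ P
      ∋-∁⁻ u v with x , s , t ← ∋-witness (∋-∩ u v) = s t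

      ∋-∁⁺ : {P : X → Set p} → ¬ U ∋ P → U ∋ (λ x → ¬ P x)
      ∋-∁⁺ {P = P} f with ∋-total P
      ... | inj₁ u = ⊥-elim (f u)
      ... | inj₂ v = v

      ∋-all : {P : X → Set p} → (∀ x → P x) → U ∋ P
      ∋-all {P = P} f with ∋-total P
      ... | inj₁ u = u
      ... | inj₂ v with x , ¬p ← ∋-witness v = ⊥-elim (¬p (f x))

      ∋-const : {P : Set p} → U ∋ (λ _ → P) → P
      ∋-const u = proj₂ (∋-witness u)

      ∋-⊎ : {P : X → Set p} {Q : X → Set q} → U ∋ (λ x → P x ⊎ Q x) → U ∋ P ⊎ U ∋ Q
      ∋-⊎ {P = P} {Q} u with ∋-total P
      ... | inj₁ v = inj₁ v
      ... | inj₂ v = inj₂ (∋-mono₂ (λ { x (inj₁ s) ¬s → ⊥-elim (¬s s) ; x (inj₂ t) _ → t }) u v)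

      ∋-∃Fin : ∀ {m} {P : Fin m → X → Set p} → U ∋ (λ x → ∃[ i ] P i x) → ∃[ i ] U ∋ P i
      ∋-∃Fin {m = zero}  u with x , () , _ ← ∋-witness u
      ∋-∃Fin {m = suc m} {P} u
        with ∋-⊎ {P = P zero} {Q = λ x → ∃[ i ] P (suc i) x}
                 (∋-mono (λ { x (zero , s) → inj₁ s ; x (suc i , s) → inj₂ (i , s) }) u)
      ... | inj₁ v = zero , v
      ... | inj₂ v with i , w ← ∋-∃Fin v = suc i , w

      ∋-∀Fin : ∀ {m} {P : Fin m → X → Set p} → (∀ i → U ∋ P i) → U ∋ (λ x → ∀ i → P i x)
      ∋-∀Fin {P = P} f with ∋-total (λ x → ∀ i → P i x)
      ... | inj₁ u = u
      ... | inj₂ v with i , w ← ∋-∃Fin (∋-mono (λ x → ¬∀⇒∃¬) v) = ⊥-elim (∋-∁⁻ w (f i))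

    pushforward : {X : Set a} {Y : Set b} → (X → Y) → Ultrafilter X → Ultrafilter Y
    pushforward f U = record
      { mem      = λ A → mem U (A ∘ f)
      ; upward   = λ A⊆B → upward U λ x → A⊆B (f x)
      ; meet     = λ {A} {B} s t →
                     upward U (λ x u → let v , w = ∩⁻ u in ∩⁺ {X = A} {B} {f x} v w) (meet U s t)
      ; nonempty = λ t → let x , t′ = nonempty U t in f x , t′
      ; total    = λ A → total U (A ∘ f)
      }

    push⁻ : {X : Set a} {Y : Set b} {f : X → Y} {U : Ultrafilter X} {P : Y → Set p} →
            pushforward f U ∋ P → U ∋ (λ x → P (f x))
    push⁻ (large t) = large t

    principal : {X : Set a} → X → Ultrafilter X
    principal {X = X} x = record
      { mem      = λ A → A x
      ; upward   = λ A⊆B → A⊆B x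
      ; meet     = ∩⁺
      ; nonempty = x ,_
      ; total    = λ A → split (A x)
      }
      where
      split : ∀ b → Holds b ⊎ Holds (not b)
      split true  = inj₁ (holds refl)
      split false = inj₂ (holds refl)

    record IsFilterBase {X : Set a} {J : Set b} (Z : J → X → Set p) : Set (a ⊔ b ⊔ p) where
      field
        index     : J
        directed  : ∀ i j → ∃[ k ] (∀ x → Z k x → Z i x × Z j x)
        inhabited : ∀ j → ∃ (Z j)

    module _ {X : Set a} {J : Set b} {Z : J → X → Set p} (base : IsFilterBase Z) where
      open IsFilterBase base

      private
        Contains : ((X → Bool) → Bool) → (X → Bool) → (X → Bool) → Set a
        Contains F A B = ∃[ C ] (Holds (F C) × (∀ x → Holds (C x) → Holds (A x) → Holds (B x)))

        Undecided : ((X → Bool) → Bool) → (X → Bool) → Set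
        Undecided F A = ¬ Holds (F A) × ¬ Holds (F (not ∘ A))

        -- Applied to a Σ-type, `em` returns a particular undecided set and so acts as the choice
        -- function of Zermelo's argument.
        next : ((X → Bool) → Bool) → (X → Bool) → Bool
        next F with em {P = ∃ (Undecided F)}
        ... | yes (A , _) = λ B → ⌊ Contains F A B ⌋
        ... | no _        = F

        bottom : (X → Bool) → Bool
        bottom A = ⌊ (∃[ j ] (∀ x → Z j x → Holds (A x))) ⌋

        open Tower bottom next

        inflate : ∀ F → F ⊑ next F
        inflate F A t with em {P = ∃ (Undecided F)}
        ... | yes _ = ⌊⌋⁺ (A , t , λ _ s _ → s)
        ... | no _  = t

        open Inflationary inflate

        record IsFilter (F : (X → Bool) → Bool) : Set a where
          field
            up     : ∀ {A B} → (∀ x → Holds (A x) → Holds (B x)) → Holds (F A) → Holds (F B)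
            cap    : ∀ {A B} → Holds (F A) → Holds (F B) → Holds (F (A ∩ B))
            proper : ∀ {A} → Holds (F A) → ∃[ x ] Holds (A x)

        bottom-isFilter : IsFilter bottom
        bottom-isFilter = record
          { up     = λ A⊆B t → let j , f = ⌊⌋⁻ t in ⌊⌋⁺ (j , λ x z → A⊆B x (f x z))
          ; cap    = λ s t → let i , f = ⌊⌋⁻ s ; j , g = ⌊⌋⁻ t ; k , h = directed i j in
                     ⌊⌋⁺ (k , λ x z → ∩⁺ (f x (proj₁ (h x z))) (g x (proj₂ (h x z))))
          ; proper = λ t → let j , f = ⌊⌋⁻ t ; x , z = inhabited j in x , f x z
          }

        next-isFilter : ∀ {F} → IsFilter F → IsFilter (next F)
        next-isFilter {F} isF with em {P = ∃ (Undecided F)}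
        ... | no _ = isF
        ... | yes (A , ¬FA , ¬F∁A) = record
          { up     = λ B⊆B′ t → let C , FC , f = ⌊⌋⁻ t in ⌊⌋⁺ (C , FC , λ x c y → B⊆B′ x (f x c y))
          ; cap    = λ s t → let C , FC , f = ⌊⌋⁻ s ; D , FD , g = ⌊⌋⁻ t in
                     ⌊⌋⁺ (_ , cap FC FD ,
                          λ x c y → ∩⁺ (f x (proj₁ (∩⁻ c)) y) (g x (proj₂ (∩⁻ c)) y))
          ; proper = λ {B} t → let C , FC , f = ⌊⌋⁻ t in ¬¬-elim λ none →
                     ¬F∁A (up (λ x c → Holds-not⁺ λ y → none (x , f x c y)) FC)
          }
          where open IsFilter isF

        -- For unions the point is closure under intersection: stages are linearly ordered, so two
        -- members already lie in a common stage.
        stage-isFilter : ∀ {F} → Stage F → IsFilter F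
        stage-isFilter (step s) = next-isFilter (stage-isFilter s)
        stage-isFilter (limit C sC) = record { up = up′ ; cap = cap′ ; proper = proper′ }
          where
          Above : (X → Bool) → Set a
          Above A = ∃[ F ] (Stage F × IsFilter F × F ⊑ union C × Holds (F A))

          above : ∀ {A} → Holds (bottom A) ⊎ (∃[ F ] (Holds (C F) × Holds (F A))) →
                  Holds (bottom A) ⊎ Above A
          above (inj₁ t) = inj₁ t
          above (inj₂ (F , c , t)) =
            inj₂ (F , sC F c , stage-isFilter (sC F c) , (λ y u → ⌊⌋⁺ (inj₂ (F , c , u))) , t)

          bottom⊑∪ : bottom ⊑ union C
          bottom⊑∪ y t = ⌊⌋⁺ (inj₁ t)

          up′ : ∀ {A B} → (∀ x → Holds (A x) → Holds (B x)) → Holds (union C A) → Holds (union C B)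
          up′ {A} A⊆B t with above {A} (⌊⌋⁻ t)
          ... | inj₁ u = bottom⊑∪ _ (IsFilter.up bottom-isFilter A⊆B u)
          ... | inj₂ (F , _ , isF , F⊑ , u) = F⊑ _ (IsFilter.up isF A⊆B u)

          cap′ : ∀ {A B} → Holds (union C A) → Holds (union C B) → Holds (union C (A ∩ B))
          cap′ {A} {B} s t with above {A} (⌊⌋⁻ s) | above {B} (⌊⌋⁻ t)
          ... | inj₁ u | inj₁ v = bottom⊑∪ _ (IsFilter.cap bottom-isFilter u v)
          ... | inj₁ u | inj₂ (F , sF , isF , F⊑ , v) =
                F⊑ _ (IsFilter.cap isF (bottom⊑ sF _ u) v)
          ... | inj₂ (F , sF , isF , F⊑ , u) | inj₁ v =
                F⊑ _ (IsFilter.cap isF u (bottom⊑ sF _ v))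
          ... | inj₂ (F , sF , isF , F⊑ , u) | inj₂ (G , sG , isG , G⊑ , v) with linear sF sG
          ...   | inj₁ F⊑G = G⊑ _ (IsFilter.cap isG (F⊑G _ u) v)
          ...   | inj₂ G⊑F = F⊑ _ (IsFilter.cap isF u (G⊑F _ v))

          proper′ : ∀ {A} → Holds (union C A) → ∃[ x ] Holds (A x)
          proper′ {A} t with above {A} (⌊⌋⁻ t)
          ... | inj₁ u = IsFilter.proper bottom-isFilter u
          ... | inj₂ (F , _ , isF , _ , u) = IsFilter.proper isF u

        whole : Holds (top λ _ → true)
        whole = bottom⊑ top-stage _ (⌊⌋⁺ (index , λ _ _ → holds refl))

        -- If some `B` were undecided, `next top` would contain the chosen one; but `next top` is
        -- included in `top`.
        top-decides : ∀ A → Holds (top A) ⊎ Holds (top (not ∘ A))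
        top-decides A with em {P = ∃ (Undecided top)} | next-top⊑top
        ... | yes (B , ¬B , ¬∁B) | contains =
              ⊥-elim (¬B (contains B (⌊⌋⁺ (_ , whole , λ _ _ t → t))))
        ... | no decided | _ with em {P = Holds (top A)} | em {P = Holds (top (not ∘ A))}
        ...   | yes t | _     = inj₁ t
        ...   | no _  | yes t = inj₂ t
        ...   | no s  | no t  = ⊥-elim (decided (A , s , t))

      abstract
        extend : Ultrafilter X
        extend = record
          { mem      = top
          ; upward   = up
          ; meet     = cap
          ; nonempty = proper
          ; total    = top-decides
          }
          where open IsFilter (stage-isFilter top-stage)

        extend-∋ : ∀ j → extend ∋ Z j
        extend-∋ j = large (bottom⊑ top-stage _ (⌊⌋⁺ (j , λ x z → ⌊⌋⁺ z)))

  open Ultrafilters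

  -- Ramsey's theorem for colourings of finite tuples.

  module RamseyTheorem where
    open import Data.Nat.Base using (_∸_; _≤_)
    open import Data.Vec.Functional using (_∷_)
    open import Relation.Binary.Definitions using (tri<; tri≈; tri>)

    tails : IsFilterBase (λ j k → j ≤ k)
    tails = record
      { index     = 0
      ; directed  = λ i j → i ℕ.⊔ j , λ x m≤x → ℕₚ.m⊔n≤o⇒m≤o i j m≤x , ℕₚ.m⊔n≤o⇒n≤o i j m≤x
      ; inhabited = λ j → j , ℕₚ.≤-refl
      }

    nonprincipal : Ultrafilter ℕ
    nonprincipal = extend tails

    eventually : ∀ {p} {P : ℕ → Set p} m → (∀ k → m ≤ k → P k) → nonprincipal ∋ P
    eventually m f = ∋-mono nonprincipal f (extend-∋ tails m)

    Increasing : (ℕ → ℕ) → Set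
    Increasing h = ∀ {i j} → i < j → h i < h j

    increasing : ∀ {h} → (∀ i → h i < h (suc i)) → Increasing h
    increasing {h} f {i} {suc j} (s≤s i≤j) with ℕₚ.m≤n⇒m<n∨m≡n i≤j
    ... | inj₁ i<j  = ℕₚ.<-trans (increasing f i<j) (f j)
    ... | inj₂ refl = f i

    IncreasingTuple : ∀ {r} → (Fin r → ℕ) → Set
    IncreasingTuple z = ∀ {i j} → i Fin.< j → z i < z j

    reflects-< : ∀ {h} → Increasing h → ∀ {i j} → h i < h j → i < j
    reflects-< inc {i} {j} hi<hj with ℕₚ.<-cmp i j
    ... | tri< i<j _ _ = i<j
    ... | tri≈ _ refl _ = ⊥-elim (ℕₚ.<-irrefl refl hi<hj)
    ... | tri> _ _ j<i = ⊥-elim (ℕₚ.<-asym hi<hj (inc j<i))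

    -- The colour is the limit of `c` along a nonprincipal ultrafilter, all of whose members are
    -- unbounded.
    infinitelyOften : ∀ {C} (c : ℕ → Fin C) → ∃[ d ] (∀ m → ∃[ k ] (m ≤ k × c k ≡ d))
    infinitelyOften {C} c = d , λ m → ∋-witness nonprincipal
                              (∋-∩ nonprincipal (extend-∋ tails m) often)
      where
      limit : ∃[ d ] (nonprincipal ∋ (λ k → c k ≡ d))
      limit = ∋-∃Fin nonprincipal (∋-all nonprincipal λ k → c k , refl)
      d = proj₁ limit
      often = proj₂ limit

    constantSubsequence : ∀ {C} (c : ℕ → Fin C) → ∃[ d ] ∃[ g ] (Increasing g × (∀ i → c (g i) ≡ d))
    constantSubsequence c = d , g , increasing g-step , g-colour
      where
      d = proj₁ (infinitelyOften c)
      next = proj₂ (infinitelyOften c)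
      g : ℕ → ℕ
      g zero    = proj₁ (next 0)
      g (suc i) = proj₁ (next (suc (g i)))
      g-step : ∀ i → g i < g (suc i)
      g-step i = proj₁ (proj₂ (next (suc (g i))))
      g-colour : ∀ i → c (g i) ≡ d
      g-colour zero    = proj₂ (proj₂ (next 0))
      g-colour (suc i) = proj₂ (proj₂ (next (suc (g i))))

    Homogeneous : ∀ {r C} → ((Fin r → ℕ) → Fin C) → (ℕ → ℕ) → Fin C → Set
    Homogeneous col h c = ∀ z → IncreasingTuple z → col (h ∘ z) ≡ c

    -- Each `state` refines the tail of the preceding one so that the tuples starting with the head
    -- just dropped have a single colour. Among the heads the colour of a tuple then depends on its
    -- first entry only, and a subsequence of heads makes it constant.
    ramsey : ∀ r {C} (col : (Fin r → ℕ) → Fin C) →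
             ∃[ h ] (Increasing h × ∃[ c ] Homogeneous col h c)
    ramsey zero col = (λ i → i) , (λ i<j → i<j) , col (λ ()) , λ z _ → cong col (ext λ ())
    ramsey (suc r) {C} col = h , h-increasing , d , h-homogeneous
      where
      State = Σ (ℕ → ℕ) Increasing

      refine : (s : State) → let f = proj₁ s in
               ∃[ g ] (Increasing g × ∃[ c ] Homogeneous (λ z → col (f 0 ∷ (f ∘ suc ∘ z))) g c)
      refine (f , _) = ramsey r (λ z → col (f 0 ∷ (f ∘ suc ∘ z)))

      state : ℕ → State
      state zero    = (λ i → i) , λ i<j → i<j
      state (suc k) with f , f-inc ← state k | g , g-inc , _ ← refine (state k) =
        f ∘ suc ∘ g , λ i<j → f-inc (s≤s (g-inc i<j))

      seq : ℕ → ℕ → ℕ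
      seq k = proj₁ (state k)

      head : ℕ → ℕ
      head k = seq k 0

      head-increasing : Increasing head
      head-increasing = increasing λ k → proj₂ (state k) (s≤s z≤n)

      colour : ℕ → Fin C
      colour k = proj₁ (proj₂ (proj₂ (refine (state k))))

      descend : ∀ d k x → ∃[ w ] seq (d + k) x ≡ seq k w
      descend zero    k x = x , refl
      -- `seq (suc d + k) x` unfolds to a value of `seq (d + k)`, whose argument unification finds.
      descend (suc d) k x = descend d k _

      head-colour : ∀ k z → IncreasingTuple z → (∀ i → k < z i) → col (head k ∷ (head ∘ z)) ≡ colour k
      head-colour k z z-inc k<z = ≡-trans
        (cong (λ y → col (head k ∷ y)) (ext λ i → proj₂ (preimage i)))
        (proj₂ (proj₂ (proj₂ (refine (state k)))) w w-inc)
        where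
        preimage : ∀ i → ∃[ w ] head (z i) ≡ seq (suc k) w
        preimage i = subst (λ m → ∃[ w ] head m ≡ seq (suc k) w) (ℕₚ.m∸n+n≡m (k<z i))
                           (descend (z i ∸ suc k) (suc k) 0)
        w : Fin r → ℕ
        w i = proj₁ (preimage i)
        w-inc : IncreasingTuple w
        w-inc {i} {j} i<j = reflects-< (proj₂ (state (suc k)))
          (subst₂ _<_ (proj₂ (preimage i)) (proj₂ (preimage j)) (head-increasing (z-inc i<j)))

      d = proj₁ (constantSubsequence colour)
      g = proj₁ (proj₂ (constantSubsequence colour))
      g-inc = proj₁ (proj₂ (proj₂ (constantSubsequence colour)))
      g-colour = proj₂ (proj₂ (proj₂ (constantSubsequence colour)))

      h : ℕ → ℕ
      h = head ∘ g

      h-increasing : Increasing h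
      h-increasing i<j = head-increasing (g-inc i<j)

      h-homogeneous : Homogeneous col h d
      h-homogeneous z z-inc = ≡-trans
        (cong col (ext λ { zero → refl ; (suc i) → refl }))
        (≡-trans (head-colour (g (z zero)) (g ∘ z ∘ suc) (λ i<j → g-inc (z-inc (s≤s i<j)))
                            (λ i → g-inc (z-inc (s≤s z≤n))))
               (g-colour (z zero)))

  open RamseyTheorem

  -- Shift graphs: colourings and closed walks.

  module ShiftGraphs where
    open import Data.Bool.Base using (_xor_)
    import Data.Bool.Properties as Boolₚ
    open import Data.Fin.Base using (funToFin; finToFun)
    open import Data.Nat.Base using (_≤_)
    open import Relation.Binary.Definitions using (tri<; tri≈; tri>)

    private variable
      a p : Level

    -- The shift graph on (m+1)-tuples. To keep the type of vertices independent of m,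
    -- a tuple is represented by any sequence that starts with it.
    record Shift (m : ℕ) (f g : ℕ → ℕ) : Set where
      field
        inc₁  : Increasing f
        inc₂  : Increasing g
        first : f 0 < g 0
        shift : ∀ i → i < m → g i ≡ f (suc i)
    open Shift

    -- Induction on `m`. For `m = 0` increasing sequences with different first terms are adjacent,
    -- so the pigeonhole principle applies. Lowering `m` by one replaces `C` colours by `2 ^ C`.
    shift-uncolourable : ∀ m {C} (c : (ℕ → ℕ) → Fin C) → ¬ (∀ f g → Shift m f g → c f ≢ c g)
    shift-uncolourable zero {C} c proper
      with i , j , i<j , same ← Finₚ.pigeonhole (ℕₚ.n<1+n C) (λ i → c (toℕ {suc C} i +_)) =
      proper (toℕ i +_) (toℕ j +_)
        (record { inc₁ = ℕₚ.+-monoʳ-< (toℕ i) ; inc₂ = ℕₚ.+-monoʳ-< (toℕ j)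
                ; first = ℕₚ.+-monoˡ-< 0 i<j ; shift = λ _ () })
        same
    shift-uncolourable (suc m) {C} c proper = shift-uncolourable m arcColours proper′
      where
      Out : (ℕ → ℕ) → Fin C → Set
      Out f d = ∃[ h ] (Increasing h × (∀ i → i ≤ m → h i ≡ f i) × c h ≡ d)

      -- An edge of the graph for m is a vertex of the graph for m + 1, so a colouring
      -- of the latter assigns to a vertex of the former the colours of its outgoing
      -- edges.
      arcColours : (ℕ → ℕ) → Fin (2 ^ C)
      arcColours f = funToFin (λ d → bit ⌊ Out f d ⌋)

      arcColours-injective : ∀ f g → arcColours f ≡ arcColours g → ∀ d → ⌊ Out f d ⌋ ≡ ⌊ Out g d ⌋
      arcColours-injective f g eq d = bit-injective (≡-trans
        (sym (Finₚ.finToFun-funToFin _ d))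
        (≡-trans (cong (λ x → finToFun {2} {C} x d) eq) (Finₚ.finToFun-funToFin _ d)))

      proper′ : ∀ f g → Shift m f g → arcColours f ≢ arcColours g
      -- `arc` codes the edge from `f` to `g`. If both ends had the same outgoing colours, some edge
      -- `h` leaving `g` would have the colour of `arc`; but `arc` and `h` are adjacent in the graph
      -- for `suc m`.
      proper′ f g s eq with ⌊⌋⁻ (subst Holds (arcColours-injective f g eq (c arc)) (⌊⌋⁺ out))
        where
        arc : ℕ → ℕ
        arc zero    = f 0
        arc (suc i) = g i
        arc-inc : Increasing arc
        arc-inc = increasing λ { zero → first s ; (suc i) → inc₂ s (ℕₚ.n<1+n i) }
        out : Out f (c arc)
        out = arc , arc-inc , (λ { zero _ → refl ; (suc i) i<m → shift s i i<m }) , refl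
      ... | h , h-inc , h≡g , ch = proper _ h
        (record { inc₁ = increasing λ { zero → first s ; (suc i) → inc₂ s (ℕₚ.n<1+n i) }
                ; inc₂ = h-inc ; first = subst (f 0 <_) (sym (h≡g 0 z≤n)) (first s)
                ; shift = λ { i (s≤s i≤m) → h≡g i i≤m } })
        (sym ch)

    -- `E` plays the role of equality: in the ultraproduct vertices are equal only up to almost
    -- everywhere agreement.
    data Walk {W : Set a} (E A : W → W → Set p) : ℕ → W → W → Set (a ⊔ p) where
      nil  : ∀ {x y} → E x y → Walk E A 0 x y
      snoc : ∀ {L x y z} → Walk E A L x y → A y z → Walk E A (suc L) x z

    parity : ℕ → Bool
    parity zero    = false
    parity (suc n) = not (parity n)

    parity-+ : ∀ m n → parity (m + n) ≡ parity m xor parity n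
    parity-+ zero    n = refl
    parity-+ (suc m) n = ≡-trans (cong not (parity-+ m n)) (Boolₚ.not-distribˡ-xor (parity m) (parity n))

    ShiftEdge : ℕ → (ℕ → ℕ) → (ℕ → ℕ) → Set
    ShiftEdge m f g = Shift m f g ⊎ Shift m g f

    in-range : ∀ {m} p b i → i + suc (p + b) ≤ m → i + b < m
    in-range p b i le =
      ℕₚ.<-≤-trans (ℕₚ.+-monoʳ-< i (s≤s (ℕₚ.m≤n+m b p))) le

    -- `p` counts the forward and `b` the backward shifts. Every step may lose one entry of the
    -- tuple, whence the range `i + L ≤ m`.
    walk-displacement : ∀ {m L f g} → Walk _≡_ (ShiftEdge m) L f g →
                        ∃[ p ] ∃[ b ] (p + b ≡ L × (∀ i → i + L ≤ m → g (i + b) ≡ f (i + p)))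
    walk-displacement (nil refl) = 0 , 0 , refl , λ _ _ → refl
    walk-displacement {m} {suc L} {f} (snoc {y = g} {z = h} w (inj₁ s))
      with p , b , refl , agree ← walk-displacement w =
      suc p , b , refl , λ i le → begin
        h (i + b)       ≡⟨ shift s (i + b) (in-range p b i le) ⟩
        g (suc i + b)   ≡⟨ agree (suc i) (subst (_≤ m) (ℕₚ.+-suc i (p + b)) le) ⟩
        f (suc i + p)   ≡⟨ cong f (ℕₚ.+-suc i p) ⟨
        f (i + suc p)   ∎
      where open ≡-Reasoning
    walk-displacement {m} {suc L} {f} (snoc {y = g} {z = h} w (inj₂ s))
      with p , b , refl , agree ← walk-displacement w =
      p , suc b , ℕₚ.+-suc p b , λ i le → begin
        h (i + suc b)   ≡⟨ cong h (ℕₚ.+-suc i b) ⟩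
        h (suc (i + b)) ≡⟨ shift s (i + b) (in-range p b i le) ⟨
        g (i + b)       ≡⟨ agree i (ℕₚ.<⇒≤ (subst (_≤ m) (ℕₚ.+-suc i (p + b)) le)) ⟩
        f (i + p)       ∎
      where open ≡-Reasoning

    walk-end-increasing : ∀ {m L f g} → Walk _≡_ (ShiftEdge m) (suc L) f g → Increasing g
    walk-end-increasing (snoc _ (inj₁ s)) = inc₂ s
    walk-end-increasing (snoc _ (inj₂ s)) = inc₁ s

    increasing-injective : ∀ {f} → Increasing f → ∀ {i j} → f i ≡ f j → i ≡ j
    increasing-injective inc {i} {j} eq with ℕₚ.<-cmp i j
    ... | tri< i<j _ _ = ⊥-elim (ℕₚ.<-irrefl eq (inc i<j))
    ... | tri≈ _ i≡j _ = i≡j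
    ... | tri> _ _ j<i = ⊥-elim (ℕₚ.<-irrefl (sym eq) (inc j<i))

    -- On a closed walk `f b ≡ f p`, and an increasing `f` forces `p ≡ b`: as many shifts forward as
    -- backward.
    closedWalk-even : ∀ {m L f} → L ≤ m → Walk _≡_ (ShiftEdge m) L f f → parity L ≡ false
    closedWalk-even {L = zero}  _ _ = refl
    closedWalk-even {L = suc L} L≤m w
      with p , b , eq , agree ← walk-displacement w
      with refl ← increasing-injective (walk-end-increasing w) (agree 0 L≤m) =
      ≡-trans (cong parity (sym eq)) (≡-trans (parity-+ b b) (Boolₚ.xor-same (parity b)))

    -- A graph without odd closed walks is bipartite: a vertex is coloured by the parity of a walk
    -- to it from the chosen root of its component.
    module TwoColouring {W : Set a} {E A : W → W → Set p}
      (E-refl : ∀ {x} → E x x) (E-sym : ∀ {x y} → E x y → E y x)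
      (E-trans : ∀ {x y z} → E x y → E y z → E x z)
      (A-sym : ∀ {x y} → A x y → A y x) (A-respʳ : ∀ {x y z} → A x y → E y z → A x z)
      (even : ∀ {L x} → Walk E A L x x → parity L ≡ false)
      where

      walk-respʳ : ∀ {L x y z} → Walk E A L x y → E y z → Walk E A L x z
      walk-respʳ (nil e)    e′ = nil (E-trans e e′)
      walk-respʳ (snoc w r) e′ = snoc w (A-respʳ r e′)

      _++_ : ∀ {L M x y z} → Walk E A L x y → Walk E A M y z → Walk E A (M + L) x z
      w ++ nil e     = walk-respʳ w e
      w ++ snoc w′ r = snoc (w ++ w′) r

      reverse : ∀ {L x y} → Walk E A L x y → Walk E A L y x
      reverse (nil e) = nil (E-sym e)
      reverse (snoc {L} {x} {_} {z} w r) = subst (λ M → Walk E A M z x) (ℕₚ.+-comm L 1)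
                                 (snoc (nil E-refl) (A-sym r) ++ reverse w)

      Connected : Bool → W → W → Set _
      Connected b x y = ∃[ L ] (parity L ≡ b × Walk E A L x y)

      component : W → W → Bool
      component x y = ⌊ (∃[ b ] Connected b x y) ⌋

      connected-trans : ∀ {b c x y z} → Connected b x y → Connected c y z → Connected (c xor b) x z
      connected-trans (L , refl , w) (M , refl , w′) = M + L , parity-+ M L , w ++ w′

      connected-sym : ∀ {b x y} → Connected b x y → Connected b y x
      connected-sym (L , eq , w) = L , eq , reverse w

      component-cong : ∀ {b x y} → Connected b x y → component x ≡ component y
      component-cong c = subset-ext
        (λ z t → let _ , d = ⌊⌋⁻ t in ⌊⌋⁺ (_ , connected-trans (connected-sym c) d))
        (λ z t → let _ , d = ⌊⌋⁻ t in ⌊⌋⁺ (_ , connected-trans c d))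

      -- The element is taken from `em` and not from the given proof, so it depends on `P` alone and
      -- all vertices of a component get the same root.
      pick : (P : W → Bool) → ∃ (Holds ∘ P) → W
      pick P p with em {P = ∃ (Holds ∘ P)}
      ... | yes (x , _) = x
      ... | no ¬p       = ⊥-elim (¬p p)

      pick-∈ : ∀ P p → Holds (P (pick P p))
      pick-∈ P p with em {P = ∃ (Holds ∘ P)}
      ... | yes (_ , t) = t
      ... | no ¬p       = ⊥-elim (¬p p)

      pick-cong : ∀ {P Q} → P ≡ Q → ∀ p q → pick P p ≡ pick Q q
      pick-cong {P} refl p q with em {P = ∃ (Holds ∘ P)}
      ... | yes _ = refl
      ... | no ¬p = ⊥-elim (¬p p)

      root : W → W
      root x = pick (component x) (x , ⌊⌋⁺ (false , 0 , refl , nil E-refl))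

      root-connected : ∀ x → ∃[ b ] Connected b (root x) x
      root-connected x with b , c ← ⌊⌋⁻ (pick-∈ (component x) _) = b , connected-sym c

      colour : W → Bool
      colour x = proj₁ (root-connected x)

      closed-even : ∀ {b x} → Connected b x x → b ≡ false
      closed-even (L , refl , w) = even w

      -- Going from the common root to `x`, on to `y` and back to the root is a closed walk.
      connected-colour : ∀ {b x y} → Connected b x y → colour y xor (b xor colour x) ≡ false
      connected-colour {b} {x} {y} c = closed-even (connected-trans
        (connected-trans (proj₂ (root-connected x)) c)
        (connected-sym (subst (λ r → Connected (colour y) r y)
          (sym (pick-cong (component-cong c) _ _)) (proj₂ (root-connected y)))))

      colour-resp : ∀ {x y} → E x y → colour x ≡ colour y
      colour-resp {x} {y} e = eq (colour x) (colour y) (connected-colour (0 , refl , nil e))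
        where
        eq : ∀ u v → v xor u ≡ false → u ≡ v
        eq true  true  _ = refl
        eq false false _ = refl

      colour-proper : ∀ {x y} → A x y → colour x ≢ colour y
      colour-proper {x} {y} r same =
        absurd (colour x) (colour y) same (connected-colour (1 , refl , snoc (nil E-refl) r))
        where
        absurd : ∀ u v → u ≡ v → v xor (true xor u) ≢ false
        absurd true  true  _ ()
        absurd false false _ ()

  open ShiftGraphs

  -- Maps between finite sets and updates of tuples.

  module FiniteSets where
    open import Data.Fin.Base using (punchOut)
    open import Data.Nat.Base using (_≤_)

    private variable
      a : Level
      n : ℕ

    _[_≔_] : {B : Fin n → Set a} → (∀ k → B k) → ∀ i → B i → ∀ k → B k
    (s [ i ≔ x ]) k with k ≟ i
    ... | yes refl = x
    ... | no _     = s k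

    ≔-same : {B : Fin n → Set a} (s : ∀ k → B k) → ∀ i x → (s [ i ≔ x ]) i ≡ x
    ≔-same s i x with i ≟ i
    ... | yes refl = refl
    ... | no i≢i   = ⊥-elim (i≢i refl)

    ≔-other : {B : Fin n → Set a} (s : ∀ k → B k) → ∀ {i k} {x} → k ≢ i → (s [ i ≔ x ]) k ≡ s k
    ≔-other s {i} {k} k≢i with k ≟ i
    ... | yes refl = ⊥-elim (k≢i refl)
    ... | no _     = refl

    injective⇒surjective : (f : Fin n → Fin n) → (∀ {j k} → f j ≡ f k → j ≡ k) → ∀ y → ∃[ x ] f x ≡ y
    injective⇒surjective {n = suc n} f inj y = ¬¬-elim λ none →
      ℕₚ.1+n≰n (Finₚ.injective⇒≤ {f = λ x → punchOut {i = y} {j = f x} λ y≡fx → none (x , sym y≡fx)}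
        (λ {j} {k} → inj ∘ Finₚ.punchOut-injective {i = y} (λ e → none (j , sym e))
                                                            (λ e → none (k , sym e))))

    unhit : ∀ {m} → m < n → (f : Fin m → Fin n) → ∃[ y ] (∀ x → f x ≢ y)
    unhit {n} {m} m<n f = ¬¬-elim λ none →
      let preimage : ∀ y → ∃[ x ] f x ≡ y
          preimage y = ¬¬-elim λ ¬x → none (y , λ x e → ¬x (x , e))
      in ℕₚ.<⇒≱ m<n (Finₚ.injective⇒≤ {f = λ y → proj₁ (preimage y)} λ {x} {y} e →
           ≡-trans (sym (proj₂ (preimage x))) (≡-trans (cong f e) (proj₂ (preimage y))))

    InjectiveOff : {A : Set a} → (Fin n → A) → Fin n → Set a
    InjectiveOff f i = ∀ {j k} → j ≢ i → k ≢ i → f j ≡ f k → j ≡ k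

    -- Redirecting `j` to a missed value turns `f` into a permutation. This matches the face of
    -- `s ∘ f` opposite to `j` with the face of `s` opposite to `m`.
    missedPoint : (f : Fin n → Fin n) → ∀ {j} → InjectiveOff f j →
                  ∃[ m ] ((∀ k → k ≢ j → f k ≢ m) × (∀ l → l ≢ m → ∃[ k ] (k ≢ j × f k ≡ l)))
    missedPoint {n} f {j} inj = m , missed , onto
      where
      missing : ∃[ m ] (∀ k → k ≢ j → f k ≢ m)
      missing = ¬¬-elim λ none →
        let preimage : ∀ m → ∃[ k ] (k ≢ j × f k ≡ m)
            preimage m = ¬¬-elim λ ¬k → none (m , λ k k≢j e → ¬k (k , k≢j , e))
            x , gx≡j = injective⇒surjective (λ m → proj₁ (preimage m))
              (λ {x} {y} e → ≡-trans (sym (proj₂ (proj₂ (preimage x))))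
                              (≡-trans (cong f e) (proj₂ (proj₂ (preimage y))))) j
        in proj₁ (proj₂ (preimage x)) gx≡j
      m = proj₁ missing
      missed = proj₂ missing
      g : Fin n → Fin n
      g = f [ j ≔ m ]
      g-inj : ∀ {k l} → g k ≡ g l → k ≡ l
      g-inj {k} {l} e with k ≟ j | l ≟ j
      ... | yes refl | yes refl = refl
      ... | yes refl | no l≢j   = ⊥-elim (missed l l≢j (sym e))
      ... | no k≢j   | yes refl = ⊥-elim (missed k k≢j e)
      ... | no k≢j   | no l≢j   = inj k≢j l≢j e
      onto : ∀ l → l ≢ m → ∃[ k ] (k ≢ j × f k ≡ l)
      onto l l≢m with k , e ← injective⇒surjective g g-inj l with k ≟ j
      ... | yes refl = ⊥-elim (l≢m (sym e))
      ... | no k≢j   = k , k≢j , e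

    argmax : Fin n → (f : Fin n → ℕ) → ∃[ j ] (∀ k → f k ≤ f j)
    argmax {suc zero}    _ f = zero , λ { zero → ℕₚ.≤-refl }
    argmax {suc (suc n)} _ f with j , max ← argmax zero (f ∘ suc) with ℕₚ.≤-total (f zero) (f (suc j))
    ... | inj₁ le = suc j , λ { zero → le ; (suc k) → max k }
    ... | inj₂ ge = zero , λ { zero → ℕₚ.≤-refl ; (suc k) → ℕₚ.≤-trans (max k) ge }

    sumᶠ : (Fin n → ℕ) → ℕ
    sumᶠ {zero}  f = 0
    sumᶠ {suc n} f = f zero + sumᶠ (f ∘ suc)

    ≤-sumᶠ : (f : Fin n → ℕ) → ∀ j → f j ≤ sumᶠ f
    ≤-sumᶠ f zero    = ℕₚ.m≤m+n _ _
    ≤-sumᶠ f (suc j) = ℕₚ.≤-trans (≤-sumᶠ (f ∘ suc) j) (ℕₚ.m≤n+m _ _)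

    module ThreeElements (2<n : 2 < n) where

      abstract
        another : (i j : Fin n) → ∃[ k ] (k ≢ i × k ≢ j)
        another i j = let k , f = unhit 2<n pair in
          k , (λ e → f zero (sym e)) , (λ e → f (suc zero) (sym e))
          where
          pair : Fin 2 → Fin n
          pair zero       = i
          pair (suc zero) = j

  open FiniteSets

  -- The complex algebra of an atom structure.

  module ComplexAlgebras where
    open import Relation.Binary.Bundles using (Setoid)
    open import Relation.Binary.Definitions using (_Respects_)

    module _ {n σ ℓ} (S : AtomStructure n σ ℓ ℓ ℓ) where
      private
        module S = AtomStructure S
        module ≈ = Setoid S.universe

        Set! : Set (Level.suc ℓ)
        Set! = Σ (Pred S.Carrier ℓ) (λ X → X Respects S._≈_)

      complexRaw : RawAlgebra n σ (Level.suc ℓ) ℓ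
      complexRaw = record
        { Carrier = Set!
        ; _≈_     = λ (X , _) (Y , _) → ∀ a → X a ⇔ Y a
        ; _∨_     = λ (X , p) (Y , q) → (λ a → X a ⊎ Y a) , λ a≈b → Sum.map (p a≈b) (q a≈b)
        ; _∧_     = λ (X , p) (Y , q) → (λ a → X a × Y a) , λ a≈b (x , y) → p a≈b x , q a≈b y
        ; ∁       = λ (X , p) → (λ a → ¬ X a) , λ a≈b ¬x y → ¬x (p (≈.sym a≈b) y)
        ; 𝟙       = (λ _ → Lift ℓ ⊤) , λ _ _ → lift tt
        ; 𝟘       = (λ _ → Lift ℓ ⊥) , λ _ ()
        ; op      = λ Ω (X , _) → (λ a → ∃[ b ] (X b × S.R Ω a b)) ,
                    λ a≈a′ (b , x , r) → b , x , proj₂ (S.R-respects Ω) a≈a′ r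
        ; const   = λ d → S.D d , S.D-respects d
        }

      private
        module C = RawAlgebra complexRaw

        ≤⁺ : ∀ {x y} → (∀ a → proj₁ x a → proj₁ y a) → x C.≤ y
        ≤⁺ f a = mk⇔ proj₁ λ x → x , f a x

        ≤⁻ : ∀ {x y} → x C.≤ y → ∀ a → proj₁ x a → proj₁ y a
        ≤⁻ le a x = proj₂ (from (le a) x)

      complex : Algebra n σ (Level.suc ℓ) ℓ
      complex = record
        { raw                = complexRaw
        ; isBooleanAlgebra   = record
          { isDistributiveLattice = record
            { isLattice   = record
              { isEquivalence = record
                { refl  = λ a → mk⇔ id id
                ; sym   = λ e a → mk⇔ (from (e a)) (to (e a))
                ; trans = λ e f a → mk⇔ (to (f a) ∘ to (e a)) (from (e a) ∘ from (f a))
                }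
              ; ∨-comm  = λ _ _ a → mk⇔ Sum.swap Sum.swap
              ; ∨-assoc = λ _ _ _ a → mk⇔ Sum.assocʳ Sum.assocˡ
              ; ∨-cong  = λ e f a → mk⇔ (Sum.map (to (e a)) (to (f a)))
                                          (Sum.map (from (e a)) (from (f a)))
              ; ∧-comm  = λ _ _ a → mk⇔ (λ (x , y) → y , x) (λ (x , y) → y , x)
              ; ∧-assoc = λ _ _ _ a → mk⇔ (λ ((x , y) , z) → x , y , z) (λ (x , y , z) → (x , y) , z)
              ; ∧-cong  = λ e f a → mk⇔ (λ (x , y) → to (e a) x , to (f a) y)
                                          (λ (x , y) → from (e a) x , from (f a) y)
              ; absorptive = (λ _ _ a → mk⇔ (λ { (inj₁ x) → x ; (inj₂ (x , _)) → x }) inj₁)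
                           , (λ _ _ a → mk⇔ proj₁ (λ x → x , inj₁ x))
              }
            ; ∨-distrib-∧ =
                (λ _ _ _ a → mk⇔
                  (λ { (inj₁ x) → inj₁ x , inj₁ x ; (inj₂ (y , z)) → inj₂ y , inj₂ z })
                  (λ { (inj₁ x , _) → inj₁ x ; (inj₂ _ , inj₁ x) → inj₁ x
                     ; (inj₂ y , inj₂ z) → inj₂ (y , z) }))
              , (λ _ _ _ a → mk⇔
                  (λ { (inj₁ (y , z)) → inj₁ y , inj₁ z ; (inj₂ x) → inj₂ x , inj₂ x })
                  (λ { (inj₂ x , _) → inj₂ x ; (inj₁ _ , inj₂ x) → inj₂ x
                     ; (inj₁ y , inj₁ z) → inj₁ (y , z) }))
            ; ∧-distrib-∨ =
                (λ _ _ _ a → mk⇔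
                  (λ { (x , inj₁ y) → inj₁ (x , y) ; (x , inj₂ z) → inj₂ (x , z) })
                  (λ { (inj₁ (x , y)) → x , inj₁ y ; (inj₂ (x , z)) → x , inj₂ z }))
              , (λ _ _ _ a → mk⇔
                  (λ { (inj₁ y , x) → inj₁ (y , x) ; (inj₂ z , x) → inj₂ (z , x) })
                  (λ { (inj₁ (y , x)) → inj₁ y , x ; (inj₂ (z , x)) → inj₂ z , x }))
            }
          ; ∨-complement = (λ _ a → mk⇔ (λ _ → lift tt) (λ _ → Sum.swap (excluded _)))
                         , (λ _ a → mk⇔ (λ _ → lift tt) (λ _ → excluded _))
          ; ∧-complement = (λ _ a → mk⇔ (λ (¬x , x) → lift (¬x x)) λ ())
                         , (λ _ a → mk⇔ (λ (x , ¬x) → lift (¬x x)) λ ())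
          ; ¬-cong       = λ e a → mk⇔ (λ ¬x y → ¬x (from (e a) y)) (λ ¬y x → ¬y (to (e a) x))
          }
        ; op-cong            = λ Ω e a → mk⇔ (λ (b , x , r) → b , to (e b) x , r)
                                              (λ (b , y , r) → b , from (e b) y , r)
        ; completelyAdditive = λ Ω x y (upper , least) →
            (λ k → ≤⁺ {C.op Ω (x k)} {C.op Ω y} λ a (b , xb , r) → b , ≤⁻ {x k} {y} (upper k) b xb , r) ,
            λ z bound → ≤⁺ {C.op Ω y} {z} λ a (b , yb , r) →
              let y≤⋃x = least (⋃ x) λ k → ≤⁺ {x k} {⋃ x} λ a xa → lift (⌊⌋⁺ (k , xa))
                  k , xkb = ⌊⌋⁻ (lower (≤⁻ {y} {⋃ x} y≤⋃x b yb))
              in ≤⁻ {C.op Ω (x k)} {z} (bound k) a (b , xkb , r)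
        }
        where
        excluded : (P : Set ℓ) → P ⊎ ¬ P
        excluded P with em {P = P}
        ... | yes p = inj₁ p
        ... | no ¬p = inj₂ ¬p
        -- Index types in complete additivity live one level above the subsets; passing through
        -- `⌊_⌋` brings the union down again.
        ⋃ : ∀ {k} {K : Set k} → (K → Set!) → Set!
        ⋃ x = (λ a → Lift ℓ (Holds ⌊ (∃[ k ] proj₁ (x k) a) ⌋)) ,
              λ a≈b (lift t) → let k , xa = ⌊⌋⁻ t in lift (⌊⌋⁺ (k , proj₂ (x k) a≈b xa))

      private
        singleton : S.Carrier → Set!
        singleton a = (S._≈ a) , λ b≈c b≈a → ≈.trans (≈.sym b≈c) b≈a

        singleton≤ : ∀ {a x} → proj₁ x a → singleton a C.≤ x
        singleton≤ {a} {x} xa = ≤⁺ {singleton a} {x} λ b b≈a → proj₂ x (≈.sym b≈a) xa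

        singleton-isAtom : ∀ a → C.IsAtom (singleton a)
        singleton-isAtom a = (λ e → lower (to (e a) ≈.refl)) , λ x x≤a → case x x≤a
          where
          case : ∀ x → x C.≤ singleton a → x C.≈ C.𝟘 ⊎ x C.≈ singleton a
          case x x≤a with em {P = proj₁ x a}
          ... | yes xa = inj₂ λ b → mk⇔ (≤⁻ {x} {singleton a} x≤a b)
                                         (≤⁻ {singleton a} {x} (singleton≤ {a} {x} xa) b)
          ... | no ¬xa = inj₁ λ b →
                mk⇔ (λ xb → lift (¬xa (proj₂ x (≤⁻ {x} {singleton a} x≤a b xb) xb))) λ ()

        element : ∀ {x} → ¬ (x C.≈ C.𝟘) → ∃ (proj₁ x)
        element {x} x≉0 = ¬¬-elim λ none → x≉0 λ a → mk⇔ (λ xa → lift (none (a , xa))) λ ()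

      complex-atomic : Algebra.Atomic complex
      complex-atomic x x≉0 with a , xa ← element {x} x≉0 =
        singleton a , singleton-isAtom a , singleton≤ {a} {x} xa

      private
        atomElement : Σ C.Carrier C.IsAtom → S.Carrier
        atomElement (x , x≉0 , _) = proj₁ (element {x} x≉0)

        atom≈ : (α : Σ C.Carrier C.IsAtom) → ∀ b → proj₁ (proj₁ α) b ⇔ (b S.≈ atomElement α)
        atom≈ (x , x≉0 , minimal) with element {x} x≉0
        ... | a , xa with minimal (singleton a) (singleton≤ {a} {x} xa)
        ...   | inj₁ e = ⊥-elim (lower (to (e a) ≈.refl))
        ...   | inj₂ e = λ b → mk⇔ (from (e b)) (to (e b))

        atomElement-∈ : (α : Σ C.Carrier C.IsAtom) → proj₁ (proj₁ α) (atomElement α)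
        atomElement-∈ α = from (atom≈ α (atomElement α)) ≈.refl

      At-complex : At complex ≅ₛ S
      At-complex = record
        { bijection = record
          { to        = atomElement
          ; cong      = λ {α} {β} e → to (atom≈ β (atomElement α)) (to (e (atomElement α)) (atomElement-∈ α))
          ; bijective = (λ {α} {β} e b → mk⇔
              (λ x → from (atom≈ β b) (≈.trans (to (atom≈ α b) x) e))
              (λ y → from (atom≈ α b) (≈.trans (to (atom≈ β b) y) (≈.sym e))))
            , λ a → (singleton a , singleton-isAtom a) , λ {β} e →
                to (e (atomElement β)) (atomElement-∈ β)
          }
        ; R-iso = λ Ω α β → mk⇔
            (λ le → let b , yb , r = ≤⁻ {proj₁ α} {C.op Ω (proj₁ β)} le (atomElement α) (atomElement-∈ α)
                    in proj₁ (S.R-respects Ω) (to (atom≈ β b) yb) r)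
            (λ r → ≤⁺ {proj₁ α} {C.op Ω (proj₁ β)} λ a xa → atomElement β , atomElement-∈ β ,
                      proj₂ (S.R-respects Ω) (≈.sym (to (atom≈ α a) xa)) r)
        ; D-iso = λ d α → mk⇔
            (λ le → ≤⁻ {proj₁ α} {C.const d} le (atomElement α) (atomElement-∈ α))
            (λ t → ≤⁺ {proj₁ α} {C.const d} λ a xa → S.D-respects d (≈.sym (to (atom≈ α a) xa)) t)
        }

  open ComplexAlgebras

  -- Ultraproducts and Łoś's theorem.

  module Ultraproducts where
    open import Data.Vec.Functional using (_∷_)
    open import Relation.Binary.Bundles using (Setoid)

    module _ {n σ ℓ} {I : Set} (U : Ultrafilter I) (S : I → AtomStructure n σ ℓ ℓ ℓ) where
      private
        module S i = AtomStructure (S i)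
        module ≈ i = Setoid (S.universe i)

      ultraproduct : AtomStructure n σ ℓ ℓ ℓ
      ultraproduct = record
        { universe   = record
          { Carrier       = ∀ i → S.Carrier i
          ; _≈_           = λ f g → Lift ℓ (U ∋ λ i → S._≈_ i (f i) (g i))
          ; isEquivalence = record
            { refl  = lift (∋-all U λ i → ≈.refl i)
            ; sym   = λ (lift e) → lift (∋-mono U (λ i → ≈.sym i) e)
            ; trans = λ (lift e) (lift f) → lift (∋-mono₂ U (λ i → ≈.trans i) e f)
            }
          }
        ; R          = λ Ω f g → Lift ℓ (U ∋ λ i → S.R i Ω (f i) (g i))
        ; D          = λ d f → Lift ℓ (U ∋ λ i → S.D i d (f i))
        ; R-respects = λ Ω → (λ (lift e) (lift r) → lift (∋-mono₂ U (λ i → proj₁ (S.R-respects i Ω)) e r))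
                           , (λ (lift e) (lift r) → lift (∋-mono₂ U (λ i → proj₂ (S.R-respects i Ω)) e r))
        ; D-respects = λ d (lift e) (lift t) → lift (∋-mono₂ U (λ i → S.D-respects i d) e t)
        }

      module _ (default : ∀ i → S.Carrier i) where

        -- For `∀′`, if almost all factors had a counterexample, a choice `f` of counterexamples
        -- would be one in the ultraproduct; `default` fills in the remaining factors.
        łoś : ∀ {m} (φ : Formula n σ m) (v : Fin m → ∀ i → S.Carrier i) →
              Satisfies ultraproduct v φ ⇔ U ∋ (λ i → Satisfies (S i) (λ x → v x i) φ)
        łoś (x ≐ y)     v = mk⇔ lower lift
        łoś (rel Ω x y) v = mk⇔ lower lift
        łoś (unary d x) v = mk⇔ lower lift
        łoś ⊥′          v = mk⇔ (λ ()) (∋-const U)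
        łoś (φ ⇒′ ψ)    v = mk⇔ forth
          λ u s → from (łoś ψ v) (∋-mono₂ U (λ _ f x → f x) u (to (łoś φ v) s))
          where
          forth : (Satisfies ultraproduct v φ → Satisfies ultraproduct v ψ) →
                  U ∋ (λ i → Satisfies (S i) (λ x → v x i) φ → Satisfies (S i) (λ x → v x i) ψ)
          forth f with ∋-total U (λ i → Satisfies (S i) (λ x → v x i) φ)
          ... | inj₁ u = ∋-mono U (λ _ y _ → y) (to (łoś ψ v) (f (from (łoś φ v) u)))
          ... | inj₂ u = ∋-mono U (λ _ ¬x x → ⊥-elim (¬x x)) u
        łoś (∀′ φ)      v = mk⇔ forth
          λ u f → from (łoś φ (f ∷ v))
            (∋-mono U (λ i s → subst (λ w → Satisfies (S i) w φ) (sym (at f i)) (s (f i))) u)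
          where
          at : ∀ (f : ∀ i → S.Carrier i) i → (λ x → (f ∷ v) x i) ≡ (f i ∷ λ x → v x i)
          at f i = ext λ { zero → refl ; (suc x) → refl }
          Counter : ∀ i → S.Carrier i → Set ℓ
          Counter i a = ¬ Satisfies (S i) (a ∷ λ x → v x i) φ
          forth : (∀ f → Satisfies ultraproduct (f ∷ v) φ) →
                  U ∋ (λ i → ∀ a → Satisfies (S i) (a ∷ λ x → v x i) φ)
          forth s with ∋-total U (λ i → ∀ a → Satisfies (S i) (a ∷ λ x → v x i) φ)
          ... | inj₁ u = u
          ... | inj₂ u = ⊥-elim (∋-∁⁻ U (∋-mono U (λ i → counter-spec i) (∋-mono U (λ i → ¬∀⇒∃¬) u))
                           (∋-mono U (λ i → subst (λ w → Satisfies (S i) w φ) (at f i))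
                                     (to (łoś φ (f ∷ v)) (s f))))
            where
            f : ∀ i → S.Carrier i
            f i with em {P = ∃ (Counter i)}
            ... | yes (a , _) = a
            ... | no _        = default i
            counter-spec : ∀ i → ∃ (Counter i) → Counter i (f i)
            counter-spec i c with em {P = ∃ (Counter i)}
            ... | yes (_ , ¬s) = ¬s
            ... | no ¬c        = ⊥-elim (¬c c)

  open Ultraproducts

  -- The atom structure of labelled tuples.

  module LabelledAtoms {ℓ} (n : ℕ) (V : Set ℓ) (_~_ : V → V → Set) where
    open import Data.Bool.Base using (if_then_else_)
    open import Data.Fin.Permutation.Components using (transpose)
    open import Relation.Nullary using (does)

    Discrete : (Fin n → Fin n → Bool) → Set
    Discrete p = ∀ {j k} → Holds (p j k) → j ≡ k

    -- The face opposite to `i` really has `n - 1` distinct points, and so carries a label.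
    BigFace : (Fin n → Fin n → Bool) → Fin n → Set
    BigFace p i = ∀ {j k} → j ≢ i → k ≢ i → Holds (p j k) → j ≡ k

    -- same i j: the points i and j of the tuple coincide; label i: the label of the
    -- face opposite to i. Labels of faces that are not big are junk, ignored by _≋_.
    record Atom : Set ℓ where
      field
        same       : Fin n → Fin n → Bool
        label      : Fin n → V
        same-refl  : ∀ i → Holds (same i i)
        same-sym   : ∀ {i j} → Holds (same i j) → Holds (same j i)
        same-trans : ∀ {i j k} → Holds (same i j) → Holds (same j k) → Holds (same i k)
        label-cong : ∀ {i j} → BigFace same i → Holds (same i j) → label i ≡ label j
        adjacent   : Discrete same → ∃[ i ] ∃[ j ] label i ~ label j

      Big : Fin n → Set
      Big = BigFace same

    open Atom

    infix 4 _≋_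
    _≋_ : Atom → Atom → Set ℓ
    a ≋ b = (∀ i j → same a i j ≡ same b i j) × (∀ i → Big a i → label a i ≡ label b i)

    bigFace-cong : ∀ {p q : Fin n → Fin n → Bool} {i} → (∀ {j k} → j ≢ i → k ≢ i → p j k ≡ q j k) →
                   BigFace p i → BigFace q i
    bigFace-cong p≡q big j≢i k≢i t = big j≢i k≢i (subst Holds (sym (p≡q j≢i k≢i)) t)

    ≋-big : ∀ {a b i} → a ≋ b → Big a i → Big b i
    ≋-big (e , _) = bigFace-cong λ {j} {k} _ _ → e j k

    ≋-refl : ∀ {a} → a ≋ a
    ≋-refl = (λ _ _ → refl) , λ _ _ → refl

    ≋-sym : ∀ {a b} → a ≋ b → b ≋ a
    ≋-sym {a} {b} (e , l) = (λ i j → sym (e i j)) ,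
      λ i big → sym (l i (bigFace-cong (λ {j} {k} _ _ → sym (e j k)) big))

    ≋-trans : ∀ {a b c} → a ≋ b → b ≋ c → a ≋ c
    ≋-trans {a} {b} a≋b (e , l) = (λ i j → ≡-trans (proj₁ a≋b i j) (e i j)) ,
      λ i big → ≡-trans (proj₂ a≋b i big) (l i (≋-big {a} {b} a≋b big))

    infix 4 _≡[_]_ _∘[_]_
    -- What remains of an atom when the point at index `i` is forgotten: every face opposite to
    -- another index involves that point.
    _≡[_]_ : Atom → Fin n → Atom → Set ℓ
    a ≡[ i ] b = (∀ {j k} → j ≢ i → k ≢ i → same a j k ≡ same b j k) × (Big a i → label a i ≡ label b i)

    -- b is a ∘ τ. If the face of b opposite to j is big then τ maps the indices
    -- other than j bijectively to those other than some m.
    _∘[_]_ : Atom → (Fin n → Fin n) → Atom → Set ℓ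
    a ∘[ τ ] b = (∀ j k → same b j k ≡ same a (τ j) (τ k)) ×
                 (∀ j m → Big b j → Big a m → (∀ k → k ≢ j → τ k ≢ m) → label b j ≡ label a m)

    ≡[]-respʳ : ∀ {i x y z} → y ≋ z → x ≡[ i ] y → x ≡[ i ] z
    ≡[]-respʳ (e , l) (r , s) = (λ {j} {k} j≢i k≢i → ≡-trans (r j≢i k≢i) (e j k)) ,
      λ big → ≡-trans (s big) (l _ (bigFace-cong r big))

    ≡[]-respˡ : ∀ {i x y z} → y ≋ z → y ≡[ i ] x → z ≡[ i ] x
    ≡[]-respˡ {y = y} {z} y≋z (r , s) =
      (λ {j} {k} j≢i k≢i → ≡-trans (sym (proj₁ y≋z j k)) (r j≢i k≢i)) ,
      λ big → ≡-trans (sym (proj₂ y≋z _ (big′ big))) (s (big′ big))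
      where big′ = ≋-big {z} {y} (≋-sym {y} {z} y≋z)

    ∘[]-respʳ : ∀ {τ x y z} → y ≋ z → x ∘[ τ ] y → x ∘[ τ ] z
    ∘[]-respʳ {y = y} {z} y≋z (r , s) = (λ j k → ≡-trans (sym (proj₁ y≋z j k)) (r j k)) ,
      λ j m big big′ missed → let big″ = ≋-big {z} {y} (≋-sym {y} {z} y≋z) big in
        ≡-trans (sym (proj₂ y≋z j big″)) (s j m big″ big′ missed)

    ∘[]-respˡ : ∀ {τ x y z} → y ≋ z → y ∘[ τ ] x → z ∘[ τ ] x
    ∘[]-respˡ {y = y} {z} y≋z (r , s) = (λ j k → ≡-trans (r j k) (proj₁ y≋z _ _)) ,
      λ j m big big′ missed → let big″ = ≋-big {z} {y} (≋-sym {y} {z} y≋z) big′ in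
        ≡-trans (s j m big big″ missed) (proj₂ y≋z m big″)

    ≡[]-trans : ∀ {i a b c} → a ≡[ i ] b → b ≡[ i ] c → a ≡[ i ] c
    ≡[]-trans (r , l) (r′ , l′) = (λ j≢i k≢i → ≡-trans (r j≢i k≢i) (r′ j≢i k≢i)) ,
      λ big → ≡-trans (l big) (l′ (bigFace-cong r big))

    ≡[]-sym : ∀ {i a b} → a ≡[ i ] b → b ≡[ i ] a
    ≡[]-sym (r , s) = (λ j≢i k≢i → sym (r j≢i k≢i)) ,
      λ big → sym (s (bigFace-cong (λ j≢i k≢i → sym (r j≢i k≢i)) big))

    atomStructure : ∀ σ → AtomStructure n σ ℓ ℓ ℓ
    atomStructure σ = record
      { universe   = record
        { Carrier = Atom ; _≈_ = _≋_
        ; isEquivalence = record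
          { refl  = λ {a} → ≋-refl {a}
          ; sym   = λ {a} {b} → ≋-sym {a} {b}
          ; trans = λ {a} {b} {c} → ≋-trans {a} {b} {c}
          }
        }
      ; R          = R
      ; D          = λ { (diag _ i j) a → Lift ℓ (Holds (same a i j)) }
      ; R-respects = λ Ω → (λ {x y z} → respʳ Ω {x} {y} {z}) , (λ {x y z} → respˡ Ω {x} {y} {z})
      ; D-respects = λ { (diag _ i j) (e , _) (lift t) → lift (subst Holds (e i j) t) }
      }
      where
      R : Operator n σ → Atom → Atom → Set ℓ
      R (cyl i)       a b = a ≡[ i ] b
      R (repl _ i j)  a b = a ∘[ [_∣_] {σ = σ} {u = 0ℓ} i j ] b
      R (trans _ i j) a b = a ∘[ transpose i j ] b

      respʳ : ∀ Ω {x y z} → y ≋ z → R Ω x y → R Ω x z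
      respʳ (cyl i)       {x} {y} {z} = ≡[]-respʳ {i} {x} {y} {z}
      respʳ (repl _ i j)  {x} {y} {z} = ∘[]-respʳ {[_∣_] {σ = σ} {u = 0ℓ} i j} {x} {y} {z}
      respʳ (trans _ i j) {x} {y} {z} = ∘[]-respʳ {transpose i j} {x} {y} {z}

      respˡ : ∀ Ω {x y z} → y ≋ z → R Ω y x → R Ω z x
      respˡ (cyl i)       {x} {y} {z} = ≡[]-respˡ {i} {x} {y} {z}
      respˡ (repl _ i j)  {x} {y} {z} = ∘[]-respˡ {[_∣_] {σ = σ} {u = 0ℓ} i j} {x} {y} {z}
      respˡ (trans _ i j) {x} {y} {z} = ∘[]-respˡ {transpose i j} {x} {y} {z}

    module _ {i j : Fin n} (i≢j : i ≢ j) where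

      collapse : Fin n → Fin n
      collapse k = if does (k ≟ i) then j else k

      collapse≢ : ∀ k → collapse k ≢ i
      collapse≢ k with k ≟ i
      ... | yes _  = λ j≡i → i≢j (sym j≡i)
      ... | no k≢i = k≢i

      collapse-same : ∀ a → Holds (same a i j) → ∀ k → Holds (same a k (collapse k))
      collapse-same a t k with k ≟ i
      ... | yes refl = t
      ... | no _     = same-refl a k

      collapse-i : collapse i ≡ j
      collapse-i with i ≟ i
      ... | yes _  = refl
      ... | no i≢i = ⊥-elim (i≢i refl)

      collapse-other : ∀ {k} → k ≢ i → collapse k ≡ k
      collapse-other {k} k≢i with k ≟ i
      ... | yes k≡i = ⊥-elim (k≢i k≡i)
      ... | no _    = refl

      collapse-identifies : ∀ a → Holds (same a (collapse i) (collapse j))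
      collapse-identifies a = subst₂ (λ k l → Holds (same a k l)) (sym collapse-i)
                                (sym (collapse-other (λ j≡i → i≢j (sym j≡i)))) (same-refl a j)

      -- Once `i` and `j` coincide, only the faces opposite to `i` and to `j` can be big, and they
      -- are the same face. So a single label suffices.
      collapsed : Atom → Atom
      collapsed a = record
        { same       = λ k l → same a (collapse k) (collapse l)
        ; label      = λ _ → label a i
        ; same-refl  = λ _ → same-refl a _
        ; same-sym   = same-sym a
        ; same-trans = same-trans a
        ; label-cong = λ _ _ → refl
        ; adjacent   = λ disc → ⊥-elim (i≢j (disc {i} {j} (collapse-identifies a)))
        }

      collapsed-ij : ∀ a → Holds (same (collapsed a) i j)
      collapsed-ij = collapse-identifies

      collapsed-≡[] : ∀ a → a ≡[ i ] collapsed a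
      collapsed-≡[] a =
        (λ k≢i l≢i → cong₂ (same a) (sym (collapse-other k≢i)) (sym (collapse-other l≢i))) , λ _ → refl

      big-swap : ∀ a → Holds (same a i j) → Big a j → Big a i
      big-swap a t big {k} {l} k≢i l≢i s with k ≟ j | l ≟ j
      ... | yes refl | yes refl = refl
      ... | no k≢j   | no l≢j   = big k≢j l≢j s
      ... | yes refl | no l≢j   = ⊥-elim (l≢i (sym (big i≢j l≢j (same-trans a t s))))
      ... | no k≢j   | yes refl = ⊥-elim (k≢i (big k≢j i≢j (same-trans a s (same-sym a t))))

      -- The atomic form of the cylindric algebra law that d_ij · c_i(d_ij · x) lies below x: if the
      -- point `i` is also the point `j`, forgetting it loses nothing.
      ≡[]-diagonal : ∀ a b → a ≡[ i ] b → Holds (same a i j) → Holds (same b i j) → a ≋ b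
      ≡[]-diagonal a b (r , s) ta tb = same≡ , label≡
        where
        collapse-invariant : ∀ c → Holds (same c i j) →
                             ∀ k l → same c k l ≡ same c (collapse k) (collapse l)
        collapse-invariant c t k l = Holds-ext
          (λ u → same-trans c (same-sym c (collapse-same c t k)) (same-trans c u (collapse-same c t l)))
          (λ u → same-trans c (collapse-same c t k) (same-trans c u (same-sym c (collapse-same c t l))))
        same≡ : ∀ k l → same a k l ≡ same b k l
        same≡ k l = ≡-trans (collapse-invariant a ta k l)
          (≡-trans (r (collapse≢ k) (collapse≢ l)) (sym (collapse-invariant b tb k l)))
        label≡ : ∀ k → Big a k → label a k ≡ label b k
        label≡ k big with k ≟ i | k ≟ j
        ... | yes refl | _ = s big
        ... | no _ | yes refl = ≡-trans (label-cong a big (same-sym a ta))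
                (≡-trans (s big-i) (label-cong b (bigFace-cong r big-i) tb))
          where big-i = big-swap a ta big
        ... | no k≢i | no k≢j = ⊥-elim (i≢j (big (λ i≡k → k≢i (sym i≡k)) (λ j≡k → k≢j (sym j≡k)) ta))

  -- The representation built from ultrafilters on labellings.

  module Representation {ℓ} {n N : ℕ} (2<n : 2 < n) (N-large : n * 2 ^ n < N)
    {V : Set ℓ} (_~_ : V → V → Set) (~-sym : ∀ {v w} → v ~ w → w ~ v)
    (copy : V → Fin N) (cross : ∀ {v w} → copy v ≢ copy w → v ~ w)
    (uncolourable : ∀ c {C} (f : V → Fin C) →
                    ¬ (∀ v w → copy v ≡ c → copy w ≡ c → v ~ w → f v ≢ f w))
    where
    open import Data.Fin.Base using (join; splitAt; combine; remQuot; funToFin; finToFun)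
    open import Data.Nat.Base using (_≤_)
    open import Data.Sum.Properties using (inj₁-injective; inj₂-injective)

    open ThreeElements 2<n
    open LabelledAtoms n V _~_

    0ᵢ : Fin n
    0ᵢ = fromℕ< (ℕₚ.≤-trans (s≤s z≤n) 2<n)

    0ᶜ : Fin N
    0ᶜ = fromℕ< (ℕₚ.≤-trans (s≤s z≤n) N-large)

    module Flood (c : Fin N) where

      -- Codes the set `rest`, whose complement in copy `c` has a finite colouring. The finitely
      -- colourable parts of the copy form an ideal, proper by `uncolourable`; `flood` extends the
      -- dual filter.
      record Colouring : Set ℓ where
        field
          rest    : V → Bool
          size    : ℕ
          colour  : V → Fin size
          proper  : ∀ v w → copy v ≡ c → copy w ≡ c → ¬ Holds (rest v) → ¬ Holds (rest w) →
                    v ~ w → colour v ≢ colour w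
      open Colouring

      Rest : Colouring → V → Set
      Rest r v = Holds (rest r v) × copy v ≡ c

      merge : Colouring → Colouring → Colouring
      merge r s = record
        { rest   = rest r ∩ rest s
        ; size   = size r + size s
        ; colour = λ v → join (size r) (size s) (both v)
        ; proper = λ v w cv cw ¬v ¬w v~w e → both-proper v w cv cw ¬v ¬w v~w
            (≡-trans (sym (Finₚ.splitAt-join (size r) (size s) (both v)))
              (≡-trans (cong (splitAt (size r)) e) (Finₚ.splitAt-join (size r) (size s) (both w))))
        }
        where
        both : V → Fin (size r) ⊎ Fin (size s)
        both v with em {P = Holds (rest r v)}
        ... | no _  = inj₁ (colour r v)
        ... | yes _ = inj₂ (colour s v)
        both-proper : ∀ v w → copy v ≡ c → copy w ≡ c → ¬ Holds ((rest r ∩ rest s) v) →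
                      ¬ Holds ((rest r ∩ rest s) w) → v ~ w → both v ≢ both w
        both-proper v w cv cw ¬v ¬w v~w e with em {P = Holds (rest r v)} | em {P = Holds (rest r w)}
        ... | no ¬r | no ¬r′ = proper r v w cv cw ¬r ¬r′ v~w (inj₁-injective e)
        ... | yes t | yes t′ = proper s v w cv cw (λ u → ¬v (∩⁺ t u)) (λ u → ¬w (∩⁺ t′ u)) v~w
                                 (inj₂-injective e)
        ... | no _  | yes _  with () ← e
        ... | yes _ | no _   with () ← e

      base : IsFilterBase Rest
      base = record
        { index     = record { rest = λ _ → true ; size = 1 ; colour = λ _ → zero
                             ; proper = λ _ _ _ _ ¬t → ⊥-elim (¬t (holds refl)) }
        ; directed  = λ r s → merge r s , λ v (t , cv) →
                        let u , u′ = ∩⁻ t in (u , cv) , (u′ , cv)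
        ; inhabited = λ r → ¬¬-elim λ none → uncolourable c (colour r) λ v w cv cw →
                        proper r v w cv cw (λ t → none (v , t , cv)) (λ t → none (w , t , cw))
        }

      flood : Ultrafilter V
      flood = extend base

      flood-copy : flood ∋ (λ v → copy v ≡ c)
      flood-copy = ∋-mono flood (λ _ → proj₂) (extend-∋ base (IsFilterBase.index base))

      -- An independent set is colourable by one colour, so its complement is in the filter.
      flood-edge : ∀ {p} {P : V → Set p} → flood ∋ P → ∃[ v ] ∃[ w ] (P v × P w × v ~ w)
      flood-edge {P = P} u = ¬¬-elim λ none →
        ∋-∁⁻ flood (∋-mono flood (λ v (t , _) → ⌊⌋⁻ t) (extend-∋ base (independent none))) u
        where
        independent : ¬ (∃[ v ] ∃[ w ] (P v × P w × v ~ w)) → Colouring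
        independent none = record
          { rest   = λ v → ⌊ ¬ P v ⌋
          ; size   = 1
          ; colour = λ _ → zero
          ; proper = λ v w _ _ ¬v ¬w v~w _ → none (v , w ,
              ¬¬-elim (λ ¬p → ¬v (⌊⌋⁺ ¬p)) , ¬¬-elim (λ ¬p → ¬w (⌊⌋⁺ ¬p)) , v~w)
          }

    open Flood using (flood; flood-copy; flood-edge)

    S : Set ℓ
    S = Atom

    -- If s belongs to c_i X, the point p = new s i X will provide the tuple
    -- s [ i ≔ p ] in X.
    data Point : Set ℓ where
      root : Point
      new  : (Fin n → Point) → Fin n → (S → Bool) → Point

    Tuple : Set ℓ
    Tuple = Fin n → Point

    Sub : Set ℓ
    Sub = Point → Bool

    -- Labels belong to sets of points, not to tuples with an index; tuples that share a face thus
    -- share its label automatically.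
    Labelling : Set ℓ
    Labelling = Sub → V

    tuple : Point → Tuple
    tuple root          = λ _ → root
    tuple p@(new s i X) = s [ i ≔ p ]

    place : Point → Fin n
    place root        = 0ᵢ
    place (new s i X) = i

    tuple-place : ∀ q → tuple q (place q) ≡ q
    tuple-place root        = refl
    tuple-place (new s i X) = ≔-same s i _

    depth : Point → ℕ
    depth root        = 0
    depth (new s i X) = suc (sumᶠ (λ j → depth (s j)))

    depth-new : ∀ s i X j → depth (s j) < depth (new s i X)
    depth-new s i X j = s≤s (≤-sumᶠ (λ j → depth (s j)) j)

    depth-tuple : ∀ q m → tuple q m ≡ q ⊎ depth (tuple q m) < depth q
    depth-tuple root m = inj₁ refl
    depth-tuple (new s i X) m with m ≟ i
    ... | yes refl = inj₁ refl
    ... | no m≢i   = inj₂ (depth-new s i X m)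

    face : Tuple → Fin n → Sub
    face s i u = ⌊ (∃[ k ] (k ≢ i × s k ≡ u)) ⌋

    range : Tuple → Sub
    range s u = ⌊ (∃[ k ] s k ≡ u) ⌋

    face⊆range : ∀ s i u → Holds (face s i u) → Holds (range s u)
    face⊆range s i u t = let k , _ , e = ⌊⌋⁻ t in ⌊⌋⁺ (k , e)

    face-∈ : ∀ s {i k} → k ≢ i → Holds (face s i (s k))
    face-∈ s {i} {k} k≢i = ⌊⌋⁺ (k , k≢i , refl)

    face-cong : ∀ {s t i} → (∀ k → k ≢ i → s k ≡ t k) → face s i ≡ face t i
    face-cong s≡t = subset-ext
      (λ u t → let k , k≢i , e = ⌊⌋⁻ t in ⌊⌋⁺ (k , k≢i , ≡-trans (sym (s≡t k k≢i)) e))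
      (λ u t → let k , k≢i , e = ⌊⌋⁻ t in ⌊⌋⁺ (k , k≢i , ≡-trans (s≡t k k≢i) e))

    face-repeated : ∀ {s i j} → s i ≡ s j → face s i ≡ face s j
    face-repeated {s} {i} {j} si≡sj with i ≟ j
    ... | yes refl = refl
    ... | no i≢j   = subset-ext (half i≢j si≡sj) (half (i≢j ∘ sym) (sym si≡sj))
      where
      half : ∀ {i j} → i ≢ j → s i ≡ s j → ∀ u → Holds (face s i u) → Holds (face s j u)
      half {i} {j} i≢j e u t with k , k≢i , ek ← ⌊⌋⁻ t with k ≟ j
      ... | no k≢j   = ⌊⌋⁺ (k , k≢j , ek)
      ... | yes refl = ⌊⌋⁺ (i , i≢j , ≡-trans e ek)

    Injective : Tuple → Set ℓ
    Injective s = ∀ {j k} → s j ≡ s k → j ≡ k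

    Valid : Tuple → Labelling → Set ℓ
    Valid s κ = Injective s → ∃[ j ] ∃[ k ] (κ (face s j) ~ κ (face s k))

    -- For injective `s` the map `σ` is a permutation, and `s` has the faces of `t` in another
    -- order.
    valid-transfer : ∀ {s t} (σ : Fin n → Fin n) → (∀ k → t (σ k) ≡ s k) → ∀ κ → Valid t κ → Valid s κ
    valid-transfer {s} {t} σ tσ≡s κ valid s-inj =
      let j , k , r = valid t-inj ; j′ , ej = preimage j ; k′ , ek = preimage k in
      j′ , k′ , subst₂ (λ A B → κ A ~ κ B) (faces j j′ ej) (faces k k′ ek) r
      where
      σ-inj : ∀ {j k} → σ j ≡ σ k → j ≡ k
      σ-inj {j} {k} e = s-inj (≡-trans (sym (tσ≡s j)) (≡-trans (cong t e) (tσ≡s k)))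
      preimage = injective⇒surjective σ σ-inj
      t-inj : Injective t
      t-inj {j} {k} e with j′ , refl ← preimage j | k′ , refl ← preimage k =
        cong σ (s-inj (≡-trans (sym (tσ≡s j′)) (≡-trans e (tσ≡s k′))))
      faces : ∀ j j′ → σ j′ ≡ j → face t j ≡ face s j′
      faces j j′ refl = subset-ext
        (λ u x → let k , k≢j , e = ⌊⌋⁻ x ; k′ , ek = preimage k in
           ⌊⌋⁺ (k′ , (λ e′ → k≢j (≡-trans (sym ek) (cong σ e′))) ,
                ≡-trans (sym (tσ≡s k′)) (≡-trans (cong t ek) e)))
        (λ u x → let k′ , k′≢j′ , e = ⌊⌋⁻ x in
           ⌊⌋⁺ (σ k′ , (λ e′ → k′≢j′ (σ-inj e′)) , ≡-trans (tσ≡s k′) e))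

    pattern-of : Tuple → Fin n → Fin n → Bool
    pattern-of s j k = ⌊ s j ≡ s k ⌋

    atom : (s : Tuple) (κ : Labelling) → Valid s κ → S
    atom s κ valid = record
      { same       = pattern-of s
      ; label      = λ i → κ (face s i)
      ; same-refl  = λ _ → ⌊⌋⁺ refl
      ; same-sym   = λ t → ⌊⌋⁺ (sym (⌊⌋⁻ t))
      ; same-trans = λ t u → ⌊⌋⁺ (≡-trans (⌊⌋⁻ t) (⌊⌋⁻ u))
      ; label-cong = λ _ t → cong κ (face-repeated {s} (⌊⌋⁻ t))
      ; adjacent   = λ disc → valid λ e → disc (⌊⌋⁺ e)
      }

    -- A topped face gets its label from the labelling chosen at its top point. Any
    -- other face gets the label flood c, in a copy c that avoids the labels of all
    -- topped faces with a top point in it. Avoidance is possible because such a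
    -- topped face is the image of a subset of Fin n under tuple q, with n choices
    -- for q.
    Topped : Sub → Point → Set ℓ
    Topped A q = Σ[ q∈A ∈ Holds (A q) ] (∀ u → Holds (A u) → ∃[ m ] tuple q m ≡ u)

    -- Each of two top points is an entry of the tuple of the other, and the entries of `tuple q`
    -- other than `q` have smaller depth.
    topped-unique : ∀ {A p q} → Topped A p → Topped A q → p ≡ q
    topped-unique {A} {p} {q} (p∈ , A⊆p) (q∈ , A⊆q) with A⊆q p p∈ | A⊆p q q∈
    ... | m , e | m′ , e′ with depth-tuple q m | depth-tuple p m′
    ...   | inj₁ eq | _       = ≡-trans (sym e) eq
    ...   | inj₂ _ | inj₁ eq  = ≡-trans (sym eq) e′
    ...   | inj₂ lt | inj₂ lt′ = ⊥-elim (ℕₚ.<-asym (subst (λ x → depth x < depth q) e lt)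
                                                    (subst (λ x → depth x < depth p) e′ lt′))

    marginal : Sub → Ultrafilter Labelling → Ultrafilter V
    marginal A = pushforward (λ κ → κ A)

    -- One inclusion between ultrafilters already means that they agree, see `marginal⁻`; this form
    -- is what a filter base delivers.
    Marginal : Sub → Ultrafilter V → Ultrafilter Labelling → Set ℓ
    Marginal A ν Ω = ∀ (Y : V → Bool) → ν ∋ (λ v → Holds (Y v)) → Ω ∋ (λ κ → Holds (Y (κ A)))

    marginal⁺ : ∀ {p A ν Ω} {P : V → Set p} → Marginal A ν Ω → ν ∋ P → Ω ∋ (λ κ → P (κ A))
    marginal⁺ {ν = ν} {Ω} {P} m u =
      ∋-mono Ω (λ κ t → ⌊⌋⁻ t) (m (λ v → ⌊ P v ⌋) (∋-mono ν (λ v p → ⌊⌋⁺ p) u))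

    marginal⁻ : ∀ {p A ν Ω} {P : V → Set p} → Marginal A ν Ω → Ω ∋ (λ κ → P (κ A)) → ν ∋ P
    marginal⁻ {A = A} {ν} {Ω} {P} m u with ∋-total ν P
    ... | inj₁ v = v
    ... | inj₂ v = ⊥-elim (∋-∁⁻ Ω (marginal⁺ {A = A} {ν} {Ω} m v) u)

    -- `θ` stands for the still undefined `Θ` on the points of `A`. As a parameter it leaves the
    -- definition of `Θ` structurally recursive.
    module _ (A : Sub) (θ : ∀ u → Holds (A u) → Ultrafilter Labelling) where

      Avoids : Fin N → Set ℓ
      Avoids c = ∀ q (q∈A : Holds (A q)) B → Topped B q → marginal B (θ q q∈A) ∋ (λ v → copy v ≢ c)

      abstract
        -- The default `0ᶜ` allows the choice to be made inside the recursion; `avoids-free` shows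
        -- afterwards that faces do have an avoiding copy.
        copyChoice : Σ[ c ∈ Fin N ] (∃ Avoids → Avoids c)
        copyChoice with em {P = ∃ Avoids}
        ... | yes (c , avoids) = c , λ _ → avoids
        ... | no none          = 0ᶜ , λ e → ⊥-elim (none e)

      avoidingCopy : Fin N
      avoidingCopy = proj₁ copyChoice

      abstract
        typeChoice : Σ[ μ ∈ Ultrafilter V ]
          ((Σ[ q ∈ Point ] Σ[ top ∈ Topped A q ] μ ≡ marginal A (θ q (proj₁ top)))
           ⊎ ((¬ ∃ (Topped A)) × μ ≡ flood avoidingCopy))
        typeChoice with em {P = ∃ (Topped A)}
        ... | yes (q , top) = marginal A (θ q (proj₁ top)) , inj₁ (q , top , refl)
        ... | no ¬top       = flood avoidingCopy , inj₂ (¬top , refl)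

      faceType : Ultrafilter V
      faceType = proj₁ typeChoice

    vertex : V
    vertex = proj₁ (∋-witness (flood 0ᶜ) (flood-copy 0ᶜ))

    private
      elsewhere : ∀ v → ∃[ c ] (∀ (x : Fin 1) → copy v ≢ c)
      elsewhere v = unhit (ℕₚ.≤-<-trans (ℕₚ.*-mono-≤ (ℕₚ.<⇒≤ (ℕₚ.<⇒≤ 2<n)) (ℕₚ.m^n>0 2 n)) N-large)
                          (λ _ → copy v)

    neighbour : V → V
    neighbour v = proj₁ (∋-witness (flood (proj₁ (elsewhere v))) (flood-copy (proj₁ (elsewhere v))))

    neighbour-~ : ∀ v → v ~ neighbour v
    neighbour-~ v = cross λ e → proj₂ (elsewhere v) zero
      (≡-trans e (proj₂ (∋-witness (flood (proj₁ (elsewhere v))) (flood-copy (proj₁ (elsewhere v))))))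


    -- Amalgamation with one prescribed marginal. Finitely many large sets have a large
    -- intersection, so `box` only has to meet one of them at a time. `C` is the condition under
    -- which the marginal is imposed.
    module OneFace (A : Sub) (ν : Ultrafilter V) {p} (E : Labelling → Set p) (C : Set ℓ)
      (box : ∀ (Y : V → Bool) → ν ∋ (λ v → Holds (Y v)) → ∃[ κ ] (E κ × (C → Holds (Y (κ A))))) where

      private
        Constraint : Set ℓ
        Constraint = Σ[ Y ∈ (V → Bool) ] (ν ∋ (λ v → Holds (Y v)))

        Z : Constraint → Labelling → Set (p ⊔ ℓ)
        Z j κ = E κ × (C → Holds (proj₁ j (κ A)))

        meets : ∀ i j → ∃[ k ] (∀ κ → Z k κ → Z i κ × Z j κ)
        meets (Y , u) (Y′ , u′) = (Y ∩ Y′ , ∋-mono₂ ν (λ v → ∩⁺ {X = Y} {Y = Y′} {x = v}) u u′) , λ κ z →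
          (proj₁ z , λ c → proj₁ (∩⁻ {X = Y} {Y = Y′} {x = κ A} (proj₂ z c))) ,
          (proj₁ z , λ c → proj₂ (∩⁻ {X = Y} {Y = Y′} {x = κ A} (proj₂ z c)))

        base : IsFilterBase Z
        base = record
          { index     = (λ _ → true) , ∋-all ν (λ _ → holds refl)
          ; directed  = meets
          ; inhabited = λ j → box (proj₁ j) (proj₂ j)
          }

      abstract
        extendMarginal : Σ[ Ω ∈ Ultrafilter Labelling ] (Ω ∋ E × (C → Marginal A ν Ω))
        extendMarginal = Ω ,
          ∋-mono Ω (λ κ (z : Z (IsFilterBase.index base) κ) → proj₁ z)
                   (extend-∋ base (IsFilterBase.index base)) ,
          λ c Y u → ∋-mono Ω (λ κ (z : Z (Y , u) κ) → proj₂ z c) (extend-∋ base (Y , u))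
          where
          Ω : Ultrafilter Labelling
          Ω = extend base

    -- Amalgamation with all marginals prescribed at once. A condition on a single marginal is a
    -- family that is trivial elsewhere (`only`), and conditions intersect pointwise.
    module AllFaces (ν : Sub → Ultrafilter V) {p} (E : Labelling → Set p)
      (box : ∀ (Y : Sub → V → Bool) → (∀ A → ν A ∋ (λ v → Holds (Y A v))) →
             ∃[ κ ] (E κ × (∀ A → Holds (Y A (κ A))))) where

      private
        Constraint : Set ℓ
        Constraint = Σ[ Y ∈ (Sub → V → Bool) ] (∀ A → ν A ∋ (λ v → Holds (Y A v)))

        Z : Constraint → Labelling → Set (p ⊔ ℓ)
        Z j κ = E κ × (∀ A → Holds (proj₁ j A (κ A)))

        meets : ∀ i j → ∃[ k ] (∀ κ → Z k κ → Z i κ × Z j κ)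
        meets (Y , u) (Y′ , u′) =
          ((λ A → Y A ∩ Y′ A) ,
           λ A → ∋-mono₂ (ν A) (λ v → ∩⁺ {X = Y A} {Y = Y′ A} {x = v}) (u A) (u′ A)) , λ κ z →
          (proj₁ z , λ A → proj₁ (∩⁻ {X = Y A} {Y = Y′ A} {x = κ A} (proj₂ z A))) ,
          (proj₁ z , λ A → proj₂ (∩⁻ {X = Y A} {Y = Y′ A} {x = κ A} (proj₂ z A)))

        base : IsFilterBase Z
        base = record
          { index     = (λ _ _ → true) , λ A → ∋-all (ν A) (λ _ → holds refl)
          ; directed  = meets
          ; inhabited = λ j → box (proj₁ j) (proj₂ j)
          }

        module _ (A : Sub) (Y : V → Bool) where
          only : Sub → V → Bool
          only B v with em {P = B ≡ A}
          ... | yes _ = Y v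
          ... | no _  = true

          only-∋ : ν A ∋ (λ v → Holds (Y v)) → ∀ B → ν B ∋ (λ v → Holds (only B v))
          only-∋ u B with em {P = B ≡ A}
          ... | yes refl = u
          ... | no _     = ∋-all (ν B) (λ _ → holds refl)

          only-A : ∀ v → Holds (only A v) → Holds (Y v)
          only-A v t with em {P = A ≡ A}
          ... | yes _ = t
          ... | no ¬r = ⊥-elim (¬r refl)

      abstract
        extendMarginals : Σ[ Ω ∈ Ultrafilter Labelling ] (Ω ∋ E × (∀ A → Marginal A (ν A) Ω))
        extendMarginals = Ω ,
          ∋-mono Ω (λ κ (z : Z (IsFilterBase.index base) κ) → proj₁ z)
                   (extend-∋ base (IsFilterBase.index base)) ,
          λ A Y u → ∋-mono Ω (λ κ (z : Z (only A Y , only-∋ A Y u) κ) → only-A A Y (κ A) (proj₂ z A))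
                      (extend-∋ base (only A Y , only-∋ A Y u))
          where
          Ω : Ultrafilter Labelling
          Ω = extend base

    baseFace : Point → Sub
    baseFace q = face (tuple q) (place q)

    Good : Point → Ultrafilter V → Ultrafilter Labelling → Set ℓ
    Good q ν Ω = Ω ∋ Valid (tuple q) ×
                 (InjectiveOff (tuple q) (place q) → Marginal (baseFace q) ν Ω)

    Witnesses : Point → Labelling → Set ℓ
    Witnesses root          κ = Lift ℓ ⊥
    Witnesses p@(new s i X) κ = Σ[ valid ∈ Valid (tuple p) κ ] Holds (X (atom (tuple p) κ valid))

    good-exists : ∀ q ν → Σ[ Ω ∈ Ultrafilter Labelling ] Good q ν Ω
    good-exists q ν = OneFace.extendMarginal (baseFace q) ν (Valid (tuple q)) _ box
      where
      box : ∀ (Y : V → Bool) → ν ∋ (λ v → Holds (Y v)) →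
            ∃[ κ ] (Valid (tuple q) κ × (InjectiveOff (tuple q) (place q) → Holds (Y (κ (baseFace q)))))
      box Y u with v , Yv ← ∋-witness ν u = κ , valid , λ _ → subst (Holds ∘ Y) (sym κ-base) Yv
        where
        κ : Labelling
        -- The base face gets the prescribed label and every other set a neighbour of it, so an edge
        -- joins the base face to any other face.
        κ A with em {P = A ≡ baseFace q}
        ... | yes _ = v
        ... | no _  = neighbour v
        κ-base : κ (baseFace q) ≡ v
        κ-base with em {P = baseFace q ≡ baseFace q}
        ... | yes _ = refl
        ... | no ¬r = ⊥-elim (¬r refl)
        κ-other : ∀ {A} → A ≢ baseFace q → κ A ≡ neighbour v
        κ-other {A} A≢ with em {P = A ≡ baseFace q}
        ... | yes eq = ⊥-elim (A≢ eq)
        ... | no _   = refl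
        valid : Valid (tuple q) κ
        valid inj with k , k≢i , _ ← another (place q) (place q) =
          place q , k , subst₂ _~_ (sym κ-base) (sym (κ-other distinct)) (neighbour-~ v)
          where
          distinct : face (tuple q) k ≢ baseFace q
          distinct eq with l , l≢i , e ← ⌊⌋⁻ (subst (λ A → Holds (A (tuple q (place q)))) eq
                                           (face-∈ (tuple q) (λ i≡k → k≢i (sym i≡k)))) = l≢i (inj e)

    abstract
      -- There is a point `new s i X` for every `X`, even if the tuple `s` has no witness for `X` at
      -- `i`. Hence `X` is realised if possible, and otherwise any good ultrafilter is taken.
      extensionChoice : ∀ q ν → Σ[ Ω ∈ Ultrafilter Labelling ]
        (Good q ν Ω × (Σ[ Ω ∈ Ultrafilter Labelling ] (Good q ν Ω × Ω ∋ Witnesses q) → Ω ∋ Witnesses q))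
      extensionChoice q ν
        with em {P = Σ[ Ω ∈ Ultrafilter Labelling ] (Good q ν Ω × Ω ∋ Witnesses q)}
      ... | yes (Ω , good , w) = Ω , good , λ _ → w
      ... | no none            = let Ω , good = good-exists q ν in Ω , good , λ e → ⊥-elim (none e)

    faceExtension : Point → Ultrafilter V → Ultrafilter Labelling
    faceExtension q ν = proj₁ (extensionChoice q ν)

    -- For structural recursion a point `u` of the face is presented as an entry `s k`, with `k`
    -- read off from the proof `t`; `Θ-new` restores `u`.
    Θ : Point → Ultrafilter Labelling
    Θ root            = faceExtension root (principal vertex)
    Θ p@(new s i X) = faceExtension p (faceType (face s i) (λ u t → Θ (s (proj₁ (⌊⌋⁻ t)))))

    ν : Sub → Ultrafilter V
    ν A = faceType A (λ u _ → Θ u)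

    Θ-new : ∀ s i X → Θ (new s i X) ≡ faceExtension (new s i X) (ν (face s i))
    Θ-new s i X = cong (λ θ → faceExtension (new s i X) (faceType (face s i) θ)) θ≡
      where
      θ≡ : (λ (u : Point) (t : Holds (face s i u)) → Θ (s (proj₁ (⌊⌋⁻ t)))) ≡ (λ u _ → Θ u)
      θ≡ = ext λ u → ext λ t → cong Θ (proj₂ (proj₂ (⌊⌋⁻ t)))

    baseFace-new : ∀ s i X → baseFace (new s i X) ≡ face s i
    baseFace-new s i X = face-cong {tuple (new s i X)} {s} {i} λ k k≢i → ≔-other s k≢i

    root-not-injectiveOff : ∀ i → ¬ InjectiveOff (tuple root) i
    root-not-injectiveOff i inj with j , j≢i , _ ← another i i with k , k≢i , k≢j ← another i j =
      k≢j (sym (inj j≢i k≢i refl))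

    good-Θ : ∀ q → Good q (ν (baseFace q)) (Θ q)
    good-Θ root = proj₁ (proj₁ (proj₂ (extensionChoice root (principal vertex)))) ,
                  λ inj → ⊥-elim (root-not-injectiveOff 0ᵢ inj)
    good-Θ (new s i X) = subst₂ (Good (new s i X)) (cong ν (sym (baseFace-new s i X)))
      (sym (Θ-new s i X)) (proj₁ (proj₂ (extensionChoice (new s i X) (ν (face s i)))))

    ν-topped : ∀ {A q} → Topped A q → ν A ≡ marginal A (Θ q)
    ν-topped {A} top with proj₂ (typeChoice A (λ u _ → Θ u))
    ... | inj₁ (_ , top′ , eq) = ≡-trans eq (cong (λ q → marginal A (Θ q)) (topped-unique top′ top))
    ... | inj₂ (¬top , _)      = ⊥-elim (¬top (_ , top))

    free : Sub → Fin N
    free A = avoidingCopy A (λ u _ → Θ u)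

    ν-free : ∀ {A} → ¬ ∃ (Topped A) → ν A ≡ flood (free A)
    ν-free {A} ¬top with proj₂ (typeChoice A (λ u _ → Θ u))
    ... | inj₁ (_ , top , _) = ⊥-elim (¬top (_ , top))
    ... | inj₂ (_ , eq)      = eq

    subsetImage : Point → (Fin n → Fin 2) → Sub
    subsetImage q D u = ⌊ (∃[ m ] (D m ≡ suc zero × tuple q m ≡ u)) ⌋

    topped-image : ∀ {B q} → Topped B q → ∃[ D ] B ≡ subsetImage q D
    topped-image {B} {q} (_ , B⊆q) = D , subset-ext
      (λ u t → let m , e = B⊆q u t in
         ⌊⌋⁺ (m , cong bit (Holds.isTrue (subst (λ x → Holds (B x)) (sym e) t)) , e))
      (λ u t → let m , d , e = ⌊⌋⁻ t in subst (λ x → Holds (B x)) e (holds (bit-injective d)))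
      where
      D : Fin n → Fin 2
      D m = bit (B (tuple q m))

    abstract
      dominantCopy : (μ : Ultrafilter V) → ∃[ c ] (μ ∋ (λ v → copy v ≡ c))
      dominantCopy μ = ∋-∃Fin μ (∋-all μ λ v → copy v , refl)

    -- Each marginal in question lives on a single copy by `dominantCopy`. Top points and subsets of
    -- their tuples give `n * 2 ^ n` codes, fewer than there are copies.
    avoids-free : ∀ s i → Avoids (face s i) (λ u _ → Θ u) (free (face s i))
    avoids-free s i = proj₂ (copyChoice (face s i) (λ u _ → Θ u)) (c , avoids)
      where
      excludedBy : Fin n → Fin (2 ^ n) → Fin N
      excludedBy k x = proj₁ (dominantCopy (marginal (subsetImage (s k) (finToFun x)) (Θ (s k))))

      excluded : Fin (n * 2 ^ n) → Fin N
      excluded x = excludedBy (proj₁ (remQuot {n} (2 ^ n) x)) (proj₂ (remQuot {n} (2 ^ n) x))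

      c : Fin N
      c = proj₁ (unhit N-large excluded)

      avoids-image : ∀ k D → marginal (subsetImage (s k) D) (Θ (s k)) ∋ (λ v → copy v ≢ c)
      avoids-image k D = ∋-mono _ (λ v e c≡ → proj₂ (unhit N-large excluded) code
          (≡-trans excluded-code (≡-trans (sym e) c≡)))
        (proj₂ (dominantCopy (marginal (subsetImage (s k) D) (Θ (s k)))))
        where
        code : Fin (n * 2 ^ n)
        code = combine k (funToFin D)
        excluded-code : excluded code ≡ proj₁ (dominantCopy (marginal (subsetImage (s k) D) (Θ (s k))))
        excluded-code = ≡-trans
          (cong (λ p → excludedBy (proj₁ p) (proj₂ p)) (Finₚ.remQuot-combine {n} {2 ^ n} k (funToFin D)))
          (cong (λ E → proj₁ (dominantCopy (marginal (subsetImage (s k) E) (Θ (s k)))))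
                (ext (Finₚ.finToFun-funToFin D)))

      avoids : Avoids (face s i) (λ u _ → Θ u) c
      avoids q q∈ B top = let k , _ , e = ⌊⌋⁻ q∈ ; D , eq = topped-image (subst (Topped B) (sym e) top) in
        subst₂ (λ B q → marginal B (Θ q) ∋ (λ v → copy v ≢ c)) (sym eq) e (avoids-image k D)

    -- The edge relation of the ultrafilter extension of the graph, in symmetric form.
    Adjacent : Ultrafilter V → Ultrafilter V → Set ℓ
    Adjacent μ ν = ∀ (Y Y′ : V → Bool) → μ ∋ (λ v → Holds (Y v)) → ν ∋ (λ v → Holds (Y′ v)) →
                   ∃[ v ] ∃[ w ] (Holds (Y v) × Holds (Y′ w) × v ~ w)

    adjacent-sym : ∀ {μ ν} → Adjacent μ ν → Adjacent ν μ
    adjacent-sym adj Y Y′ u u′ with v , w , yv , yw , v~w ← adj Y′ Y u′ u = w , v , yw , yv , ~-sym v~w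

    flood-adjacent : ∀ c d → Adjacent (flood c) (flood d)
    flood-adjacent c d Y Y′ u u′ with c ≟ d
    ... | yes refl with v , w , (yv , _) , (_ , yw) , v~w ← flood-edge c (∋-∩ (flood c) u u′) =
          v , w , yv , yw , v~w
    ... | no c≢d with v , yv , cv ← ∋-witness (flood c) (∋-∩ (flood c) u (flood-copy c))
                    | w , yw , dw ← ∋-witness (flood d) (∋-∩ (flood d) u′ (flood-copy d)) =
          v , w , yv , yw , cross λ e → c≢d (≡-trans (sym cv) (≡-trans e dw))

    flood-topped-adjacent : ∀ s i {B q} → Holds (face s i q) → Topped B q →
                            Adjacent (flood (free (face s i))) (marginal B (Θ q))
    flood-topped-adjacent s i {B} {q} q∈ top Y Y′ u u′ =
      let v , yv , cv  = ∋-witness μ (∋-∩ μ u (flood-copy (free (face s i))))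
          w , yw , ¬cw = ∋-witness μ′ (∋-∩ μ′ u′ (avoids-free s i q q∈ B top))
      in v , w , yv , yw , cross λ e → ¬cw (≡-trans (sym e) cv)
      where
      μ  = flood (free (face s i))
      μ′ = marginal B (Θ q)

    faces-distinct : ∀ {s} → Injective s → ∀ {j k} → j ≢ k → face s j ≢ face s k
    faces-distinct {s} inj {j} {k} j≢k eq
      with l , l≢k , e ← ⌊⌋⁻ (subst (λ A → Holds (A (s k))) eq (face-∈ s (λ k≡j → j≢k (sym k≡j)))) =
      l≢k (inj e)

    module Untopped {s : Tuple} (inj : Injective s) (¬top : ¬ ∃ (Topped (range s))) where

      private
        j : Fin n
        j = proj₁ (argmax 0ᵢ (depth ∘ s))
        deepest : ∀ k → depth (s k) ≤ depth (s j)
        deepest = proj₂ (argmax 0ᵢ (depth ∘ s))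

      -- Two faces containing a deepest point are adjacent: if both are topped, then
      -- both by that point, which makes it a top point of range s.
      top-is-deepest : ∀ {k q} → k ≢ j → Topped (face s k) q → q ≡ s j
      top-is-deepest {k} {q} k≢j (q∈ , ⊆q)
        with m , e ← ⊆q (s j) (face-∈ s (λ j≡k → k≢j (sym j≡k))) | l , _ , refl ← ⌊⌋⁻ q∈
        with depth-tuple (s l) m
      ... | inj₁ eq = ≡-trans (sym eq) e
      ... | inj₂ lt = ⊥-elim (ℕₚ.<⇒≱ (subst (λ x → depth x < depth (s l)) e lt) (deepest l))

      adjacentFaces : ∃[ k ] ∃[ l ] (k ≢ l × Adjacent (ν (face s k)) (ν (face s l)))
      adjacentFaces with another j j
      -- By `2 < n` there are two indices besides `j`; the faces opposite to them both contain the
      -- deepest point.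
      ... | k , k≢j , _ with another j k
      ...   | l , l≢j , l≢k = k , l , (λ k≡l → l≢k (sym k≡l)) , adj
        where
        j∈k : Holds (face s k (s j))
        j∈k = face-∈ s (λ j≡k → k≢j (sym j≡k))
        j∈l : Holds (face s l (s j))
        j∈l = face-∈ s (λ j≡l → l≢j (sym j≡l))
        adj : Adjacent (ν (face s k)) (ν (face s l))
        adj with em {P = ∃ (Topped (face s k))} | em {P = ∃ (Topped (face s l))}
        ... | no ¬k | no ¬l = subst₂ Adjacent (sym (ν-free ¬k)) (sym (ν-free ¬l)) (flood-adjacent _ _)
        ... | no ¬k | yes (q , top) with refl ← top-is-deepest l≢j top =
              subst₂ Adjacent (sym (ν-free ¬k)) (sym (ν-topped top)) (flood-topped-adjacent s k j∈k top)
        ... | yes (q , top) | no ¬l with refl ← top-is-deepest k≢j top =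
              subst₂ Adjacent (sym (ν-topped top)) (sym (ν-free ¬l))
                (adjacent-sym {flood (free (face s l))} (flood-topped-adjacent s l j∈l top))
        ... | yes (q , top) | yes (q′ , top′)
          with refl ← top-is-deepest k≢j top | refl ← top-is-deepest l≢j top′ =
              ⊥-elim (¬top (s j , ⌊⌋⁺ (j , refl) , covered))
          where
          covered : ∀ u → Holds (range s u) → ∃[ m ] tuple (s j) m ≡ u
          covered u t with i , refl ← ⌊⌋⁻ t with i ≟ k
          ... | no i≢k   = proj₂ top (s i) (face-∈ s i≢k)
          ... | yes refl = proj₂ top′ (s i) (face-∈ s (λ i≡l → l≢k (sym i≡l)))

    Free : Sub → Ultrafilter Labelling → Set ℓ
    Free B Ω = (∀ A → Marginal A (ν A) Ω) × (∀ s → range s ≡ B → Ω ∋ Valid s)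

    -- Only two adjacent faces have to be labelled jointly, to produce an edge. Every other set
    -- takes any label from its own large set.
    free-exists : ∀ s → ¬ ∃ (Topped (range s)) → Σ[ Ω ∈ Ultrafilter Labelling ] Free (range s) Ω
    free-exists s ¬top =
      let Ω , valid , marg = AllFaces.extendMarginals ν (Valid s) box in
      Ω , marg , λ s′ eq → ∋-mono Ω
        (valid-transfer (λ k → proj₁ (index s′ eq k)) (λ k → proj₂ (index s′ eq k))) valid
      where
      index : ∀ s′ → range s′ ≡ range s → ∀ k → ∃[ m ] s m ≡ s′ k
      index s′ eq k = ⌊⌋⁻ (subst (λ A → Holds (A (s′ k))) eq (⌊⌋⁺ (k , refl)))
      box : ∀ (Y : Sub → V → Bool) → (∀ A → ν A ∋ (λ v → Holds (Y A v))) →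
            ∃[ κ ] (Valid s κ × (∀ A → Holds (Y A (κ A))))
      box Y u with em {P = Injective s}
      ... | no ¬inj = (λ A → proj₁ (∋-witness (ν A) (u A))) , (λ inj → ⊥-elim (¬inj inj)) ,
                      λ A → proj₂ (∋-witness (ν A) (u A))
      ... | yes inj with k , l , k≢l , adj ← Untopped.adjacentFaces inj ¬top
                    with v , w , yv , yw , v~w ← adj (Y (face s k)) (Y (face s l)) (u _) (u _) =
            (λ A → proj₁ (κ A)) , (λ _ → k , l , subst₂ _~_ (sym κk) (sym κl) v~w) , λ A → proj₂ (κ A)
        where
        κ : ∀ A → ∃[ x ] Holds (Y A x)
        κ A with em {P = A ≡ face s k} | em {P = A ≡ face s l}
        ... | yes refl | _        = v , yv
        ... | no _     | yes refl = w , yw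
        ... | no _     | no _     = ∋-witness (ν A) (u A)
        κk : proj₁ (κ (face s k)) ≡ v
        κk with em {P = face s k ≡ face s k} | em {P = face s k ≡ face s l}
        ... | yes refl | _ = refl
        ... | no ¬r    | _ = ⊥-elim (¬r refl)
        κl : proj₁ (κ (face s l)) ≡ w
        κl with em {P = face s l ≡ face s k} | em {P = face s l ≡ face s l}
        ... | yes e | _        = ⊥-elim (faces-distinct inj k≢l (sym e))
        ... | no _  | yes refl = refl
        ... | no _  | no ¬r    = ⊥-elim (¬r refl)

    abstract
      -- The choice depends on the range of a tuple alone, so that permuting a tuple does not change
      -- its ultrafilter. This is what substitutions will rely on.
      omegaChoice : ∀ B → Σ[ Ω ∈ Ultrafilter Labelling ]
        ((Σ[ q ∈ Point ] (Topped B q × Ω ≡ Θ q))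
         ⊎ ((¬ ∃ (Topped B)) × (Σ[ Ω ∈ Ultrafilter Labelling ] Free B Ω → Free B Ω)))
      omegaChoice B with em {P = ∃ (Topped B)}
      ... | yes (q , top) = Θ q , inj₁ (q , top , refl)
      ... | no ¬top with em {P = Σ[ Ω ∈ Ultrafilter Labelling ] Free B Ω}
      ...   | yes (Ω , f) = Ω , inj₂ (¬top , λ _ → f)
      ...   | no ¬f       = principal (λ _ → vertex) , inj₂ (¬top , λ f → ⊥-elim (¬f f))

    Ω : Sub → Ultrafilter Labelling
    Ω B = proj₁ (omegaChoice B)

    Ω-topped : ∀ {B q} → Topped B q → Ω B ≡ Θ q
    Ω-topped {B} top with proj₂ (omegaChoice B)
    ... | inj₁ (_ , top′ , eq) = ≡-trans eq (cong Θ (topped-unique top′ top))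
    ... | inj₂ (¬top , _)      = ⊥-elim (¬top (_ , top))

    valid-Ω : ∀ s → Ω (range s) ∋ Valid s
    valid-Ω s with proj₂ (omegaChoice (range s))
    ... | inj₂ (¬top , f) = proj₂ (f (free-exists s ¬top)) s refl
    ... | inj₁ (q , (_ , s⊆q) , eq) = subst (_∋ Valid s) (sym eq)
          (∋-mono (Θ q) (valid-transfer (λ k → proj₁ (s⊆q (s k) (⌊⌋⁺ (k , refl))))
                                         (λ k → proj₂ (s⊆q (s k) (⌊⌋⁺ (k , refl)))))
                  (proj₁ (good-Θ q)))

    -- A face containing `q` is topped by it, and then `ν` is the marginal of `Θ q` by definition. A
    -- face missing `q` is the base face of `q`, where the marginal was prescribed.
    marginal-Θ : ∀ {s q i} → Topped (range s) q → InjectiveOff s i →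
                 Marginal (face s i) (ν (face s i)) (Θ q)
    marginal-Θ {s} {q} {i} (q∈ , s⊆q) inj with em {P = Holds (face s i q)}
    ... | yes q∈A = subst (λ μ → Marginal (face s i) μ (Θ q))
                      (sym (ν-topped (q∈A , λ u t → s⊆q u (face⊆range s i u t))))
                      (λ Y u → push⁻ u)
    ... | no q∉A = subst (λ A → Marginal A (ν A) (Θ q)) base≡face (proj₂ (good-Θ q) base-inj)
      where
      σ : Fin n → Fin n
      σ k = proj₁ (s⊆q (s k) (⌊⌋⁺ (k , refl)))
      tσ : ∀ k → tuple q (σ k) ≡ s k
      tσ k = proj₂ (s⊆q (s k) (⌊⌋⁺ (k , refl)))
      σ-inj : InjectiveOff σ i
      σ-inj {j} {k} j≢i k≢i e = inj j≢i k≢i (≡-trans (sym (tσ j)) (≡-trans (cong (tuple q) e) (tσ k)))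
      missing : ∀ k → k ≢ i → σ k ≢ place q
      missing k k≢i e = q∉A (⌊⌋⁺ (k , k≢i ,
        ≡-trans (sym (tσ k)) (≡-trans (cong (tuple q) e) (tuple-place q))))
      onto : ∀ l → l ≢ place q → ∃[ k ] (k ≢ i × σ k ≡ l)
      onto l l≢ with m , _ , hit ← missedPoint σ σ-inj with place q ≟ m
      ... | yes refl = hit l l≢
      ... | no ≢m with k , k≢i , e ← hit (place q) ≢m = ⊥-elim (missing k k≢i e)
      base≡face : baseFace q ≡ face s i
      base≡face = subset-ext
        (λ u t → let l , l≢ , e = ⌊⌋⁻ t ; k , k≢i , e′ = onto l l≢ in
           ⌊⌋⁺ (k , k≢i , ≡-trans (sym (tσ k)) (≡-trans (cong (tuple q) e′) e)))
        (λ u t → let k , k≢i , e = ⌊⌋⁻ t in ⌊⌋⁺ (σ k , missing k k≢i , ≡-trans (tσ k) e))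
      base-inj : InjectiveOff (tuple q) (place q)
      base-inj {j} {k} j≢ k≢ e
        with j′ , j′≢i , refl ← onto j j≢ | k′ , k′≢i , refl ← onto k k≢ =
        cong σ (inj j′≢i k′≢i (≡-trans (sym (tσ j′)) (≡-trans e (tσ k′))))

    marginal-Ω : ∀ s {i} → InjectiveOff s i → Marginal (face s i) (ν (face s i)) (Ω (range s))
    marginal-Ω s {i} inj with proj₂ (omegaChoice (range s))
    ... | inj₂ (¬top , f)    = proj₁ (f (free-exists s ¬top)) (face s i)
    ... | inj₁ (q , top , eq) = subst (Marginal (face s i) (ν (face s i))) (sym eq) (marginal-Θ top inj)

    Invariant : (S → Set ℓ) → Set ℓ
    Invariant X = ∀ a b → a ≋ b → X a → X b

    Realises : (S → Set ℓ) → (s : Tuple) → Labelling → Set ℓ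
    Realises X s κ = Σ[ valid ∈ Valid s κ ] X (atom s κ valid)

    -- The representation: a tuple lies in the image of `X` if its atom is in `X` for almost all
    -- labellings.
    ⟦_⟧ : (S → Set ℓ) → Tuple → Set
    ⟦ X ⟧ s = Ω (range s) ∋ Realises X s

    big⇒injectiveOff : ∀ s {κ valid i} → Atom.Big (atom s κ valid) i → InjectiveOff s i
    big⇒injectiveOff s big j≢i k≢i e = big j≢i k≢i (⌊⌋⁺ e)

    injectiveOff⇒big : ∀ s {κ valid i} → InjectiveOff s i → Atom.Big (atom s κ valid) i
    injectiveOff⇒big s inj j≢i k≢i t = inj j≢i k≢i (⌊⌋⁻ t)

    -- A tuple with a repetition has at most one big face, possibly seen from two indices, so its
    -- atom is fixed by one label. Ultrafilters with the same marginal there realise the same sets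
    -- at `t`, even if chosen for different ranges.
    module Repeated (t : Tuple) {j j′ : Fin n} (j≢j′ : j ≢ j′) (tj≡tj′ : t j ≡ t j′) where

      valid : ∀ κ → Valid t κ
      valid κ inj = ⊥-elim (j≢j′ (inj tj≡tj′))

      atom-cong : ∀ κ κ′ v v′ → (InjectiveOff t j → κ (face t j) ≡ κ′ (face t j)) →
                  atom t κ v ≋ atom t κ′ v′
      atom-cong κ κ′ v v′ eq = (λ _ _ → refl) , label≡
        where
        a = atom t κ v
        label≡ : ∀ l → Atom.Big a l → κ (face t l) ≡ κ′ (face t l)
        label≡ l big with l ≟ j | l ≟ j′
        ... | yes refl | _ = eq (big⇒injectiveOff t {κ} {v} big)
        ... | no _ | yes refl = subst (λ A → κ A ≡ κ′ A) (face-repeated {t} tj≡tj′)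
              (eq (big⇒injectiveOff t {κ} {v} (big-swap j≢j′ a (⌊⌋⁺ tj≡tj′) big)))
        ... | no l≢j | no l≢j′ =
              ⊥-elim (j≢j′ (big (λ e → l≢j (sym e)) (λ e → l≢j′ (sym e)) (⌊⌋⁺ tj≡tj′)))

      transfer : ∀ {X} → Invariant X → ∀ Ω₁ Ω₂ →
                 (InjectiveOff t j → Marginal (face t j) (ν (face t j)) Ω₁) →
                 (InjectiveOff t j → Marginal (face t j) (ν (face t j)) Ω₂) →
                 Ω₁ ∋ Realises X t → Ω₂ ∋ Realises X t
      transfer {X} inv Ω₁ Ω₂ m₁ m₂ u with em {P = InjectiveOff t j}
      ... | yes inj = ∋-mono Ω₂ back
            (marginal⁺ {P = Q} (m₂ inj) (marginal⁻ {P = Q} (m₁ inj) (∋-mono Ω₁ forth u)))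
        where
        Q : V → Set ℓ
        Q v = Realises X t (λ _ → v)
        forth : ∀ κ → Realises X t κ → Q (κ (face t j))
        forth κ (v , x) = valid κ′ , inv _ _ (atom-cong κ κ′ v (valid κ′) λ _ → refl) x
          where
          κ′ : Labelling
          κ′ _ = κ (face t j)
        back : ∀ κ → Q (κ (face t j)) → Realises X t κ
        back κ (v , x) = valid κ , inv _ _ (atom-cong (λ _ → κ (face t j)) κ v (valid κ) λ _ → refl) x
      ... | no ¬inj = let κ , v , x = ∋-witness Ω₁ u in
            ∋-all Ω₂ λ κ′ → valid κ′ , inv _ _ (atom-cong κ κ′ v (valid κ′) λ inj → ⊥-elim (¬inj inj)) x

    ⟦⟧-⊆ : ∀ X Y s → (∀ a → X a → Y a) → ⟦ X ⟧ s → ⟦ Y ⟧ s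
    ⟦⟧-⊆ X Y s X⊆Y = ∋-mono (Ω (range s)) λ κ (v , x) → v , X⊆Y _ x

    Cyl : Fin n → (S → Set ℓ) → S → Set ℓ
    Cyl i X a = ∃[ b ] (X b × a ≡[ i ] b)

    infix 4 _≡ᵗ[_]_
    _≡ᵗ[_]_ : Tuple → Fin n → Tuple → Set ℓ
    t ≡ᵗ[ i ] s = ∀ j → j ≢ i → t j ≡ s j

    atom-≡[] : ∀ s t i κ κ′ v v′ → t ≡ᵗ[ i ] s → (InjectiveOff s i → κ (face s i) ≡ κ′ (face t i)) →
               atom s κ v ≡[ i ] atom t κ′ v′
    atom-≡[] s t i κ κ′ v v′ t≡s label≡ =
      (λ {j} {k} j≢i k≢i → cong₂ (λ x y → ⌊ x ≡ y ⌋) (sym (t≡s j j≢i)) (sym (t≡s k k≢i))) ,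
      λ big → label≡ (big⇒injectiveOff s {κ} {v} big)

    -- For a valid labelling of `s`, that some relabelling puts `t` in `X` is a condition on the
    -- label of the face opposite to `i` only. The ultrafilters of `s` and `t` have the same
    -- marginal on that face.
    ⟦Cyl⟧⁺ : ∀ {X s t i} → t ≡ᵗ[ i ] s → ⟦ X ⟧ t → ⟦ Cyl i X ⟧ s
    ⟦Cyl⟧⁺ {X} {s} {t} {i} t≡s u with em {P = InjectiveOff t i}
    ... | yes inj = ∋-mono₂ (Ω (range s)) combine′ (valid-Ω s)
          (marginal⁺ {P = Q} (marginal-Ω s {i} inj-s) (subst (λ A → ν A ∋ Q) face≡
            (marginal⁻ {P = Q} (marginal-Ω t {i} inj) (∋-mono (Ω (range t)) (λ κ r → κ , refl , r) u))))
      where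
      Q : V → Set ℓ
      Q v = ∃[ κ ] (κ (face t i) ≡ v × Realises X t κ)
      face≡ : face t i ≡ face s i
      face≡ = face-cong {t} {s} t≡s
      inj-s : InjectiveOff s i
      inj-s {j} {k} j≢i k≢i e = inj j≢i k≢i (≡-trans (t≡s j j≢i) (≡-trans e (sym (t≡s k k≢i))))
      combine′ : ∀ κ → Valid s κ → Q (κ (face s i)) → Realises (Cyl i X) s κ
      combine′ κ v (κ′ , e , v′ , x) = v , atom t κ′ v′ , x ,
        atom-≡[] s t i κ κ′ v v′ t≡s (λ _ → sym e)
    ... | no ¬inj = let κ′ , v′ , x = ∋-witness (Ω (range t)) u in
          ∋-mono (Ω (range s)) (λ κ v → v , atom t κ′ v′ , x ,
            atom-≡[] s t i κ κ′ v v′ t≡s (λ inj → ⊥-elim (¬inj λ {j} {k} j≢i k≢i e →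
              inj j≢i k≢i (≡-trans (sym (t≡s j j≢i)) (≡-trans e (t≡s k k≢i)))))) (valid-Ω s)

    -- In an atom witnessing the cylindrification, point `i` either coincides with some other point
    -- `j`, and the entry `s j` can be reused, or differs from all others, and a new point is
    -- needed. The ultrafilter makes one case prevail.
    module CylBack {X : S → Set ℓ} (inv : Invariant X) (s : Tuple) (i : Fin n) where

      Old : Fin n → Labelling → Set ℓ
      Old j κ = Σ[ valid ∈ Valid s κ ] ∃[ b ]
        (X b × atom s κ valid ≡[ i ] b × j ≢ i × Holds (Atom.same b i j))

      New : Labelling → Set ℓ
      New κ = Σ[ valid ∈ Valid s κ ] ∃[ b ]
        (X b × atom s κ valid ≡[ i ] b × (∀ j → j ≢ i → ¬ Holds (Atom.same b i j)))

      split : ∀ κ → Realises (Cyl i X) s κ → (∃[ j ] Old j κ) ⊎ New κ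
      split κ (v , b , x , r) with em {P = ∃[ j ] (j ≢ i × Holds (Atom.same b i j))}
      ... | yes (j , j≢i , t) = inj₁ (j , v , b , x , r , j≢i , t)
      ... | no none           = inj₂ (v , b , x , r , λ j j≢i t → none (j , j≢i , t))

      old : ∀ j → Ω (range s) ∋ Old j → ⟦ X ⟧ (s [ i ≔ s j ])
      old j u = transfer inv (Ω (range s)) (Ω (range t))
        (λ inj → subst (λ A → Marginal A (ν A) (Ω (range s))) (sym face≡)
                   (marginal-Ω s λ {k} {l} k≢i l≢i e → inj k≢i l≢i
                     (≡-trans (t≡s k k≢i) (≡-trans e (sym (t≡s l l≢i))))))
        (λ inj → marginal-Ω t inj)
        (∋-mono (Ω (range s)) realise u)
        where
        t : Tuple
        t = s [ i ≔ s j ]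
        t≡s : t ≡ᵗ[ i ] s
        t≡s k k≢i = ≔-other s k≢i
        face≡ : face t i ≡ face s i
        face≡ = face-cong {t} {s} t≡s
        j≢i : j ≢ i
        j≢i = let _ , _ , _ , _ , _ , j≢i , _ = ∋-witness (Ω (range s)) u in j≢i
        i≢j : i ≢ j
        i≢j e = j≢i (sym e)
        ti≡tj : t i ≡ t j
        ti≡tj = ≡-trans (≔-same s i (s j)) (sym (t≡s j j≢i))
        open Repeated t i≢j ti≡tj
        realise : ∀ κ → Old j κ → Realises X t κ
        realise κ (v , b , x , r , _ , bij) = valid κ , inv b a b≈a x
          where
          a : S
          a = atom t κ (valid κ)
          b≈a : b ≋ a
          b≈a = ≡[]-diagonal i≢j b a
            (≡[]-trans {i} {b} {atom s κ v} {a} (≡[]-sym {i} {atom s κ v} {b} r)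
              (atom-≡[] s t i κ κ v (valid κ) t≡s λ _ → cong κ (sym face≡)))
            bij (⌊⌋⁺ ti≡tj)

      p : Point
      p = new s i (λ b → ⌊ X b ⌋)

      t : Tuple
      t = tuple p

      t≡s : t ≡ᵗ[ i ] s
      t≡s k k≢i = ≔-other s k≢i

      ti≡p : t i ≡ p
      ti≡p = tuple-place p

      p≢s : ∀ k → p ≢ s k
      p≢s k e = ℕₚ.<-irrefl (cong depth (sym e)) (depth-new s i (λ b → ⌊ X b ⌋) k)

      injectiveOff-s : InjectiveOff t i → InjectiveOff s i
      injectiveOff-s inj {j} {k} j≢i k≢i e =
        inj j≢i k≢i (≡-trans (t≡s j j≢i) (≡-trans e (sym (t≡s k k≢i))))

      module Witness (κ₀ : Labelling) (v₀ : Valid s κ₀) (b : S) (x : X b)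
        (r : atom s κ₀ v₀ ≡[ i ] b) (fresh : ∀ j → j ≢ i → ¬ Holds (Atom.same b i j)) where

        open Atom b

        fresh-t : ∀ k → k ≢ i → t i ≢ t k
        fresh-t k k≢i e = p≢s k (≡-trans (sym ti≡p) (≡-trans e (t≡s k k≢i)))

        same⁺ : ∀ {j k} → Dec (j ≡ i) → Dec (k ≡ i) → Holds (same j k) → t j ≡ t k
        same⁺ (yes refl) (yes refl) _ = refl
        same⁺ (yes refl) (no k≢i)   h = ⊥-elim (fresh _ k≢i h)
        same⁺ (no j≢i)   (yes refl) h = ⊥-elim (fresh _ j≢i (same-sym h))
        same⁺ (no j≢i)   (no k≢i)   h = ≡-trans (t≡s _ j≢i)
          (≡-trans (⌊⌋⁻ (subst Holds (sym (proj₁ r j≢i k≢i)) h)) (sym (t≡s _ k≢i)))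

        same⁻ : ∀ {j k} → Dec (j ≡ i) → Dec (k ≡ i) → t j ≡ t k → Holds (same j k)
        same⁻ (yes refl) (yes refl) _ = same-refl i
        same⁻ (yes refl) (no k≢i)   e = ⊥-elim (fresh-t _ k≢i e)
        same⁻ (no j≢i)   (yes refl) e = ⊥-elim (fresh-t _ j≢i (sym e))
        same⁻ (no j≢i)   (no k≢i)   e = subst Holds (proj₁ r j≢i k≢i)
          (⌊⌋⁺ (≡-trans (sym (t≡s _ j≢i)) (≡-trans e (t≡s _ k≢i))))

        same≡ : ∀ j k → same j k ≡ pattern-of t j k
        same≡ j k = Holds-ext (λ h → ⌊⌋⁺ (same⁺ (j ≟ i) (k ≟ i) h)) (λ h → same⁻ (j ≟ i) (k ≟ i) (⌊⌋⁻ h))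

        big : ∀ {l} → InjectiveOff t l → Big l
        big inj {j} {k} j≢l k≢l h = inj j≢l k≢l (same⁺ (j ≟ i) (k ≟ i) h)

        face-≡⇒≡ : ∀ {l l′} → InjectiveOff t l → face t l′ ≡ face t l → Dec (l ≡ l′) → t l ≡ t l′
        face-≡⇒≡ inj eq (yes refl) = refl
        face-≡⇒≡ {l} {l′} inj eq (no l≢l′) = repeated (⌊⌋⁻ (subst (λ A → Holds (A (t l′))) (sym eq)
                                               (face-∈ t (λ e → l≢l′ (sym e)))))
          where
          repeated : ∃[ k ] (k ≢ l′ × t k ≡ t l′) → t l ≡ t l′
          repeated (k , k≢l′ , e) with k ≟ l
          ... | yes refl = e
          ... | no k≢l   = ⊥-elim (k≢l′ (inj k≢l (λ e → l≢l′ (sym e)) e))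

        -- Labels are copied from `b`. A face may arise from two indices; these then carry the same
        -- point, and `label-cong` makes the labels agree.
        κ-choice : ∀ A → Σ[ v ∈ V ] (∀ l → InjectiveOff t l → A ≡ face t l → v ≡ label l)
        κ-choice A with em {P = ∃[ l ] face t l ≡ A}
        ... | no none       = label i , λ l _ eq → ⊥-elim (none (l , sym eq))
        ... | yes (l′ , eq) = label l′ , λ l inj eq′ →
              sym (label-cong (big inj)
                (same⁻ (l ≟ i) (l′ ≟ i) (face-≡⇒≡ inj (≡-trans eq eq′) (l ≟ l′))))

        κ : Labelling
        κ A = proj₁ (κ-choice A)

        κ-face : ∀ l → InjectiveOff t l → κ (face t l) ≡ label l
        κ-face l inj = proj₂ (κ-choice (face t l)) l inj refl

        valid : Valid t κ
        valid inj =
          let j , k , j~k = adjacent (λ {j} {k} h → inj (same⁺ (j ≟ i) (k ≟ i) h)) in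
          j , k , subst₂ _~_ (sym (κ-face j λ _ _ → inj)) (sym (κ-face k λ _ _ → inj)) j~k

        b≋atom : b ≋ atom t κ valid
        b≋atom = same≡ , λ l big-l → sym (κ-face l λ {j} {k} j≢l k≢l e →
          big-l j≢l k≢l (same⁻ (j ≟ i) (k ≟ i) e))

        witnesses : Witnesses p κ
        witnesses = valid , ⌊⌋⁺ (inv b (atom t κ valid) b≋atom x)

        κ-base : InjectiveOff t i → κ (face t i) ≡ κ₀ (face s i)
        κ-base inj = ≡-trans (κ-face i inj)
          (sym (proj₂ r (injectiveOff⇒big s {κ₀} {v₀} (injectiveOff-s inj))))

      -- The prescribed marginal is respected by starting from a labelling `κ₀` of `s` that has its
      -- base label in `Y`; the new labelling keeps that label.
      new-exists : Ω (range s) ∋ New → ∀ (Y : V → Bool) → ν (face s i) ∋ (λ v → Holds (Y v)) →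
                   ∃[ κ ] (Witnesses p κ × (InjectiveOff t i → Holds (Y (κ (face t i)))))
      new-exists u Y y with em {P = InjectiveOff s i}
      ... | no ¬inj =
        let κ₀ , v , b , x , r , fresh = ∋-witness (Ω (range s)) u
            open Witness κ₀ v b x r fresh
        in κ , witnesses , λ inj → ⊥-elim (¬inj λ {j} {k} → injectiveOff-s inj {j} {k})
      ... | yes inj =
        let κ₀ , (v , b , x , r , fresh) , y₀ =
              ∋-witness (Ω (range s)) (∋-∩ (Ω (range s)) u (marginal-Ω s {i} inj Y y))
            open Witness κ₀ v b x r fresh
        in κ , witnesses , λ inj′ → subst (λ v → Holds (Y v)) (sym (κ-base inj′)) y₀

      range-topped : Topped (range t) p
      range-topped = ⌊⌋⁺ (i , ti≡p) , λ u h → ⌊⌋⁻ h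

      -- `p` tops the range of `t`, so the ultrafilter of `t` is the one chosen at `p`. By
      -- `new-exists` a witnessing choice was possible there, hence was made.
      new-realised : Ω (range s) ∋ New → ⟦ X ⟧ t
      new-realised u = subst (_∋ Realises X t) (sym (≡-trans (Ω-topped range-topped) (Θ-new s i _)))
        (∋-mono (faceExtension p (ν (face s i))) (λ κ (v , h) → v , ⌊⌋⁻ h)
          (proj₂ (proj₂ (extensionChoice p (ν (face s i)))) good))
        where
        good : Σ[ Ω ∈ Ultrafilter Labelling ] (Good p (ν (face s i)) Ω × Ω ∋ Witnesses p)
        good = let Ω , w , m = OneFace.extendMarginal (baseFace p) (ν (face s i)) (Witnesses p)
                                 (InjectiveOff t i) (new-exists u)
               in Ω , (∋-mono Ω (λ κ → proj₁) w , m) , w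

    ⟦Cyl⟧⁻ : ∀ {X} → Invariant X → ∀ s i → ⟦ Cyl i X ⟧ s → ∃[ t ] (⟦ X ⟧ t × t ≡ᵗ[ i ] s)
    ⟦Cyl⟧⁻ {X} inv s i u with ∋-⊎ (Ω (range s)) (∋-mono (Ω (range s)) (CylBack.split inv s i) u)
    ... | inj₂ w = CylBack.t inv s i , CylBack.new-realised inv s i w , CylBack.t≡s inv s i
    ... | inj₁ w with j , w′ ← ∋-∃Fin (Ω (range s)) w =
          s [ i ≔ s j ] , CylBack.old inv s i j w′ , λ k k≢i → ≔-other s k≢i

    Subst : (Fin n → Fin n) → (S → Set ℓ) → S → Set ℓ
    Subst τ X a = ∃[ b ] (X b × a ∘[ τ ] b)

    module Composition (s : Tuple) (τ : Fin n → Fin n) where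

      private
        t : Tuple
        t = s ∘ τ

      faceImage : ∀ {j} → InjectiveOff t j →
                  ∃[ m ] ((∀ k → k ≢ j → τ k ≢ m) × (∀ l → l ≢ m → ∃[ k ] (k ≢ j × τ k ≡ l)))
      faceImage inj = missedPoint τ λ j≢ k≢ e → inj j≢ k≢ (cong s e)

      face-image : ∀ {j m} → (∀ k → k ≢ j → τ k ≢ m) → (∀ l → l ≢ m → ∃[ k ] (k ≢ j × τ k ≡ l)) →
                   face s m ≡ face t j
      face-image missed onto = subset-ext
        (λ u h → let l , l≢m , e = ⌊⌋⁻ h ; k , k≢j , e′ = onto l l≢m in
           ⌊⌋⁺ (k , k≢j , ≡-trans (cong s e′) e))
        (λ u h → let k , k≢j , e = ⌊⌋⁻ h in ⌊⌋⁺ (τ k , missed k k≢j , e))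

      injectiveOff-image : ∀ {j m} → InjectiveOff t j → (∀ l → l ≢ m → ∃[ k ] (k ≢ j × τ k ≡ l)) →
                           InjectiveOff s m
      injectiveOff-image inj onto {l} {l′} l≢m l′≢m e =
        let k , k≢j , ek = onto l l≢m ; k′ , k′≢j , ek′ = onto l′ l′≢m in
        ≡-trans (sym ek) (≡-trans (cong τ (inj k≢j k′≢j
          (≡-trans (cong s ek) (≡-trans e (cong s (sym ek′)))))) ek′)

      range-injective : Injective t → range t ≡ range s
      range-injective inj = subset-ext
        (λ u h → let k , e = ⌊⌋⁻ h in ⌊⌋⁺ (τ k , e))
        (λ u h → let l , e = ⌊⌋⁻ h ; k , e′ = injective⇒surjective τ (λ e → inj (cong s e)) l in
           ⌊⌋⁺ (k , ≡-trans (cong s e′) e))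

      repetition : ¬ Injective t → ∃[ j ] ∃[ k ] (j ≢ k × t j ≡ t k)
      repetition ¬inj = ¬¬-elim λ none → ¬inj λ {j} {k} e →
        ¬¬-elim λ j≢k → none (j , k , j≢k , e)

      valid-composition : Ω (range s) ∋ Valid t
      valid-composition with em {P = Injective t}
      ... | no ¬inj = ∋-all (Ω (range s)) λ κ inj → ⊥-elim (¬inj inj)
      ... | yes inj = subst (λ A → Ω A ∋ Valid t) (range-injective inj) (valid-Ω t)

      marginal-composition : ∀ {j} → InjectiveOff t j → Marginal (face t j) (ν (face t j)) (Ω (range s))
      marginal-composition inj = let m , missed , onto = faceImage inj in
        subst (λ A → Marginal A (ν A) (Ω (range s))) (face-image missed onto)
          (marginal-Ω s {m} (injectiveOff-image inj onto))

      -- If `t` is injective, `τ` is a permutation and both ranges are equal. Otherwise the ranges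
      -- may differ, but `t` has a repetition and only one marginal matters.
      realises⇔ : ∀ {X} → Invariant X →
                  (Ω (range s) ∋ Realises X t → ⟦ X ⟧ t) × (⟦ X ⟧ t → Ω (range s) ∋ Realises X t)
      realises⇔ {X} inv with em {P = Injective t}
      ... | yes inj = subst (λ A → Ω A ∋ Realises X t) (sym (range-injective inj)) ,
                      subst (λ A → Ω A ∋ Realises X t) (range-injective inj)
      ... | no ¬inj = let j , k , j≢k , e = repetition ¬inj in
            Repeated.transfer t j≢k e inv (Ω (range s)) (Ω (range t))
              marginal-composition (marginal-Ω t) ,
            Repeated.transfer t j≢k e inv (Ω (range t)) (Ω (range s))
              (marginal-Ω t) marginal-composition

      atom-∘ : ∀ κ v v′ → atom s κ v ∘[ τ ] atom t κ v′
      atom-∘ κ v v′ = (λ _ _ → refl) , λ j m big _ missed →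
        let m₀ , missed₀ , onto = faceImage (big⇒injectiveOff t {κ} {v′} big) in
        cong κ (≡-trans (sym (face-image missed₀ onto)) (cong (face s) (¬¬-elim λ m₀≢m →
          let k , k≢j , e = onto m (λ e → m₀≢m (sym e)) in missed k k≢j e)))

      ∘-atom : ∀ κ v v′ b → atom s κ v ∘[ τ ] b → b ≋ atom t κ v′
      ∘-atom κ v v′ b (r , l) = r , λ j big →
        let inj : InjectiveOff t j
            inj = λ {i} {k} i≢ k≢ e → big i≢ k≢ (subst Holds (sym (r i k)) (⌊⌋⁺ e))
            m , missed , onto = faceImage inj
        in ≡-trans (l j m big (injectiveOff⇒big s {κ} {v} (injectiveOff-image inj onto)) missed)
                   (cong κ (face-image missed onto))

      ⟦Subst⟧⁺ : ∀ {X} → Invariant X → ⟦ X ⟧ t → ⟦ Subst τ X ⟧ s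
      ⟦Subst⟧⁺ {X} inv u = ∋-mono₂ (Ω (range s)) compose (valid-Ω s) (proj₂ (realises⇔ inv) u)
        where
        compose : ∀ κ → Valid s κ → Realises X t κ → Realises (Subst τ X) s κ
        compose κ v (v′ , x) = v , atom t κ v′ , x , atom-∘ κ v v′

      ⟦Subst⟧⁻ : ∀ {X} → Invariant X → ⟦ Subst τ X ⟧ s → ⟦ X ⟧ t
      ⟦Subst⟧⁻ {X} inv u = proj₁ (realises⇔ inv) (∋-mono₂ (Ω (range s)) decompose valid-composition u)
        where
        decompose : ∀ κ → Valid t κ → Realises (Subst τ X) s κ → Realises X t κ
        decompose κ v′ (v , b , x , r) = v′ , inv b (atom t κ v′) (∘-atom κ v v′ b r) x

    Diagonal : Fin n → Fin n → S → Set ℓ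
    Diagonal i j a = Lift ℓ (Holds (Atom.same a i j))

    ⟦Diagonal⟧⁺ : ∀ s {i j} → s i ≡ s j → ⟦ Diagonal i j ⟧ s
    ⟦Diagonal⟧⁺ s e = ∋-mono (Ω (range s)) (λ κ v → v , lift (⌊⌋⁺ e)) (valid-Ω s)

    ⟦Diagonal⟧⁻ : ∀ s {i j} → ⟦ Diagonal i j ⟧ s → s i ≡ s j
    ⟦Diagonal⟧⁻ s u = let _ , _ , h = ∋-witness (Ω (range s)) u in ⌊⌋⁻ (lower h)

    ⟦∪⟧⁻ : ∀ X Y s → ⟦ (λ a → X a ⊎ Y a) ⟧ s → ⟦ X ⟧ s ⊎ ⟦ Y ⟧ s
    ⟦∪⟧⁻ X Y s u = ∋-⊎ (Ω (range s)) (∋-mono (Ω (range s))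
      (λ { κ (v , inj₁ x) → inj₁ (v , x) ; κ (v , inj₂ y) → inj₂ (v , y) }) u)

    ⟦∩⟧⁺ : ∀ X Y s → Invariant X → ⟦ X ⟧ s → ⟦ Y ⟧ s → ⟦ (λ a → X a × Y a) ⟧ s
    ⟦∩⟧⁺ X Y s inv = ∋-mono₂ (Ω (range s)) λ κ (v , x) (v′ , y) →
      v′ , inv (atom s κ v) (atom s κ v′) ((λ _ _ → refl) , λ _ _ → refl) x , y

    ⟦∁⟧⁻ : ∀ X s → Invariant X → ⟦ (λ a → ¬ X a) ⟧ s → ¬ ⟦ X ⟧ s
    ⟦∁⟧⁻ X s inv u u′ = let _ , (v , ¬x) , (v′ , x) = ∋-witness (Ω (range s)) (∋-∩ (Ω (range s)) u u′) in
      ¬x (inv (atom s _ v′) (atom s _ v) ((λ _ _ → refl) , λ _ _ → refl) x)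

    ⟦∁⟧⁺ : ∀ X s → ¬ ⟦ X ⟧ s → ⟦ (λ a → ¬ X a) ⟧ s
    ⟦∁⟧⁺ X s ¬u = ∋-mono₂ (Ω (range s)) (λ κ v ¬r → v , λ x → ¬r (v , x))
      (valid-Ω s) (∋-∁⁺ (Ω (range s)) ¬u)

    ⟦𝟙⟧ : ∀ {X : S → Set ℓ} s → (∀ a → X a) → ⟦ X ⟧ s
    ⟦𝟙⟧ s x = ∋-mono (Ω (range s)) (λ κ v → v , x _) (valid-Ω s)

    ⟦⟧-inhabited : ∀ X s → ⟦ X ⟧ s → ∃ X
    ⟦⟧-inhabited X s u = let _ , _ , x = ∋-witness (Ω (range s)) u in _ , x

    -- Moving the points of an atom onto its first point one after the other, by
    -- cylindrifications, leads to the atom of a constant tuple.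
    realised : ∀ {X} → Invariant X → ∀ a → X a → ∃[ s ] ⟦ X ⟧ s
    realised inv a x = below n ℕₚ.≤-refl inv a (λ i n≤i → ⊥-elim (ℕₚ.<⇒≱ (Finₚ.toℕ<n i) n≤i)) x
      where
      below : ∀ m → m ≤ n → ∀ {X} → Invariant X → ∀ a →
              (∀ i → m ≤ toℕ i → Holds (Atom.same a i 0ᵢ)) → X a → ∃[ s ] ⟦ X ⟧ s
      below zero _ {X} inv a collapsed x =
        r , ∋-all (Ω (range r)) λ κ → valid κ , inv a (atom r κ (valid κ)) (a≋ κ) x
        where
        r : Tuple
        r _ = root
        valid : ∀ κ → Valid r κ
        valid κ inj = ⊥-elim (root-not-injectiveOff 0ᵢ λ _ _ → inj)
        a≋ : ∀ κ → a ≋ atom r κ (valid κ)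
        a≋ κ = (λ i j → Holds-ext (λ _ → ⌊⌋⁺ refl) λ _ → Atom.same-trans a (collapsed i z≤n)
                 (Atom.same-sym a (collapsed j z≤n))) ,
               λ i big → ⊥-elim (root-not-injectiveOff i λ {j} {k} j≢i k≢i _ → big j≢i k≢i
                 (Atom.same-trans a (collapsed j z≤n) (Atom.same-sym a (collapsed k z≤n))))
      below (suc m) m<n {X} inv a collapsed-a x with fromℕ< m<n ≟ 0ᵢ
      ... | yes i≡0 = below m (ℕₚ.<⇒≤ m<n) inv a (λ k m≤k → case k (ℕₚ.m≤n⇒m<n∨m≡n m≤k)) x
        where
        case : ∀ k → (m < toℕ k ⊎ m ≡ toℕ k) → Holds (Atom.same a k 0ᵢ)
        case k (inj₁ m<k) = collapsed-a k m<k
        case k (inj₂ m≡k) = subst (λ k → Holds (Atom.same a k 0ᵢ))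
          (≡-trans (sym i≡0) (Finₚ.toℕ-injective (≡-trans (Finₚ.toℕ-fromℕ< m<n) m≡k)))
          (Atom.same-refl a 0ᵢ)
      ... | no i≢0 =
        let a′ = collapsed i≢0 a
            s , u = below m (ℕₚ.<⇒≤ m<n) cyl-inv a′ (λ k m≤k → case k (ℕₚ.m≤n⇒m<n∨m≡n m≤k))
                      (a , x , ≡[]-sym {a = a} {a′} (collapsed-≡[] i≢0 a))
            t , u′ , _ = ⟦Cyl⟧⁻ inv s i u
        in t , u′
        where
        i : Fin n
        i = fromℕ< m<n
        cyl-inv : Invariant (Cyl i X)
        cyl-inv a b a≋b (c , x , r) = c , x , ≡[]-respˡ {i} {c} {a} {b} a≋b r
        case : ∀ k → (m < toℕ k ⊎ m ≡ toℕ k) → Holds (Atom.same (collapsed i≢0 a) k 0ᵢ)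
        case k (inj₂ m≡k) = subst (λ k → Holds (Atom.same (collapsed i≢0 a) k 0ᵢ))
          (Finₚ.toℕ-injective (≡-trans (Finₚ.toℕ-fromℕ< m<n) m≡k)) (collapsed-ij i≢0 a)
        case k (inj₁ m<k) = subst₂ (λ k l → Holds (Atom.same a k l))
          (sym (collapse-other i≢0 k≢i)) (sym (collapse-other i≢0 λ e → i≢0 (sym e)))
          (collapsed-a k m<k)
          where
          k≢i : k ≢ i
          k≢i e = ℕₚ.<-irrefl (sym (≡-trans (cong toℕ e) (Finₚ.toℕ-fromℕ< m<n))) m<k

  -- Order, atoms and complete additivity.

  module AlgebraOrder {n σ c e} (𝔄 : Algebra n σ c e) where
    open import Algebra.Lattice.Bundles using (BooleanAlgebra)
    import Algebra.Lattice.Properties.BooleanAlgebra as BooleanAlgebraₚ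
    import Relation.Binary.Reasoning.Setoid as SetoidReasoning

    open Algebra 𝔄
    private
      booleanAlgebra : BooleanAlgebra c e
      booleanAlgebra = record { isBooleanAlgebra = isBooleanAlgebra }
      module B = BooleanAlgebra booleanAlgebra
      module P = BooleanAlgebraₚ booleanAlgebra
    open SetoidReasoning B.setoid

    ≤-resp : ∀ {x x′ y} → x ≈ x′ → x ≤ y → x′ ≤ y
    ≤-resp x≈x′ x≤y = B.trans (B.∧-congʳ (B.sym x≈x′)) (B.trans x≤y x≈x′)

    ≤-refl : ∀ {x} → x ≤ x
    ≤-refl = P.∧-idem _

    ≤-reflexive : ∀ {x y} → x ≈ y → x ≤ y
    ≤-reflexive x≈y = ≤-resp (B.sym x≈y) ≤-refl

    ≤-trans : ∀ {x y z} → x ≤ y → y ≤ z → x ≤ z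
    ≤-trans {x} {y} {z} x≤y y≤z = begin
      x ∧ z       ≈⟨ B.∧-congʳ x≤y ⟨
      (x ∧ y) ∧ z ≈⟨ B.∧-assoc x y z ⟩
      x ∧ (y ∧ z) ≈⟨ B.∧-congˡ y≤z ⟩
      x ∧ y       ≈⟨ x≤y ⟩
      x           ∎

    ≤-antisym : ∀ {x y} → x ≤ y → y ≤ x → x ≈ y
    ≤-antisym x≤y y≤x = B.trans (B.sym x≤y) (B.trans (B.∧-comm _ _) y≤x)

    ∧-greatest : ∀ {x y z} → z ≤ x → z ≤ y → z ≤ x ∧ y
    ∧-greatest {x} {y} {z} z≤x z≤y = B.trans (B.sym (B.∧-assoc z x y)) (B.trans (B.∧-congʳ z≤x) z≤y)

    ∧-lowerʳ : ∀ {x y} → x ∧ y ≤ y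
    ∧-lowerʳ {x} {y} = B.trans (B.∧-assoc x y y) (B.∧-congˡ (P.∧-idem y))

    ∧-lowerˡ : ∀ {x y} → x ∧ y ≤ x
    ∧-lowerˡ {x} {y} = B.trans (B.∧-congʳ (B.∧-comm x y)) (B.trans ∧-lowerʳ (B.∧-comm y x))

    ∨-upperˡ : ∀ {x y} → x ≤ x ∨ y
    ∨-upperˡ {x} {y} = B.∧-absorbs-∨ x y

    ∨-upperʳ : ∀ {x y} → y ≤ x ∨ y
    ∨-upperʳ {x} {y} = B.trans (B.∧-congˡ (B.∨-comm x y)) (B.∧-absorbs-∨ y x)

    ≤𝟙 : ∀ {x} → x ≤ 𝟙
    ≤𝟙 = P.∧-identityʳ _

    𝟘≤ : ∀ {x} → 𝟘 ≤ x
    𝟘≤ = P.∧-zeroˡ _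

    disjoint⇒≤∁ : ∀ {x y} → x ∧ y ≈ 𝟘 → y ≤ ∁ x
    disjoint⇒≤∁ {x} {y} x∧y≈𝟘 = begin
      y ∧ ∁ x             ≈⟨ P.∨-identityˡ _ ⟨
      𝟘 ∨ (y ∧ ∁ x)       ≈⟨ B.∨-congʳ (B.trans (B.∧-comm y x) x∧y≈𝟘) ⟨
      (y ∧ x) ∨ (y ∧ ∁ x) ≈⟨ B.∧-distribˡ-∨ y x (∁ x) ⟨
      y ∧ (x ∨ ∁ x)       ≈⟨ B.∧-congˡ (B.∨-complementʳ x) ⟩
      y ∧ 𝟙               ≈⟨ P.∧-identityʳ y ⟩
      y                   ∎

    ≤∁⇒≈𝟘 : ∀ {x y} → x ≤ y → x ≤ ∁ y → x ≈ 𝟘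
    ≤∁⇒≈𝟘 {x} {y} x≤y x≤∁y = begin
      x           ≈⟨ ∧-greatest x≤y x≤∁y ⟨
      x ∧ (y ∧ ∁ y) ≈⟨ B.∧-congˡ (B.∧-complementʳ y) ⟩
      x ∧ 𝟘       ≈⟨ P.∧-zeroʳ x ⟩
      𝟘           ∎

    ≤⁻ : ∀ {x y} → x ∧ ∁ y ≈ 𝟘 → x ≤ y
    ≤⁻ {x} {y} e = begin
      x ∧ y               ≈⟨ P.∨-identityʳ _ ⟨
      (x ∧ y) ∨ 𝟘         ≈⟨ B.∨-congˡ e ⟨
      (x ∧ y) ∨ (x ∧ ∁ y) ≈⟨ B.∧-distribˡ-∨ x y (∁ y) ⟨
      x ∧ (y ∨ ∁ y)       ≈⟨ B.∧-congˡ (B.∨-complementʳ y) ⟩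
      x ∧ 𝟙               ≈⟨ P.∧-identityʳ x ⟩
      x                   ∎

    atom-disjoint : ∀ {a y} → IsAtom a → ¬ (a ≤ y) → a ∧ y ≈ 𝟘
    atom-disjoint (_ , minimal) a≰y with minimal _ ∧-lowerˡ
    ... | inj₁ e = e
    ... | inj₂ e = ⊥-elim (a≰y e)

    atom-∁⁺ : ∀ {a y} → IsAtom a → ¬ (a ≤ y) → a ≤ ∁ y
    atom-∁⁺ {a} {y} isAtom a≰y = disjoint⇒≤∁ (B.trans (B.∧-comm y a) (atom-disjoint isAtom a≰y))

    atom-∁⁻ : ∀ {a y} → IsAtom a → a ≤ ∁ y → ¬ (a ≤ y)
    atom-∁⁻ (a≉𝟘 , _) a≤∁y a≤y = a≉𝟘 (≤∁⇒≈𝟘 a≤y a≤∁y)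

    atom-∨ : ∀ {a x y} → IsAtom a → a ≤ x ∨ y → a ≤ x ⊎ a ≤ y
    atom-∨ {a} {x} {y} isAtom a≤x∨y with em {P = a ≤ x}
    ... | yes a≤x = inj₁ a≤x
    ... | no a≰x  = inj₂ (begin
      a ∧ y             ≈⟨ P.∨-identityˡ _ ⟨
      𝟘 ∨ (a ∧ y)       ≈⟨ B.∨-congʳ (atom-disjoint isAtom a≰x) ⟨
      (a ∧ x) ∨ (a ∧ y) ≈⟨ B.∧-distribˡ-∨ a x y ⟨
      a ∧ (x ∨ y)       ≈⟨ a≤x∨y ⟩
      a                 ∎)

    -- Additivity for the two-element family of `x` and `y`, whose supremum is `y`.
    op-mono : ∀ Ω {x y} → x ≤ y → op Ω x ≤ op Ω y
    op-mono Ω {x} {y} x≤y = proj₁ (completelyAdditive Ω pair y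
      ((λ { (lift true) → ≤-refl ; (lift false) → x≤y }) , λ z bound → bound (lift true))) (lift false)
      where
      pair : Lift (c ⊔ e) Bool → Carrier
      pair (lift true)  = y
      pair (lift false) = x

    module _ (atomic : Atomic) where

      below-atoms : ∀ {x y} → (∀ a → IsAtom a → a ≤ x → a ≤ y) → x ≤ y
      below-atoms {x} {y} f = ≤⁻ (¬¬-elim λ x∧∁y≉𝟘 →
        let a , isAtom , a≤ = atomic _ x∧∁y≉𝟘 in
        atom-∁⁻ isAtom (≤-trans a≤ ∧-lowerʳ) (f a isAtom (≤-trans a≤ ∧-lowerˡ)))

      atoms-below : ∀ x → IsSupremum {K = Σ[ a ∈ Carrier ] (IsAtom a × a ≤ x)} proj₁ x
      atoms-below x = (λ (_ , _ , a≤x) → a≤x) ,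
                      λ z bound → below-atoms λ a isAtom a≤x → bound (a , isAtom , a≤x)

      -- `x` is the supremum of the atoms below it. If none of their images were above `a`, all
      -- would lie below `∁ a`, and so would `op Ω x` by complete additivity.
      atom-op : ∀ Ω {a x} → IsAtom a → a ≤ op Ω x → ∃[ b ] (IsAtom b × b ≤ x × a ≤ op Ω b)
      atom-op Ω {a} {x} isAtom a≤ = ¬¬-elim λ none → atom-∁⁻ isAtom
        (≤-trans a≤ (proj₂ (completelyAdditive Ω proj₁ x (atoms-below x)) (∁ a) λ (b , isAtom-b , b≤x) →
          disjoint⇒≤∁ (atom-disjoint isAtom λ a≤b → none (b , isAtom-b , b≤x , a≤b)))) ≤-refl

  -- Representability of every atomic algebra on the atom structure.

  module Embedding {ℓ} {n N : ℕ} (2<n : 2 < n) (N-large : n * 2 ^ n < N)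
    {V : Set ℓ} (_~_ : V → V → Set) (~-sym : ∀ {v w} → v ~ w → w ~ v)
    (copy : V → Fin N) (cross : ∀ {v w} → copy v ≢ copy w → v ~ w)
    (uncolourable : ∀ c {C} (f : V → Fin C) →
                    ¬ (∀ v w → copy v ≡ c → copy w ≡ c → v ~ w → f v ≢ f w))
    where
    open import Data.Fin.Permutation.Components using (transpose)

    open LabelledAtoms n V _~_
    open Representation 2<n N-large _~_ ~-sym copy cross uncolourable

    module Embed {σ} (𝔄 : Algebra n σ (Level.suc ℓ) ℓ) (atomic : Algebra.Atomic 𝔄)
      (iso : At 𝔄 ≅ₛ atomStructure σ) where

      open Algebra 𝔄
      open AlgebraOrder 𝔄
      private
        module 𝕊 = AtomStructure (atomStructure σ)
        module I = _≅ₛ_ iso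

      r : Level
      r = Level.suc ℓ

      𝒜 : Set r
      𝒜 = Σ Carrier IsAtom

      preimage : S → 𝒜
      preimage a = proj₁ (I.surjective a)

      to-preimage : ∀ a → I.to (preimage a) ≋ a
      to-preimage a = proj₂ (I.surjective a) {preimage a} ≈-refl

      preimage-≋ : ∀ a → a ≋ I.to (preimage a)
      preimage-≋ a = ≋-sym {I.to (preimage a)} {a} (to-preimage a)

      element : S → Carrier
      element a = proj₁ (preimage a)

      isAtom : ∀ a → IsAtom (element a)
      isAtom a = proj₂ (preimage a)

      element-cong : ∀ {a b} → a ≋ b → element a ≈ element b
      element-cong {a} {b} a≋b = I.injective {preimage a} {preimage b}
        (≋-trans {I.to (preimage a)} {a} {I.to (preimage b)} (to-preimage a)
          (≋-trans {a} {b} {I.to (preimage b)} a≋b (preimage-≋ b)))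

      element-to : (α : 𝒜) → element (I.to α) ≈ proj₁ α
      element-to α = I.injective {preimage (I.to α)} {α} (to-preimage (I.to α))

      -- The embedding of an atomic algebra into the complex algebra of its atom structure; composed
      -- with `⟦_⟧` it gives the representation.
      Below : Carrier → S → Set ℓ
      Below x a = element a ≤ x

      below-inv : ∀ x → Invariant (Below x)
      below-inv x a b a≋b = ≤-resp (element-cong {a} {b} a≋b)

      ≤-below : ∀ {x y} → (∀ a → Below x a → Below y a) → x ≤ y
      ≤-below f = below-atoms atomic λ α atom-α α≤x →
        let β = α , atom-α in
        ≤-resp (element-to β) (f (I.to β) (≤-resp (≈-sym (element-to β)) α≤x))

      R⁺ : ∀ Ω a b → element a ≤ op Ω (element b) → 𝕊.R Ω a b
      R⁺ Ω a b le = proj₂ (𝕊.R-respects Ω) {b} {I.to (preimage a)} {a} (to-preimage a)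
        (proj₁ (𝕊.R-respects Ω) {I.to (preimage a)} {I.to (preimage b)} {b} (to-preimage b)
          (to (I.R-iso Ω (preimage a) (preimage b)) le))

      R⁻ : ∀ Ω a b → 𝕊.R Ω a b → element a ≤ op Ω (element b)
      R⁻ Ω a b aRb = from (I.R-iso Ω (preimage a) (preimage b))
        (proj₂ (𝕊.R-respects Ω) {I.to (preimage b)} {a} {I.to (preimage a)} (preimage-≋ a)
          (proj₁ (𝕊.R-respects Ω) {a} {b} {I.to (preimage b)} (preimage-≋ b) aRb))

      Image : Operator n σ → (S → Set ℓ) → S → Set ℓ
      Image Ω X a = ∃[ b ] (X b × 𝕊.R Ω a b)

      below-op⁺ : ∀ Ω x a → Below (op Ω x) a → Image Ω (Below x) a
      below-op⁺ Ω x a le =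
        let β , atom-β , β≤x , a≤ = atom-op atomic Ω (isAtom a) le
            b = I.to (β , atom-β)
            eq = element-to (β , atom-β)
        in b , ≤-resp (≈-sym eq) β≤x ,
           R⁺ Ω a b (≤-trans a≤ (op-mono Ω (≤-resp eq ≤-refl)))

      below-op⁻ : ∀ Ω x a → Image Ω (Below x) a → Below (op Ω x) a
      below-op⁻ Ω x a (b , b≤x , aRb) = ≤-trans (R⁻ Ω a b aRb) (op-mono Ω b≤x)

      -- One square base, admissible for every signature including `Df`.
      base : ⊤ → Base n σ r
      base _ = square (Lift r Point)

      toTuple : Unit (base tt) → Tuple
      toTuple s i = lower (s i)

      f : Carrier → Pred (Unit (base tt)) r
      f x s = Lift r (⟦ Below x ⟧ (toTuple s))

      ⟦op⟧⁺ : ∀ Ω x s → ⟦ Image Ω (Below x) ⟧ (toTuple s) → setOp (base tt) Ω (f x) s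
      ⟦op⟧⁺ (cyl i) x s u = let t , u′ , t≡s = ⟦Cyl⟧⁻ (below-inv x) (toTuple s) i u in
        (λ j → lift (t j)) , lift u′ , λ j j≢i → cong lift (t≡s j j≢i)
      ⟦op⟧⁺ (repl _ i j) x s u = lift (Composition.⟦Subst⟧⁻ (toTuple s) _ (below-inv x) u)
      ⟦op⟧⁺ (trans _ i j) x s u = lift (Composition.⟦Subst⟧⁻ (toTuple s) _ (below-inv x) u)

      ⟦op⟧⁻ : ∀ Ω x s → setOp (base tt) Ω (f x) s → ⟦ Image Ω (Below x) ⟧ (toTuple s)
      ⟦op⟧⁻ (cyl i) x s (t , lift u , t≡s) = ⟦Cyl⟧⁺ (λ j j≢i → cong lower (t≡s j j≢i)) u
      ⟦op⟧⁻ (repl _ i j) x s (lift u) = Composition.⟦Subst⟧⁺ (toTuple s) _ (below-inv x) u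
      ⟦op⟧⁻ (trans _ i j) x s (lift u) = Composition.⟦Subst⟧⁺ (toTuple s) _ (below-inv x) u

      D⁺ : ∀ d a → Below (const d) a → 𝕊.D d a
      D⁺ d a le = 𝕊.D-respects d {I.to (preimage a)} {a} (to-preimage a) (to (I.D-iso d (preimage a)) le)

      D⁻ : ∀ d a → 𝕊.D d a → Below (const d) a
      D⁻ d a h = from (I.D-iso d (preimage a))
        (𝕊.D-respects d {a} {I.to (preimage a)} (preimage-≋ a) h)

      f-const⁺ : ∀ d s → f (const d) s → setConst (base tt) d s
      f-const⁺ d@(diag _ i j) s (lift u) = cong lift (⟦Diagonal⟧⁻ (toTuple s)
        (⟦⟧-⊆ (Below (const d)) (Diagonal i j) (toTuple s) (D⁺ d) u))

      f-const⁻ : ∀ d s → setConst (base tt) d s → f (const d) s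
      f-const⁻ d@(diag _ i j) s e = lift (⟦⟧-⊆ (Diagonal i j) (Below (const d)) (toTuple s) (D⁻ d)
        (⟦Diagonal⟧⁺ (toTuple s) (cong lower e)))

      Product : RawAlgebra n σ (Level.suc r) r
      Product = directProduct (Lift r ⊤) (λ _ → setAlgebra (base tt))

      module Prod = RawAlgebra Product

      F : Carrier → Prod.Carrier
      F x _ = f x

      f-⊆ : ∀ x y s → (∀ a → Below x a → Below y a) → f x s → f y s
      f-⊆ x y s x⊆y (lift u) = lift (⟦⟧-⊆ (Below x) (Below y) (toTuple s) x⊆y u)

      f-mono : ∀ x y s → x ≤ y → f x s → f y s
      f-mono x y s x≤y = f-⊆ x y s λ a a≤x → ≤-trans a≤x x≤y

      f-∨ : ∀ x y s → f (x ∨ y) s → f x s ⊎ f y s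
      f-∨ x y s (lift u) = Sum.map lift lift (⟦∪⟧⁻ (Below x) (Below y) (toTuple s)
        (⟦⟧-⊆ (Below (x ∨ y)) _ (toTuple s) (λ a → atom-∨ (isAtom a)) u))

      f-∧ : ∀ x y s → f x s → f y s → f (x ∧ y) s
      f-∧ x y s (lift u) (lift v) = lift (⟦⟧-⊆ (λ a → Below x a × Below y a) (Below (x ∧ y)) (toTuple s)
        (λ a (p , q) → ∧-greatest p q)
        (⟦∩⟧⁺ (Below x) (Below y) (toTuple s) (below-inv x) u v))

      f-∁⁺ : ∀ x s → ¬ f x s → f (∁ x) s
      f-∁⁺ x s ¬u = lift (⟦⟧-⊆ _ (Below (∁ x)) (toTuple s) (λ a → atom-∁⁺ (isAtom a))
        (⟦∁⟧⁺ (Below x) (toTuple s) λ u → ¬u (lift u)))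

      f-∁⁻ : ∀ x s → f (∁ x) s → ¬ f x s
      f-∁⁻ x s (lift u) (lift v) = ⟦∁⟧⁻ (Below x) (toTuple s) (below-inv x)
        (⟦⟧-⊆ (Below (∁ x)) _ (toTuple s) (λ a → atom-∁⁻ (isAtom a)) u) v

      f-𝟘 : ∀ s → ¬ f 𝟘 s
      f-𝟘 s (lift u) = let a , a≤𝟘 = ⟦⟧-inhabited (Below 𝟘) (toTuple s) u in
        atom-∁⁻ (isAtom a) (≤-trans a≤𝟘 𝟘≤) a≤𝟘

      f-op⁺ : ∀ Ω x s → f (op Ω x) s → setOp (base tt) Ω (f x) s
      f-op⁺ Ω x s (lift u) =
        ⟦op⟧⁺ Ω x s (⟦⟧-⊆ (Below (op Ω x)) (Image Ω (Below x)) (toTuple s) (below-op⁺ Ω x) u)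

      f-op⁻ : ∀ Ω x s → setOp (base tt) Ω (f x) s → f (op Ω x) s
      f-op⁻ Ω x s u =
        lift (⟦⟧-⊆ (Image Ω (Below x)) (Below (op Ω x)) (toTuple s) (below-op⁻ Ω x) (⟦op⟧⁻ Ω x s u))

      F-homomorphism : IsHomomorphism raw Product F
      F-homomorphism = record
        { cong    = λ {x} {y} e _ s →
            mk⇔ (f-mono x y s (≤-reflexive e)) (f-mono y x s (≤-reflexive (≈-sym e)))
        ; ∨-homo  = λ x y _ s → mk⇔ (f-∨ x y s)
            (λ { (inj₁ u) → f-mono x (x ∨ y) s ∨-upperˡ u ; (inj₂ u) → f-mono y (x ∨ y) s ∨-upperʳ u })
        ; ∧-homo  = λ x y _ s → mk⇔
            (λ u → f-mono (x ∧ y) x s ∧-lowerˡ u , f-mono (x ∧ y) y s ∧-lowerʳ u)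
            (λ (u , v) → f-∧ x y s u v)
        ; ∁-homo  = λ x _ s → mk⇔ (f-∁⁻ x s) (f-∁⁺ x s)
        ; 𝟙-homo  = λ _ s → mk⇔ (λ _ → lift tt)
            (λ _ → lift (⟦𝟙⟧ {Below 𝟙} (toTuple s) λ a → ≤𝟙 {element a}))
        ; 𝟘-homo  = λ _ s → mk⇔ (λ u → lift (f-𝟘 s u)) λ ()
        ; op-homo = λ Ω x _ s → mk⇔ (f-op⁺ Ω x s) (f-op⁻ Ω x s)
        ; const-homo = λ d _ s → mk⇔ (f-const⁺ d s) (f-const⁻ d s)
        }

      f-reflects-≤ : ∀ {x y} → (∀ s → f x s → f y s) → x ≤ y
      f-reflects-≤ {x} {y} g = ≤-below λ a a≤x → ¬¬-elim λ a≰y →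
        let s , u = realised (below-inv (x ∧ ∁ y)) a (∧-greatest a≤x (atom-∁⁺ (isAtom a) a≰y))
            s′ : Unit (base tt)
            s′ i = lift (s i)
        in f-∁⁻ y s′ (f-mono (x ∧ ∁ y) (∁ y) s′ ∧-lowerʳ (lift u))
             (g s′ (f-mono (x ∧ ∁ y) x s′ ∧-lowerˡ (lift u)))

      F-injective : ∀ {x y} → F x Prod.≈ F y → x ≈ y
      F-injective e = ≤-antisym (f-reflects-≤ λ s → to (e (lift tt) s))
                                (f-reflects-≤ λ s → from (e (lift tt) s))

      representable : Representable raw
      representable = Lift r ⊤ , (λ _ → base tt) , image , record
        { to             = λ x → F x , x , λ _ _ → mk⇔ id id
        ; isHomomorphism = record
          { cong = H.cong ; ∨-homo = H.∨-homo ; ∧-homo = H.∧-homo ; ∁-homo = H.∁-homo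
          ; 𝟙-homo = H.𝟙-homo ; 𝟘-homo = H.𝟘-homo ; op-homo = H.op-homo ; const-homo = H.const-homo }
        ; bijective      = F-injective , λ (Y , x , e) → x , λ z≈x i s →
            mk⇔ (from (e i s) ∘ to (H.cong z≈x i s)) (from (H.cong z≈x i s) ∘ to (e i s))
        }
        where
        module H = IsHomomorphism F-homomorphism
        image : Subuniverse Product r
        image = record
          { Mem          = λ Y → ∃[ x ] (∀ i s → Y i s ⇔ F x i s)
          ; respects     = λ Y≈Z (x , e) → x , λ i s →
              mk⇔ (to (e i s) ∘ from (Y≈Z i s)) (to (Y≈Z i s) ∘ from (e i s))
          ; ∨-closed     = λ (x , e) (y , e′) → x ∨ y , λ i s → mk⇔
              (λ z → from (H.∨-homo x y i s) (Sum.map (to (e i s)) (to (e′ i s)) z))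
              (λ z → Sum.map (from (e i s)) (from (e′ i s)) (to (H.∨-homo x y i s) z))
          ; ∧-closed     = λ (x , e) (y , e′) → x ∧ y , λ i s → mk⇔
              (λ (z , w) → from (H.∧-homo x y i s) (to (e i s) z , to (e′ i s) w))
              (λ z → let u , v = to (H.∧-homo x y i s) z in from (e i s) u , from (e′ i s) v)
          ; ∁-closed     = λ (x , e) → ∁ x , λ i s → mk⇔
              (λ ¬z → from (H.∁-homo x i s) (¬z ∘ from (e i s)))
              (λ z w → to (H.∁-homo x i s) z (to (e i s) w))
          ; 𝟙-closed     = 𝟙 , λ i s → mk⇔ (from (H.𝟙-homo i s)) (to (H.𝟙-homo i s))
          ; 𝟘-closed     = 𝟘 , λ i s → mk⇔ (from (H.𝟘-homo i s)) (to (H.𝟘-homo i s))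
          ; op-closed    = λ Ω (x , e) → op Ω x , λ i s → mk⇔
              (λ z → from (H.op-homo Ω x i s) (setOp-mono Ω (λ s → to (e i s)) s z))
              (λ z → setOp-mono Ω (λ s → from (e i s)) s (to (H.op-homo Ω x i s) z))
          ; const-closed = λ d → const d , λ i s →
              mk⇔ (from (H.const-homo d i s)) (to (H.const-homo d i s))
          }
          where
          setOp-mono : ∀ Ω {Y Z : Pred (Unit (base tt)) r} → (∀ s → Y s → Z s) →
                       ∀ s → setOp (base tt) Ω Y s → setOp (base tt) Ω Z s
          setOp-mono (cyl i)       g s (t , y , e) = t , g t y , e
          setOp-mono (repl _ i j)  g s y = g _ y
          setOp-mono (trans _ i j) g s y = g _ y

    stronglyRepresentable : ∀ σ → StronglyRepresentable (atomStructure σ)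
    stronglyRepresentable σ = Embed.representable

  -- Non-representability when the limit labels are finitely colourable.

  module UltraproductComplex {ℓ} {m : ℕ} (2<n : 2 < suc m) (σ : Signature)
    {V : Set ℓ} (_~[_]_ : V → ℕ → V → Set) (U : Ultrafilter ℕ)
    {C : ℕ} (colour : (ℕ → V) → Fin C)
    (colour-resp : ∀ {x y} → U ∋ (λ k → x k ≡ y k) → colour x ≡ colour y)
    (colour-proper : ∀ {x y} → U ∋ (λ k → x k ~[ k ] y k) → colour x ≢ colour y)
    (vertex : ℕ → V) (vertex-injective : ∀ {v w} → vertex v ≡ vertex w → v ≡ w)
    where
    open import Data.Fin.Base using (inject₁; punchIn; punchOut)
    open import Data.Fin.Induction using (<-weakInduction)
    open import Data.Nat.Base using (_≤_)
    open import Relation.Binary.Definitions using (tri<; tri≈; tri>)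

    n : ℕ
    n = suc m

    open ThreeElements 2<n

    i₀ i₁ i₂ : Fin n
    i₀ = zero
    i₁ = proj₁ (another i₀ i₀)
    i₂ = proj₁ (another i₀ i₁)

    i₁≢i₀ : i₁ ≢ i₀
    i₁≢i₀ = proj₁ (proj₂ (another i₀ i₀))

    i₀≢i₁ : i₀ ≢ i₁
    i₀≢i₁ e = i₁≢i₀ (sym e)

    i₂≢i₀ : i₂ ≢ i₀
    i₂≢i₀ = proj₁ (proj₂ (another i₀ i₁))

    i₀≢i₂ : i₀ ≢ i₂
    i₀≢i₂ e = i₂≢i₀ (sym e)

    i₂≢i₁ : i₂ ≢ i₁
    i₂≢i₁ = proj₂ (proj₂ (another i₀ i₁))

    module A (k : ℕ) = LabelledAtoms n V (λ v w → v ~[ k ] w)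
    open LabelledAtoms.Atom

    module Factor (k : ℕ) where
      open A k

      -- The coincidence of `i₀` and `i₂` keeps the face opposite to `i₁` from being big. Hence
      -- cylindrifying at `i₁` can give the face opposite to `i₀` any label, and one tuple yields
      -- infinitely many points.
      Pinched : Atom → Set
      Pinched a = Holds (same a i₀ i₂) ×
                  (∀ {j l} → j ≢ i₀ → l ≢ i₀ → j ≢ i₁ → l ≢ i₁ → Holds (same a j l) → j ≡ l)

      pinched-resp : ∀ a b → a ≋ b → Pinched a → Pinched b
      pinched-resp a b (e , _) (t , d) = subst Holds (e i₀ i₂) t ,
        λ {j} {l} j≢i₀ l≢i₀ j≢i₁ l≢i₁ h → d j≢i₀ l≢i₀ j≢i₁ l≢i₁ (subst Holds (sym (e j l)) h)

      pinched-exists : ∃ Pinched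
      pinched-exists = record
        { same       = λ j l → ⌊ ρ j ≡ ρ l ⌋
        ; label      = λ _ → vertex 0
        ; same-refl  = λ _ → ⌊⌋⁺ refl
        ; same-sym   = λ h → ⌊⌋⁺ (sym (⌊⌋⁻ h))
        ; same-trans = λ h h′ → ⌊⌋⁺ (≡-trans (⌊⌋⁻ h) (⌊⌋⁻ h′))
        ; label-cong = λ _ _ → refl
        ; adjacent   = λ disc → ⊥-elim (i₀≢i₂ (disc (⌊⌋⁺ ρ-identifies)))
        } , ⌊⌋⁺ ρ-identifies , λ j≢i₀ l≢i₀ _ _ h →
            ≡-trans (sym (collapse-other i₀≢i₂ j≢i₀)) (≡-trans (⌊⌋⁻ h) (collapse-other i₀≢i₂ l≢i₀))
        where
        ρ : Fin n → Fin n
        ρ = collapse i₀≢i₂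
        ρ-identifies : ρ i₀ ≡ ρ i₂
        ρ-identifies = ≡-trans (collapse-i i₀≢i₂) (sym (collapse-other i₀≢i₂ i₂≢i₀))

      Labelled : V → Atom → Set ℓ
      Labelled v a = Big a i₀ × label a i₀ ≡ v

      labelled-resp : ∀ v a b → a ≋ b → Labelled v a → Labelled v b
      labelled-resp v a b (e , l) (big , eq) =
        ≋-big {a} {b} {i₀} (e , l) big , ≡-trans (sym (l i₀ big)) eq

      module _ (v : V) (a : Atom) (pinched : Pinched a) where

        Replaced : Fin n → Fin n → Set
        Replaced j l = (j ≡ i₁ × l ≡ i₁) ⊎ (j ≢ i₁ × l ≢ i₁ × Holds (same a j l))

        replaced-trans : ∀ {j k l} → Replaced j k → Replaced k l → Replaced j l
        replaced-trans (inj₁ (e , _))      (inj₁ (_ , e′))     = inj₁ (e , e′)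
        replaced-trans (inj₁ (_ , e))      (inj₂ (k≢ , _))     = ⊥-elim (k≢ e)
        replaced-trans (inj₂ (_ , k≢ , _)) (inj₁ (e , _))      = ⊥-elim (k≢ e)
        replaced-trans (inj₂ (j≢ , _ , h)) (inj₂ (_ , l≢ , h′)) = inj₂ (j≢ , l≢ , same-trans a h h′)

        replaced-sym : ∀ {j k} → Replaced j k → Replaced k j
        replaced-sym (inj₁ (e , e′))      = inj₁ (e′ , e)
        replaced-sym (inj₂ (j≢ , k≢ , h)) = inj₂ (k≢ , j≢ , same-sym a h)

        replaced-refl : ∀ j → Replaced j j
        replaced-refl j with j ≟ i₁
        ... | yes e = inj₁ (e , e)
        ... | no j≢ = inj₂ (j≢ , j≢ , same-refl a j)

        replaced : Atom
        replaced = record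
          { same       = λ j l → ⌊ Replaced j l ⌋
          ; label      = λ _ → v
          ; same-refl  = λ j → ⌊⌋⁺ (replaced-refl j)
          ; same-sym   = λ h → ⌊⌋⁺ (replaced-sym (⌊⌋⁻ h))
          ; same-trans = λ h h′ → ⌊⌋⁺ (replaced-trans (⌊⌋⁻ h) (⌊⌋⁻ h′))
          ; label-cong = λ _ _ → refl
          ; adjacent   = λ disc → ⊥-elim (i₀≢i₂ (disc (⌊⌋⁺ (inj₂ (i₀≢i₁ , i₂≢i₁ , proj₁ pinched)))))
          }

        replaced-labelled : Labelled v replaced
        replaced-labelled = (λ {j} {l} → big {j} {l}) , refl
          where
          big : Big replaced i₀
          big j≢ l≢ h with ⌊⌋⁻ h
          ... | inj₁ (e , e′)       = ≡-trans e (sym e′)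
          ... | inj₂ (j≢′ , l≢′ , s) = proj₂ pinched j≢ l≢ j≢′ l≢′ s

        replaced-≡[] : a ≡[ i₁ ] replaced
        replaced-≡[] = (λ j≢ l≢ → Holds-ext (λ s → ⌊⌋⁺ (inj₂ (j≢ , l≢ , s))) (λ h → old (⌊⌋⁻ h) j≢)) ,
                       λ big → ⊥-elim (i₀≢i₂ (big i₀≢i₁ i₂≢i₁ (proj₁ pinched)))
          where
          old : ∀ {j l} → Replaced j l → j ≢ i₁ → Holds (same a j l)
          old (inj₁ (e , _))     j≢ = ⊥-elim (j≢ e)
          old (inj₂ (_ , _ , s)) _  = s

    factor : ℕ → AtomStructure n σ ℓ ℓ ℓ
    factor k = A.atomStructure k σ

    S∞ : AtomStructure n σ ℓ ℓ ℓ
    S∞ = ultraproduct U factor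

    module S∞ = AtomStructure S∞
    module B = RawAlgebra (complexRaw S∞)

    infix 4 _∈_ _⊆_
    _∈_ : S∞.Carrier → B.Carrier → Set ℓ
    a ∈ X = proj₁ X a

    _⊆_ : B.Carrier → B.Carrier → Set ℓ
    X ⊆ Y = ∀ a → a ∈ X → a ∈ Y

    internal : ∀ {p} (P : ∀ k → A.Atom k → Set p) → (∀ k a b → A._≋_ k a b → P k a → P k b) → B.Carrier
    internal P resp = (λ a → Lift ℓ (U ∋ λ k → P k (a k))) ,
      λ { {a} {b} (lift e) (lift u) → lift (∋-mono₂ U (λ k → resp k (a k) (b k)) e u) }

    cylinder : Fin n → B.Carrier → B.Carrier
    cylinder i = B.op (cyl i)

    -- In a representation as a `Df`-algebra these elements need not become equality. What can be
    -- used is that they behave like an equivalence between coordinates and interact with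
    -- cylindrifications as in `diag-total` and `diag-determines`.
    Diag : Fin n → Fin n → B.Carrier
    Diag i j = internal (λ k a → Holds (same a i j)) λ k a b (e , _) → subst Holds (e i j)

    Pinched∞ : B.Carrier
    Pinched∞ = internal Factor.Pinched Factor.pinched-resp

    Labelled∞ : V → B.Carrier
    Labelled∞ v = internal (λ k → Factor.Labelled k v) (λ k → Factor.labelled-resp k v)

    big-resp : ∀ {a b : S∞.Carrier} {i} k → A._≋_ k (a k) (b k) → Big (a k) i → Big (b k) i
    big-resp {a} {b} {i} k = A.≋-big k {a k} {b k} {i}

    label-resp : ∀ {a b : S∞.Carrier} {i} k → A._≋_ k (a k) (b k) → Big (a k) i →
                 label (a k) i ≡ label (b k) i
    label-resp {i = i} k e big = proj₂ e i big

    -- Not given factor by factor as in `internal`: the colouring lives on the ultraproduct. The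
    -- complex algebra has this element because it has all subsets.
    Coloured : Fin n → Fin C → B.Carrier
    Coloured i c = (λ a → Lift ℓ ((U ∋ λ k → Big (a k) i) × colour (λ k → label (a k) i) ≡ c)) ,
      λ { {a} {b} (lift e) (lift (big , eq)) → lift
          ( ∋-mono₂ U (big-resp {a} {b} {i}) e big
          , ≡-trans (sym (colour-resp (∋-mono₂ U (label-resp {a} {b} {i}) e big))) eq) }

    ⋃ : ∀ {N} → (Fin N → B.Carrier) → B.Carrier
    ⋃ X = (λ a → ∃[ i ] a ∈ X i) , λ a≈b (i , x) → i , proj₂ (X i) a≈b x

    Closed : B.Carrier → Fin n → Set ℓ
    Closed X i = cylinder i X ⊆ X

    diag-closed : ∀ {i j k} → k ≢ i → k ≢ j → Closed (Diag i j) k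
    diag-closed k≢i k≢j a (b , lift h , lift r) = lift (∋-mono₂ U
      (λ _ h r → subst Holds (sym (proj₁ r (λ e → k≢i (sym e)) (λ e → k≢j (sym e)))) h) h r)

    diag-refl : ∀ i → B.𝟙 ⊆ Diag i i
    diag-refl i a _ = lift (∋-all U λ k → same-refl (a k) i)

    diag-sym : ∀ i j → Diag i j ⊆ Diag j i
    diag-sym i j a (lift h) = lift (∋-mono U (λ k → same-sym (a k)) h)

    diag-trans : ∀ i j l → (Diag i j B.∧ Diag j l) ⊆ Diag i l
    diag-trans i j l a (lift h , lift h′) = lift (∋-mono₂ U (λ k → same-trans (a k)) h h′)

    diag-total : ∀ {i j} → i ≢ j → B.𝟙 ⊆ cylinder i (Diag i j)
    diag-total i≢j a _ = (λ k → A.collapsed k i≢j (a k)) ,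
      lift (∋-all U λ k → A.collapsed-ij k i≢j (a k)) , lift (∋-all U λ k → A.collapsed-≡[] k i≢j (a k))

    diag-determines : ∀ {i j} → i ≢ j → ∀ X → (Diag i j B.∧ cylinder i (Diag i j B.∧ X)) ⊆ X
    diag-determines {i} {j} i≢j X a (lift h , b , (lift h′ , x) , lift r) =
      proj₂ X (lift (∋-mono₂ U equal (∋-∩ U h h′) r)) x
      where
      equal : ∀ k → Holds (same (a k) i j) × Holds (same (b k) i j) →
              A._≡[_]_ k (a k) i (b k) → A._≋_ k (b k) (a k)
      equal k (h , h′) r = A.≋-sym k {a k} {b k} (A.≡[]-diagonal k i≢j (a k) (b k) r h h′)

    labelled-closed : ∀ v → Closed (Labelled∞ v) i₀
    labelled-closed v a (b , lift l , lift r) = lift (∋-mono₂ U closed l r)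
      where
      closed : ∀ k → Factor.Labelled k v (b k) → A._≡[_]_ k (a k) i₀ (b k) → Factor.Labelled k v (a k)
      closed k (big , e) (r , l) = (λ {i} {j} → big-a {i} {j}) , ≡-trans (l big-a) e
        where
        big-a : Big (a k) i₀
        big-a i≢ j≢ h = big i≢ j≢ (subst Holds (r i≢ j≢) h)

    labelled-disjoint : ∀ {v w} → v ≢ w → ∀ a → ¬ a ∈ (Labelled∞ v B.∧ Labelled∞ w)
    labelled-disjoint v≢w a (lift p , lift q) =
      let _ , (_ , e) , (_ , e′) = ∋-witness U (∋-∩ U p q) in v≢w (≡-trans (sym e) e′)

    pinched-labelled : ∀ v → Pinched∞ ⊆ cylinder i₁ (Labelled∞ v)
    pinched-labelled v a (lift p) = (λ k → proj₁ (choice k)) ,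
      lift (∋-mono U (λ k p → proj₁ (proj₂ (choice k) p)) p) ,
      lift (∋-mono U (λ k p → proj₂ (proj₂ (choice k) p)) p)
      where
      choice : ∀ k → Σ[ b ∈ A.Atom k ]
               (Factor.Pinched k (a k) → Factor.Labelled k v b × A._≡[_]_ k (a k) i₁ b)
      choice k with em {P = Factor.Pinched k (a k)}
      ... | yes p = Factor.replaced k v (a k) p , λ _ →
                    Factor.replaced-labelled k v (a k) p , Factor.replaced-≡[] k v (a k) p
      ... | no ¬p = a k , λ p → ⊥-elim (¬p p)

    pinched∞-exists : ∃[ a ] a ∈ Pinched∞
    pinched∞-exists = (λ k → proj₁ (Factor.pinched-exists k)) ,
                      lift (∋-all U λ k → proj₂ (Factor.pinched-exists k))

    coloured-closed : ∀ i c → Closed (Coloured i c) i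
    coloured-closed i c a (b , lift (big , e) , lift r) =
      lift (∋-mono₂ U big-a big r , ≡-trans (colour-resp (∋-mono₂ U label-a big r)) e)
      where
      big-a : ∀ k → Big (b k) i → A._≡[_]_ k (a k) i (b k) → Big (a k) i
      big-a k big (r , _) i≢ j≢ h = big i≢ j≢ (subst Holds (r i≢ j≢) h)
      label-a : ∀ k → Big (b k) i → A._≡[_]_ k (a k) i (b k) → label (a k) i ≡ label (b k) i
      label-a k big r = proj₂ r (big-a k big r)

    coloured-diag : ∀ {i j} c → i ≢ j → (Diag i j B.∧ Coloured i c) ⊆ Coloured j c
    coloured-diag {i} {j} c i≢j a (lift h , lift (big , e)) =
      lift (∋-mono₂ U big-j h big , ≡-trans (sym (colour-resp (∋-mono₂ U label-ij h big))) e)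
      where
      big-j : ∀ k → Holds (same (a k) i j) → Big (a k) i → Big (a k) j
      big-j k h = A.big-swap k (λ e → i≢j (sym e)) (a k) (same-sym (a k) h)
      label-ij : ∀ k → Holds (same (a k) i j) → Big (a k) i → label (a k) i ≡ label (a k) j
      label-ij k h big = label-cong (a k) big h

    -- The conditions on indices are part of the set, so that unions can run over all of `Fin n`.
    Degenerate : Fin n → Fin n → Fin n → B.Carrier
    Degenerate i j l = (λ a → Lift ℓ (j ≢ i × l ≢ i × j ≢ l) × a ∈ Diag j l) ,
      λ { {a} {b} a≈b (d , h) → d , proj₂ (Diag j l) {a} {b} a≈b h }

    coloured-or-degenerate : ∀ i → B.𝟙 ⊆ (⋃ (Coloured i) B.∨ ⋃ λ j → ⋃ λ l → Degenerate i j l)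
    coloured-or-degenerate i a _ with ∋-total U (λ k → Big (a k) i)
    ... | inj₁ big  = inj₁ (_ , lift (big , refl))
    ... | inj₂ ¬big =
      let j , u = ∋-∃Fin U (∋-mono U (λ k → repeated k) ¬big)
          l , u′ = ∋-∃Fin U u
          _ , j≢i , l≢i , j≢l , _ = ∋-witness U u′
      in inj₂ (j , l , lift (j≢i , l≢i , j≢l) , lift (∋-mono U (λ k (_ , _ , _ , h) → h) u′))
      where
      repeated : ∀ k → ¬ Big (a k) i → ∃[ j ] ∃[ l ] (j ≢ i × l ≢ i × j ≢ l × Holds (same (a k) j l))
      repeated k ¬big = ¬¬-elim λ none → ¬big λ {j} {l} j≢ l≢ h →
        ¬¬-elim λ j≢l → none (j , l , j≢ , l≢ , j≢l , h)

    -- If all faces are big then, as any two indices avoid a third, the points are distinct and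
    -- `adjacent` yields an edge. Both its ends would have colour `c`.
    not-all-coloured : ∀ c → B.𝟙 ⊆ ⋃ λ i → B.∁ (Coloured i c)
    not-all-coloured c a _ = ¬¬-elim λ none →
      let coloured : ∀ i → a ∈ Coloured i c
          coloured i = ¬¬-elim λ ¬x → none (i , ¬x)
          edges = ∋-mono U edge (∋-∀Fin U λ i → proj₁ (lower (coloured i)))
          i , u  = ∋-∃Fin U edges
          j , u′ = ∋-∃Fin U u
      in colour-proper u′ (≡-trans (proj₂ (lower (coloured i))) (sym (proj₂ (lower (coloured j)))))
      where
      edge : ∀ k → (∀ i → Big (a k) i) → ∃[ i ] ∃[ j ] (label (a k) i ~[ k ] label (a k) j)
      discrete : ∀ k → (∀ i → Big (a k) i) → A.Discrete k (same (a k))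
      edge k big = adjacent (a k) λ {j} {l} → discrete k big {j} {l}
      discrete k big {j} {l} h = let i , i≢j , i≢l = another j l in
        big i (λ e → i≢j (sym e)) (λ e → i≢l (sym e)) h

    -- `h` is one factor of a representation. Only Boolean operations and cylindrifications are
    -- mentioned and each coordinate has its own sort, which covers all signatures and rectangular
    -- units.
    module Homomorphism {z z′} {Z : Fin n → Set z} (h : B.Carrier → (∀ i → Z i) → Set z′)
      (h-⊆ : ∀ X Y s → X ⊆ Y → h X s → h Y s)
      (h-∧ : ∀ X Y s → h X s → h Y s → h (X B.∧ Y) s)
      (h-∨ : ∀ X Y s → h (X B.∨ Y) s → h X s ⊎ h Y s)
      (h-∁ : ∀ X s → h (B.∁ X) s → ¬ h X s)
      (h-𝟙 : ∀ s → h B.𝟙 s)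
      (h-cylinder⁺ : ∀ i X s t → (∀ k → k ≢ i → t k ≡ s k) → h X t → h (cylinder i X) s)
      (h-cylinder⁻ : ∀ i X s → h (cylinder i X) s → ∃[ t ] (h X t × (∀ k → k ≢ i → t k ≡ s k)))
      (s₀ : ∀ i → Z i) (s₀-pinched : h Pinched∞ s₀)
      where

      h-empty : ∀ X s → (∀ a → ¬ a ∈ X) → ¬ h X s
      h-empty X s empty u = h-∁ X s (h-⊆ X (B.∁ X) s (λ a x → ⊥-elim (empty a x)) u) u

      h-⋃ : ∀ {N} (X : Fin N → B.Carrier) s → h (⋃ X) s → ∃[ i ] h (X i) s
      h-⋃ {zero}  X s u = ⊥-elim (h-empty (⋃ X) s (λ { _ (() , _) }) u)
      h-⋃ {suc N} X s u with h-∨ (X zero) (⋃ (X ∘ suc)) s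
        (h-⊆ (⋃ X) (X zero B.∨ ⋃ (X ∘ suc)) s
          (λ { _ (zero , x) → inj₁ x ; _ (suc i , x) → inj₂ (i , x) }) u)
      ... | inj₁ v = zero , v
      ... | inj₂ v with i , w ← h-⋃ (X ∘ suc) s v = suc i , w

      h-total : ∀ X s → B.𝟙 ⊆ X → h X s
      h-total X s total = h-⊆ B.𝟙 X s total (h-𝟙 s)

      -- Coordinates at which `X` is closed do not affect membership in `h X`: the hybrids lead from
      -- `s` to `t` one coordinate at a time.
      module _ (X : B.Carrier) (s t : ∀ i → Z i) (f : ∀ k → Closed X k ⊎ s k ≡ t k) where

        private
          hybrid : ℕ → ∀ i → Z i
          hybrid j k with toℕ k ℕₚ.<? j
          ... | yes _ = t k
          ... | no _  = s k

          hybrid-< : ∀ {j k} → toℕ k < j → hybrid j k ≡ t k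
          hybrid-< {j} {k} k<j with toℕ k ℕₚ.<? j
          ... | yes _  = refl
          ... | no k≮j = ⊥-elim (k≮j k<j)

          hybrid-≮ : ∀ {j k} → ¬ toℕ k < j → hybrid j k ≡ s k
          hybrid-≮ {j} {k} k≮j with toℕ k ℕₚ.<? j
          ... | yes k<j = ⊥-elim (k≮j k<j)
          ... | no _    = refl

          hybrid-step : ∀ j k → toℕ k ≢ j → hybrid j k ≡ hybrid (suc j) k
          hybrid-step j k k≢j with toℕ k ℕₚ.<? j
          ... | yes k<j = sym (hybrid-< (ℕₚ.<-trans k<j (ℕₚ.n<1+n j)))
          ... | no k≮j  = sym (hybrid-≮ λ k<1+j → k≮j (ℕₚ.≤∧≢⇒< (ℕₚ.≤-pred k<1+j) k≢j))

          walk : ∀ j → j ≤ n → h X s → h X (hybrid j)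
          walk zero    _   u = subst (h X) (ext λ k → sym (hybrid-≮ {0} {k} λ ())) u
          walk (suc j) j<n u with f (fromℕ< j<n)
          ... | inj₁ closed = h-⊆ (cylinder i X) X (hybrid (suc j)) closed
                (h-cylinder⁺ i X (hybrid (suc j)) (hybrid j) (λ k k≢i → hybrid-step j k λ e →
                   k≢i (Finₚ.toℕ-injective (≡-trans e (sym (Finₚ.toℕ-fromℕ< j<n)))))
                  (walk j (ℕₚ.<⇒≤ j<n) u))
            where i = fromℕ< j<n
          ... | inj₂ si≡ti = subst (h X) (ext same′) (walk j (ℕₚ.<⇒≤ j<n) u)
            where
            same′ : ∀ k → hybrid j k ≡ hybrid (suc j) k
            same′ k with toℕ k ℕₚ.≟ j
            ... | no k≢j   = hybrid-step j k k≢j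
            ... | yes refl = ≡-trans (hybrid-≮ {j} {k} (ℕₚ.<-irrefl refl))
                  (≡-trans (subst (λ i → s i ≡ t i) (Finₚ.fromℕ<-toℕ k j<n) si≡ti)
                           (sym (hybrid-< {suc j} {k} (ℕₚ.n<1+n j))))

        h-transfer : h X s → h X t
        h-transfer u = subst (h X) (ext λ k → hybrid-< {n} {k} (Finₚ.toℕ<n k)) (walk n ℕₚ.≤-refl u)

      diag-transfer : ∀ {i j} s t → s i ≡ t i → s j ≡ t j → h (Diag i j) s → h (Diag i j) t
      diag-transfer {i} {j} s t ei ej = h-transfer (Diag i j) s t agree
        where
        agree : ∀ k → Closed (Diag i j) k ⊎ s k ≡ t k
        agree k with k ≟ i | k ≟ j
        ... | yes refl | _        = inj₂ ei
        ... | no _     | yes refl = inj₂ ej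
        ... | no k≢i   | no k≢j   = inj₁ (diag-closed k≢i k≢j)

      transfer-off : ∀ X i → Closed X i → ∀ s t → (∀ k → k ≢ i → s k ≡ t k) → h X s → h X t
      transfer-off X i closed s t e = h-transfer X s t agree
        where
        agree : ∀ k → Closed X k ⊎ s k ≡ t k
        agree k with k ≟ i
        ... | yes refl = inj₁ closed
        ... | no k≢i   = inj₂ (e k k≢i)

      h-sym : ∀ i j s → h (Diag i j) s → h (Diag j i) s
      h-sym i j s = h-⊆ (Diag i j) (Diag j i) s (diag-sym i j)

      h-trans : ∀ i j l s → h (Diag i j) s → h (Diag j l) s → h (Diag i l) s
      h-trans i j l s u v = h-⊆ (Diag i j B.∧ Diag j l) (Diag i l) s (diag-trans i j l)
        (h-∧ (Diag i j) (Diag j l) s u v)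

      h-refl : ∀ i s → h (Diag i i) s
      h-refl i s = h-total (Diag i i) s (diag-refl i)

      -- Infinitely many points: different labels force the witnesses t v i₁ apart.
      witness : ∀ v → ∃[ t ] (h (Labelled∞ (vertex v)) t × (∀ k → k ≢ i₁ → t k ≡ s₀ k))
      witness v = h-cylinder⁻ i₁ (Labelled∞ (vertex v)) s₀
        (h-⊆ Pinched∞ (cylinder i₁ (Labelled∞ (vertex v))) s₀ (pinched-labelled (vertex v)) s₀-pinched)

      t : ℕ → ∀ i → Z i
      t v = proj₁ (witness v)

      -- With different sorts a point needs a representative in each coordinate. The one at `i` is
      -- linked to the witness at `i₁` by `Diag i i₁`.
      point-choice : ∀ v i → Σ[ x ∈ Z i ] ∃[ t′ ] (h (Diag i i₁) t′ × t′ i ≡ x × t′ i₁ ≡ t v i₁)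
      point-choice v i with i ≟ i₁
      ... | yes refl = t v i₁ , t v , h-refl i₁ (t v) , refl , refl
      ... | no i≢i₁  =
        let t′ , u , e = h-cylinder⁻ i (Diag i i₁) (t v)
                           (h-total (cylinder i (Diag i i₁)) (t v) (diag-total i≢i₁))
        in t′ i , t′ , u , refl , e i₁ (λ i₁≡i → i≢i₁ (sym i₁≡i))

      point : ℕ → ∀ i → Z i
      point v i = proj₁ (point-choice v i)

      point-i₁ : ∀ v → point v i₁ ≡ t v i₁
      point-i₁ v = let _ , _ , _ , e , e′ = point-choice v i₁ in ≡-trans (sym e) e′

      point-diag : ∀ v i j → h (Diag i j) (point v)
      point-diag v i j = h-trans i i₁ j (point v) (to-i₁ i) (h-sym j i₁ (point v) (to-i₁ j))
        where
        to-i₁ : ∀ i → h (Diag i i₁) (point v)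
        to-i₁ i = let _ , t′ , u , e , e′ = point-choice v i in
          diag-transfer t′ (point v) e (≡-trans e′ (sym (point-i₁ v))) u

      points : (Fin n → ℕ) → ∀ i → Z i
      points x i = point (x i) i

      points-same : ∀ x {i j} → x i ≡ x j → h (Diag i j) (points x)
      points-same x {i} {j} e = diag-transfer (point (x i)) (points x) refl
        (cong (λ v → point v j) e) (point-diag (x i) i j)

      -- Whether the representatives of `v` at `i` and of `w` at `j` are linked does not depend on
      -- the remaining coordinates, by `diag-transfer`; so some tuple `x` is enough.
      Identified : ℕ → ℕ → Fin n → Fin n → Set _
      Identified v w i j = ∃[ x ] (x i ≡ v × x j ≡ w × h (Diag i j) (points x))

      identified-sym : ∀ {v w i j} → Identified v w i j → Identified w v j i
      identified-sym {i = i} {j} (x , ei , ej , u) = x , ej , ei , h-sym i j (points x) u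

      identified-move : ∀ {v w i j} k → i ≢ j → k ≢ j → Identified v w i j → Identified v w k j
      identified-move {v} {w} {i} {j} k i≢j k≢j (x , ei , ej , u) =
        x′ , xk , xj , h-trans k i j (points x′)
          (points-same x′ (≡-trans xk (sym xi)))
          (diag-transfer (points x) (points x′) (cong (λ v → point v i) (≡-trans ei (sym xi)))
                                                (cong (λ v → point v j) (≡-trans ej (sym xj))) u)
        where
        x′ : Fin n → ℕ
        x′ = x [ k ≔ v ]
        xk : x′ k ≡ v
        xk = ≔-same x k v
        xj : x′ j ≡ w
        xj = ≡-trans (≔-other x (λ e → k≢j (sym e))) ej
        xi : x′ i ≡ v
        xi with i ≟ k
        ... | yes refl = refl
        ... | no _     = ei

      identified-i₀i₁ : ∀ {v w i j} → i ≢ j → Identified v w i j → Identified v w i₀ i₁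
      identified-i₀i₁ {v} {w} {i} {j} i≢j id =
        -- The third index `k` keeps the two positions apart while they move to `i₀` and `i₁`.
        let k , k≢j , k≢i₁ = another j i₁ in
        identified-move i₀ k≢i₁ i₀≢i₁
          (identified-sym (identified-move i₁ (λ j≡k → k≢j (sym j≡k)) (λ i₁≡k → k≢i₁ (sym i₁≡k))
            (identified-sym (identified-move k i≢j k≢j id))))

      -- With coordinate `i₀` set to the representative of `v`, the witnesses for `v` and `w` differ
      -- only at `i₁` and both lie in `Diag i₁ i₀`. By `diag-determines` the second inherits the
      -- label of the first, but the labels are disjoint.
      identified⇒≡ : ∀ {v w} → Identified v w i₀ i₁ → v ≡ w
      identified⇒≡ {v} {w} (x , e₀ , e₁ , u) = ¬¬-elim λ v≢w →
        h-empty (Labelled∞ (vertex v) B.∧ Labelled∞ (vertex w)) y′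
          (labelled-disjoint λ e → v≢w (vertex-injective e))
          (h-∧ (Labelled∞ (vertex v)) (Labelled∞ (vertex w)) y′
            (h-⊆ _ (Labelled∞ (vertex v)) y′ (diag-determines i₁≢i₀ (Labelled∞ (vertex v)))
              (h-∧ (Diag i₁ i₀) (cylinder i₁ (Diag i₁ i₀ B.∧ Labelled∞ (vertex v))) y′ diag-y′
                (h-cylinder⁺ i₁ (Diag i₁ i₀ B.∧ Labelled∞ (vertex v)) y′ y y≡y′
                  (h-∧ (Diag i₁ i₀) (Labelled∞ (vertex v)) y diag-y (labelled v)))))
            (labelled w))
        where
        move : ℕ → ∀ i → Z i
        move v′ = t v′ [ i₀ ≔ point v i₀ ]
        y y′ : ∀ i → Z i
        y  = move v
        y′ = move w
        labelled : ∀ v′ → h (Labelled∞ (vertex v′)) (move v′)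
        labelled v′ = transfer-off (Labelled∞ (vertex v′)) i₀ (labelled-closed (vertex v′))
          (t v′) (move v′) (λ k k≢i₀ → sym (≔-other (t v′) k≢i₀)) (proj₁ (proj₂ (witness v′)))
        y≡y′ : ∀ k → k ≢ i₁ → y k ≡ y′ k
        y≡y′ k k≢i₁ with k ≟ i₀
        ... | yes refl = refl
        ... | no _     = ≡-trans (proj₂ (proj₂ (witness v)) k k≢i₁)
                                 (sym (proj₂ (proj₂ (witness w)) k k≢i₁))
        diag-y : h (Diag i₁ i₀) y
        diag-y = diag-transfer (point v) y (≡-trans (point-i₁ v) (sym (≔-other (t v) i₁≢i₀)))
          (sym (≔-same (t v) i₀ (point v i₀))) (point-diag v i₁ i₀)
        diag-y′ : h (Diag i₁ i₀) y′
        diag-y′ = diag-transfer (points x) y′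
          (≡-trans (cong (λ v → point v i₁) e₁) (≡-trans (point-i₁ w) (sym (≔-other (t w) i₁≢i₀))))
          (≡-trans (cong (λ v → point v i₀) e₀) (sym (≔-same (t w) i₀ (point v i₀))))
          (h-sym i₀ i₁ (points x) u)

      points-distinct : ∀ x {i j} → i ≢ j → x i ≢ x j → ¬ h (Diag i j) (points x)
      points-distinct x i≢j xi≢xj u = xi≢xj (identified⇒≡ (identified-i₀i₁ i≢j (x , refl , refl , u)))

      FaceColour : Fin n → (Fin m → ℕ) → Fin C → Set _
      FaceColour i y c = ∃[ x ] ((∀ k → x (punchIn i k) ≡ y k) × h (Coloured i c) (points x))

      faceColour-any : ∀ {i y c} → FaceColour i y c → ∀ x → (∀ k → x (punchIn i k) ≡ y k) →
                       h (Coloured i c) (points x)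
      faceColour-any {i} {y} {c} (x , e , u) x′ e′ =
        transfer-off (Coloured i c) i (coloured-closed i c) (points x) (points x′) agree u
        where
        agree : ∀ k → k ≢ i → points x k ≡ points x′ k
        agree k k≢i = cong (λ v → point v k)
          (subst (λ k → x k ≡ x′ k) (Finₚ.punchIn-punchOut {i = i} {j = k} (λ i≡k → k≢i (sym i≡k)))
            (≡-trans (e _) (sym (e′ _))))

      punchIn-adjacent : ∀ {r} (i : Fin r) (x : Fin (suc r) → ℕ) → x (inject₁ i) ≡ x (suc i) →
                         ∀ k → x (punchIn (inject₁ i) k) ≡ x (punchIn (suc i) k)
      punchIn-adjacent zero    x e zero    = sym e
      punchIn-adjacent zero    x e (suc k) = refl
      punchIn-adjacent (suc i) x e zero    = refl
      punchIn-adjacent (suc i) x e (suc k) = punchIn-adjacent i (x ∘ suc) e k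

      inject₁≢suc : ∀ {r} (i : Fin r) → inject₁ i ≢ suc i
      inject₁≢suc (suc i) e = inject₁≢suc i (Finₚ.suc-injective e)

      -- Repeat a point at the indices i and i + 1: the two opposite faces then agree.
      faceColour-shift : ∀ {y c} (i : Fin m) → FaceColour (inject₁ i) y c → FaceColour (suc i) y c
      faceColour-shift {y} {c} i Φ@(x , e , u) = x′ , face-suc ,
        h-⊆ (Diag (inject₁ i) (suc i) B.∧ Coloured (inject₁ i) c) (Coloured (suc i) c) (points x′)
          (coloured-diag c (inject₁≢suc i))
          (h-∧ (Diag (inject₁ i) (suc i)) (Coloured (inject₁ i) c) (points x′)
            (points-same x′ repeat) (faceColour-any Φ x′ face-inject₁))
        where
        x′ : Fin n → ℕ
        x′ = x [ inject₁ i ≔ x (suc i) ]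
        repeat : x′ (inject₁ i) ≡ x′ (suc i)
        repeat = ≡-trans (≔-same x (inject₁ i) _) (sym (≔-other x λ s≡i → inject₁≢suc i (sym s≡i)))
        face-inject₁ : ∀ k → x′ (punchIn (inject₁ i) k) ≡ y k
        face-inject₁ k = ≡-trans (≔-other x (Finₚ.punchInᵢ≢i (inject₁ i) k)) (e k)
        face-suc : ∀ k → x′ (punchIn (suc i) k) ≡ y k
        face-suc k = ≡-trans (sym (punchIn-adjacent i x′ repeat k)) (face-inject₁ k)

      increasing-distinct : ∀ {r} {y : Fin r → ℕ} → IncreasingTuple y → ∀ {j k} → j ≢ k → y j ≢ y k
      increasing-distinct inc {j} {k} j≢k e with Finₚ.<-cmp j k
      ... | tri< j<k _ _ = ℕₚ.<-irrefl e (inc j<k)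
      ... | tri≈ _ j≡k _ = j≢k j≡k
      ... | tri> _ _ k<j = ℕₚ.<-irrefl (sym e) (inc k<j)

      not-degenerate : ∀ x i j l → (j ≢ i → l ≢ i → j ≢ l → x j ≢ x l) → ¬ h (Degenerate i j l) (points x)
      not-degenerate x i j l distinct u with em {P = j ≢ i × l ≢ i × j ≢ l}
      ... | no ¬c               = h-empty (Degenerate i j l) (points x) (λ a (c , _) → ¬c (lower c)) u
      ... | yes (j≢i , l≢i , j≢l) = points-distinct x j≢l (distinct j≢i l≢i j≢l)
            (h-⊆ (Degenerate i j l) (Diag j l) (points x) (λ a → proj₂) u)

      faceColour-exists : ∀ y → IncreasingTuple y → ∃[ c ] FaceColour i₀ y c
      faceColour-exists y inc = result (h-∨ (⋃ (Coloured i₀)) degenerate (points x)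
        (h-total (⋃ (Coloured i₀) B.∨ degenerate) (points x) (coloured-or-degenerate i₀)))
        where
        x : Fin n → ℕ
        -- Index `i₀` lies outside the face; the value there is arbitrary and may repeat an entry of
        -- `y`.
        x zero    = 0
        x (suc k) = y k
        degenerate : B.Carrier
        degenerate = ⋃ λ j → ⋃ λ l → Degenerate i₀ j l
        distinct : ∀ j l → j ≢ i₀ → l ≢ i₀ → j ≢ l → x j ≢ x l
        distinct zero    l       j≢0 _   _   = ⊥-elim (j≢0 refl)
        distinct (suc j) zero    _   l≢0 _   = ⊥-elim (l≢0 refl)
        distinct (suc j) (suc l) _   _   j≢l = increasing-distinct inc λ e → j≢l (cong suc e)
        result : h (⋃ (Coloured i₀)) (points x) ⊎ h degenerate (points x) → ∃[ c ] FaceColour i₀ y c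
        result (inj₁ u) = let c , v = h-⋃ (Coloured i₀) (points x) u in c , x , (λ k → refl) , v
        result (inj₂ u) =
          let j , u′ = h-⋃ (λ j → ⋃ λ l → Degenerate i₀ j l) (points x) u
              l , v  = h-⋃ (λ l → Degenerate i₀ j l) (points x) u′
          in ⊥-elim (not-degenerate x i₀ j l (distinct j l) v)

      chosenColour : Σ[ c ∈ ((Fin m → ℕ) → Fin C) ] (∀ y → IncreasingTuple y → FaceColour i₀ y (c y))
      chosenColour = (λ y → proj₁ (choice y)) , λ y → proj₂ (choice y)
        where
        choice : ∀ y → Σ[ c ∈ Fin C ] (IncreasingTuple y → FaceColour i₀ y c)
        choice y with em {P = IncreasingTuple y}
        ... | yes inc = let c , Φ = faceColour-exists y inc in c , λ _ → Φ
        -- A default colour, obtained from an actual face since `C` is not known to be positive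
        -- beforehand.
        ... | no ¬inc = proj₁ (faceColour-exists toℕ λ i<j → i<j) ,
                        λ inc → ⊥-elim (¬inc λ {i} {j} → inc {i} {j})

      -- Ramsey's theorem is applied to increasing `m`-tuples, coloured as faces opposite to `i₀`.
      -- For `n` points of the homogeneous set, `faceColour-shift` moves the colour of each face
      -- from `i₀` to its proper index.
      contradiction : ⊥
      contradiction =
        let f , f-inc , c , homogeneous = ramsey m (proj₁ chosenColour)
            x : Fin n → ℕ
            x i = f (toℕ i)
            monochromatic : ∀ i → h (Coloured i c) (points x)
            monochromatic i =
              let y-inc : IncreasingTuple (λ k → toℕ (punchIn i k))
                  y-inc {j} {k} j<k = ℕₚ.≤∧≢⇒< (Finₚ.punchIn-mono-≤ i j k (ℕₚ.<⇒≤ j<k)) λ e →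
                    ℕₚ.<-irrefl (cong toℕ (Finₚ.punchIn-injective i j k (Finₚ.toℕ-injective e))) j<k
                  Φ₀ = subst (FaceColour i₀ (λ k → x (punchIn i k)))
                         (homogeneous (λ k → toℕ (punchIn i k)) y-inc)
                         (proj₂ chosenColour (λ k → x (punchIn i k)) (λ j<k → f-inc (y-inc j<k)))
              in faceColour-any {i} (<-weakInduction (λ i′ → FaceColour i′ (λ k → x (punchIn i k)) c)
                   Φ₀ faceColour-shift i) x (λ k → refl)
            i , u = h-⋃ (λ i → B.∁ (Coloured i c)) (points x)
                      (h-total (⋃ λ i → B.∁ (Coloured i c)) (points x) (not-all-coloured c))
        in h-∁ (Coloured i c) (points x) u (monochromatic i)

    -- Injectivity provides a factor and a tuple in the image of the nonempty `Pinched∞`, from which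
    -- the argument starts.
    not-representable : ¬ Representable (complexRaw S∞)
    not-representable (I , b , sub , iso) = nowhere λ i s u →
      Homomorphism.contradiction {Z = Sort (b i)} (h i)
        (λ X Y s X⊆Y v → proj₂ (to (H.∧-homo X Y i s) (from (H.cong (∧-absorbs X Y X⊆Y) i s) v)))
        (λ X Y s v w → from (H.∧-homo X Y i s) (v , w))
        (λ X Y s → to (H.∨-homo X Y i s))
        (λ X s → to (H.∁-homo X i s))
        (λ s → from (H.𝟙-homo i s) (lift tt))
        (λ j X s t e v → from (H.op-homo (cyl j) X i s) (t , v , e))
        (λ j X s → to (H.op-homo (cyl j) X i s))
        s u
      where
      module J = _≅_ iso
      module H = IsHomomorphism J.isHomomorphism
      h : ∀ i → B.Carrier → Unit (b i) → Set _
      h i X = proj₁ (J.to X) i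
      ∧-absorbs : ∀ X Y → X ⊆ Y → (X B.∧ Y) B.≈ X
      ∧-absorbs X Y X⊆Y a = mk⇔ proj₁ λ x → x , X⊆Y a x
      nowhere : ¬ (∀ i s → ¬ h i Pinched∞ s)
      nowhere empty = let a , p = pinched∞-exists in
        lower (to (proj₁ J.bijective {Pinched∞} {B.𝟘}
          (λ i s → mk⇔ (λ u → ⊥-elim (empty i s u)) (λ u → ⊥-elim (lower (to (H.𝟘-homo i s) u)))) a) p)

  -- The graphs, their limit and the conclusion.

  module Construction {ℓ : Level} {m : ℕ} (2<n : 2 < suc m) (σ : Signature) where
    open import Data.Fin.Base using (combine)
    open import Data.Vec.Functional using ([])

    n N : ℕ
    n = suc m
    N = suc (n * 2 ^ n)

    V : Set ℓ
    V = Lift ℓ ((ℕ → ℕ) × Fin N)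

    sequence : V → ℕ → ℕ
    sequence (lift (f , _)) = f

    copy : V → Fin N
    copy (lift (_ , c)) = c

    infix 4 _~[_]_
    _~[_]_ : V → ℕ → V → Set
    v ~[ k ] w = copy v ≢ copy w ⊎ ShiftEdge k (sequence v) (sequence w)

    ~-sym : ∀ {k v w} → v ~[ k ] w → w ~[ k ] v
    ~-sym = Sum.map (λ c≢d e → c≢d (sym e)) Sum.swap

    ~-uncolourable : ∀ k c {C} (f : V → Fin C) →
                     ¬ (∀ v w → copy v ≡ c → copy w ≡ c → v ~[ k ] w → f v ≢ f w)
    ~-uncolourable k c f proper = shift-uncolourable k (λ g → f (lift (g , c))) λ g h s →
      proper (lift (g , c)) (lift (h , c)) refl refl (inj₂ (inj₁ s))

    factor-stronglyRepresentable : ∀ k →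
      StronglyRepresentable (LabelledAtoms.atomStructure n V (λ v w → v ~[ k ] w) σ)
    factor-stronglyRepresentable k = Embedding.stronglyRepresentable 2<n ℕₚ.≤-refl
      (λ v w → v ~[ k ] w) (~-sym {k}) copy inj₁ (~-uncolourable k) σ

    U : Ultrafilter ℕ
    U = nonprincipal

    Limit : (∀ k → (ℕ → ℕ) → (ℕ → ℕ) → Set) → (ℕ → ℕ → ℕ) → (ℕ → ℕ → ℕ) → Set
    Limit R x y = U ∋ λ k → R k (x k) (y k)

    limit-walk : ∀ {L x y} → Walk (Limit λ _ → _≡_) (Limit ShiftEdge) L x y →
                 U ∋ λ k → Walk _≡_ (ShiftEdge k) L (x k) (y k)
    limit-walk (nil e)    = ∋-mono U (λ _ → nil) e
    limit-walk (snoc w r) = ∋-mono₂ U (λ _ → snoc) (limit-walk w) r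

    -- A walk of fixed length `L` in the limit is a walk in almost all factors, hence in one with
    -- `L ≤ k`, where short closed walks are even.
    limit-even : ∀ {L x} → Walk (Limit λ _ → _≡_) (Limit ShiftEdge) L x x → parity L ≡ false
    limit-even {L} w = let k , w′ , L≤k = ∋-witness U (∋-∩ U (limit-walk w) (eventually L λ _ le → le)) in
      closedWalk-even L≤k w′

    module Two = TwoColouring {E = Limit λ _ → _≡_} {A = Limit ShiftEdge}
      (∋-all U λ _ → refl) (∋-mono U λ _ → sym) (∋-mono₂ U λ _ → ≡-trans)
      (∋-mono U λ _ → Sum.swap) (∋-mono₂ U λ k r e → subst (ShiftEdge k _) e r) limit-even

    limitCopy : (x : ℕ → V) → ∃[ c ] (U ∋ λ k → copy (x k) ≡ c)
    limitCopy x = ∋-∃Fin U (∋-all U λ k → copy (x k) , refl)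

    side : (ℕ → V) → Bool
    side x = Two.colour (λ k → sequence (x k))

    -- The copy in which a sequence of vertices almost always lies, paired with its side in the
    -- bipartition of the limit. An edge of either kind changes a component.
    colour : (ℕ → V) → Fin (N * 2)
    colour x = combine (proj₁ (limitCopy x)) (bit (side x))

    colour-resp : ∀ {x y} → U ∋ (λ k → x k ≡ y k) → colour x ≡ colour y
    colour-resp {x} {y} e =
      cong₂ combine copies (cong bit (Two.colour-resp (∋-mono U (λ _ → cong sequence) e)))
      where
      copies : proj₁ (limitCopy x) ≡ proj₁ (limitCopy y)
      copies = let _ , (e₁ , e₂) , e₃ =
                     ∋-witness U (∋-∩ U (∋-∩ U e (proj₂ (limitCopy x))) (proj₂ (limitCopy y)))
               in ≡-trans (sym e₂) (≡-trans (cong copy e₁) e₃)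

    colour-proper : ∀ {x y} → U ∋ (λ k → x k ~[ k ] y k) → colour x ≢ colour y
    colour-proper {x} {y} u e
      with Finₚ.combine-injective (proj₁ (limitCopy x)) (bit (side x))
                                  (proj₁ (limitCopy y)) (bit (side y)) e
         | ∋-⊎ U u
    ... | _ , bits   | inj₂ edge = Two.colour-proper edge (bit-injective bits)
    ... | copies , _ | inj₁ differ =
      let _ , (c≢d , e₁) , e₂ =
            ∋-witness U (∋-∩ U (∋-∩ U differ (proj₂ (limitCopy x))) (proj₂ (limitCopy y)))
      in c≢d (≡-trans e₁ (≡-trans copies (sym e₂)))

    open UltraproductComplex 2<n σ _~[_]_ U {N * 2} colour (λ {x} {y} → colour-resp {x} {y})
      (λ {x} {y} → colour-proper {x} {y})
      -- An infinite supply of distinct labels: constant sequences, told apart by their first term.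
      (λ v → lift ((λ _ → v) , zero)) (λ e → cong (λ v → sequence v 0) e)
      using (S∞; factor; not-representable; module Factor)

    not-elementary : ¬ Elementary (StronglyRepresentable {n} {σ} {ℓ})
    not-elementary (Γ , axiomatises) = not-representable
      (Equivalence.from (axiomatises S∞) limit-satisfies (complex S∞) (complex-atomic S∞) (At-complex S∞))
      where
      limit-satisfies : ∀ φ → Γ φ → S∞ ⊨ φ
      limit-satisfies φ γ = Equivalence.from (łoś U factor (λ k → proj₁ (Factor.pinched-exists k)) φ [])
        (∋-all U λ k → subst (λ v → Satisfies (factor k) v φ) (ext λ ())
          (Equivalence.to (axiomatises (factor k)) (factor-stronglyRepresentable k) φ γ))

theorem6p12 : (∀ {a} → ExcludedMiddle a) → (∀ {a b} → Extensionality a b) →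
    ∀ {ℓ : Level} (n : ℕ) → 2 < n → (σ : Signature) →
    ¬ Elementary (StronglyRepresentable {n} {σ} {ℓ})
theorem6p12 em ext (suc m) 2<n σ = Construction.not-elementary em ext 2<n σ
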